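{- For all integers $s\ge 33$ and $n\ge 3s+3$, $m(n,s)=M(n,s)$, where $$m(n,s)=\max\{|\mathcal{F}|:\ \mathcal{F}\text{ is a 3-uniform hypergraph with } |V(\mathcal{F})|=n \text{ and } \nu(\mathcal{F})=s\}$$ and $$M(n,s)=\max\left\{\binom{3s+2}{3},\ \binom n3-\binom{n-s}3\right\}.$$ That is, every 3-uniform hypergraph on $n\ge 3s+3$ vertices with matching number $s\ge 33$ has at most $\max\left\{\binom{3s+2}{3},\binom n3-\binom{n-s}3\right\}$ edges, and this bound is attained.
   Context: A 3-uniform hypergraph (3-graph) $\mathcal{F}$ is a family of 3-element subsets (edges) of a finite vertex set $V(\mathcal{F})$; $|\mathcal{F}|$ denotes the number of edges. $\nu(\mathcal{F})$ denotes the matching number of $\mathcal{F}$, i.e. the maximum number of pairwise disjoint edges of $\mathcal{F}$. -}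

module Defs where

open import Data.Nat using (ℕ; _≤_; _∸_; _⊔_; _+_; _*_)
open import Data.Nat.Combinatorics using (_C_)
open import Data.Fin.Subset using (Subset; ∣_∣; _∩_; ⊥)
open import Data.List using (List; length)
open import Data.List.Relation.Unary.All using (All)
open import Data.List.Relation.Unary.AllPairs using (AllPairs)
open import Data.List.Relation.Unary.Unique.Propositional using (Unique)
open import Data.List.Membership.Propositional using (_∈_)
open import Data.Product using (_×_; Σ)
open import Relation.Binary.PropositionalEquality using (_≡_)

record ThreeGraph (n : ℕ) : Set where
  field
    edges    : List (Subset n)
    uniform  : All (λ e → ∣ e ∣ ≡ 3) edges
    distinct : Unique edges

open ThreeGraph public

size : ∀ {n} → ThreeGraph n → ℕ
size F = length (edges F)

Disjoint : ∀ {n} → Subset n → Subset n → Set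
Disjoint e f = e ∩ f ≡ ⊥

IsMatching : ∀ {n} → ThreeGraph n → List (Subset n) → Set
IsMatching F M = All (_∈ edges F) M × AllPairs Disjoint M

MatchingNumberIs : ∀ {n} → ThreeGraph n → ℕ → Set
MatchingNumberIs F s =
  Σ (List _) (λ M → IsMatching F M × length M ≡ s)
  × (∀ M → IsMatching F M → length M ≤ s)

Mbound : ℕ → ℕ → ℕ
Mbound n s = ((3 * s + 2) C 3) ⊔ ((n C 3) ∸ ((n ∸ s) C 3))

{-# OPTIONS --safe #-}

-- Compressing adjacent vertices makes the family F shifted without changing its size or increasing ν(F).
-- Either every matching of size s uses the vertex 0, and deleting 0 gives the bound by induction on s,
-- or, F being shifted, there is a matching M of size s that partitions {1, …, 3s}. In the second case no
-- edge has two vertices above 3s, so that with H the link of u = 3s + 2 and D = n − 3s − 2,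
--   |F| ≤ C(3s + 2, 3) − missing + D |H|,   missing = number of non-edges inside {0, …, 3s + 1}.
-- A set of disjoint edges of F and pairs of H below u + 1 has at most s members, because unused vertices
-- complete the pairs to edges. Exchanging two or three edges of M therefore forces non-edges among the
-- transversals of these edges wherever H has pairs; for an M containing as many pairs of H as possible
-- this gives 15 · missing ≥ 8 (s − 2) |H| and |H| ≤ s (2s + 1). If 15 D ≤ 8 (s − 2) the clique bound
-- follows, and otherwise the star bound, by a polynomial inequality that needs s ≥ 33. The induction
-- also passes through s ≤ 32, but only with n ≥ s + 84, where the star bound is the larger one.
module Submission where

open import Defs
open import Data.Bool using (Bool; true; false; T; _∧_; _∨_; not; if_then_else_)
open import Data.Bool.Properties using (∧-zeroʳ; ∨-comm)
open import Data.Empty using (⊥; ⊥-elim)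
open import Data.Fin.Subset using (Subset; ∣_∣; _∩_; ∁)
import Data.Fin.Subset as Sub
open import Data.Fin.Subset.Properties using (∣⊥∣≡0; ∣⊤∣≡n; ∩-comm; ∩-zeroˡ)
open import Data.List using (List; []; _∷_; _++_; map; length; concatMap; take)
open import Data.List.Membership.Propositional using (_∈_)
open import Data.List.Membership.Propositional.Properties using (∈-∃++; ∈-map⁺; ∈-map⁻; ∈-++⁺ˡ; ∈-++⁺ʳ)
open import Data.List.Properties using (length-++; length-map; length-take; map-++; ++-assoc; ++-identityʳ)
open import Data.List.Relation.Binary.Permutation.Propositional using (_↭_; refl; prep; swap; trans; ↭-sym; ↭-reflexive)
open import Data.List.Relation.Binary.Permutation.Propositional.Properties using (shift; ↭-length; ++⁺; ++⁺ˡ; ++⁺ʳ; All-resp-↭; map⁺; ++-comm; ∈-resp-↭)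
open import Data.List.Relation.Unary.All as All using (All; []; _∷_)
import Data.List.Relation.Unary.All.Properties as AllP
open import Data.List.Relation.Unary.AllPairs using (AllPairs; []; _∷_)
open import Data.List.Relation.Unary.Any using (here; there)
open import Data.List.Relation.Unary.Unique.Propositional using (Unique)
import Data.List.Relation.Unary.Unique.Propositional.Properties as UniqueP
open import Data.Nat
open import Data.Nat.Combinatorics using (_C_; nC1≡n; nCk+nC[k+1]≡[n+1]C[k+1]; k>n⇒nCk≡0)
open import Data.Nat.ListAction using (sum)
open import Data.Nat.ListAction.Properties using (sum-++)
open import Data.Nat.Properties
open import Data.Nat.Solver using (module +-*-Solver)
open +-*-Solver using (solve; con; _:+_; _:*_; _:=_)
open import Data.Product using (_×_; _,_; Σ; ∃; proj₁; proj₂)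
open import Data.Sum using (_⊎_; inj₁; inj₂)
open import Data.Unit using (⊤; tt)
open import Data.Vec using ([]; _∷_; head; tail)
open import Function using (_∘_; id)
open import Relation.Binary.Definitions using (tri<; tri≈; tri>)
open import Relation.Binary.PropositionalEquality as ≡ using (_≡_; _≢_; refl; sym; cong; cong₂; subst; module ≡-Reasoning)
open import Relation.Nullary using (¬_; Dec; yes; no; contradiction)

-- The weights 8 and 15 come from comparing pairs of `H` with non-edges, block by block. The binding
-- configuration is three blocks joined by up to 11 pairs of `H`, where the exchanges yield 6
-- missing transversals: locally any ratio up to 6/11 would do, and 8/15 lies just below it while
-- still being large enough for the final inequality. The obstacle is an empty block, one whose
-- vertices form no pair of `H` with 0. Their cost is met from the pairs of blocks: an empty block
-- has no inner pairs of `H`, so there the estimate for the pair has a surplus. The range n ≥ s + 84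
-- for small s is chosen because deleting 0 keeps n - s. At s = 33 it leaves out n < 117, and these
-- n follow by regarding the family as one on 117 vertices, where the clique bound is still the
-- larger one.

private variable
  A B : Set

-- Sums over the elements, the 2-subsets and the 3-subsets of a list

S1 : List A → (A → ℕ) → ℕ
S1 []       φ = 0
S1 (x ∷ xs) φ = φ x + S1 xs φ

S2 : List A → (A → A → ℕ) → ℕ
S2 []       φ = 0
S2 (x ∷ xs) φ = S1 xs (φ x) + S2 xs φ

S3 : List A → (A → A → A → ℕ) → ℕ
S3 []       φ = 0
S3 (x ∷ xs) φ = S2 xs (φ x) + S3 xs φ

S1-cong : ∀ {φ ψ : A → ℕ} xs → (∀ x → φ x ≡ ψ x) → S1 xs φ ≡ S1 xs ψ
S1-cong []       h = refl
S1-cong (x ∷ xs) h = cong₂ _+_ (h x) (S1-cong xs h)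

S2-cong : ∀ {φ ψ : A → A → ℕ} xs → (∀ x y → φ x y ≡ ψ x y) → S2 xs φ ≡ S2 xs ψ
S2-cong []       h = refl
S2-cong (x ∷ xs) h = cong₂ _+_ (S1-cong xs (h x)) (S2-cong xs h)

S3-cong : ∀ {φ ψ : A → A → A → ℕ} xs → (∀ x y z → φ x y z ≡ ψ x y z) → S3 xs φ ≡ S3 xs ψ
S3-cong []       h = refl
S3-cong (x ∷ xs) h = cong₂ _+_ (S2-cong xs (h x)) (S3-cong xs h)

S1-mono : ∀ {φ ψ : A → ℕ} {Q : A → Set} {xs} → All Q xs →
  (∀ {x} → Q x → φ x ≤ ψ x) → S1 xs φ ≤ S1 xs ψ
S1-mono []       h = z≤n
S1-mono (q ∷ qs) h = +-mono-≤ (h q) (S1-mono qs h)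

S2-mono : ∀ {φ ψ : A → A → ℕ} {Q : A → Set} {xs} → All Q xs →
  (∀ {x y} → Q x → Q y → φ x y ≤ ψ x y) → S2 xs φ ≤ S2 xs ψ
S2-mono []       h = z≤n
S2-mono (q ∷ qs) h = +-mono-≤ (S1-mono qs (h q)) (S2-mono qs h)

S3-mono : ∀ {φ ψ : A → A → A → ℕ} {Q : A → Set} {xs} → All Q xs →
  (∀ {x y z} → Q x → Q y → Q z → φ x y z ≤ ψ x y z) → S3 xs φ ≤ S3 xs ψ
S3-mono []       h = z≤n
S3-mono (q ∷ qs) h = +-mono-≤ (S2-mono qs (h q)) (S3-mono qs h)

-- The terms are compared with a permutation at hand that brings `e` to the front: the exchange
-- arguments need the remaining blocks `R`, not only `e`. Likewise for the two variants below.
S1-mono↭ : ∀ {φ ψ : A → ℕ} xs →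
  (∀ e R → xs ↭ e ∷ R → φ e ≤ ψ e) → S1 xs φ ≤ S1 xs ψ
S1-mono↭ []       h = z≤n
S1-mono↭ (x ∷ xs) h = +-mono-≤ (h x xs refl)
  (S1-mono↭ xs λ e R p → h e (x ∷ R) (trans (prep x p) (swap x e refl)))

S2-mono↭ : ∀ {φ ψ : A → A → ℕ} xs →
  (∀ e f R → xs ↭ e ∷ f ∷ R → φ e f ≤ ψ e f) → S2 xs φ ≤ S2 xs ψ
S2-mono↭ []       h = z≤n
S2-mono↭ (x ∷ xs) h = +-mono-≤ (S1-mono↭ xs λ e R p → h x e R (prep x p))
  (S2-mono↭ xs λ e f R p → h e f (x ∷ R)
    (trans (prep x p) (↭-sym (shift x (e ∷ f ∷ []) R))))

S3-mono↭ : ∀ {φ ψ : A → A → A → ℕ} xs →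
  (∀ e f g R → xs ↭ e ∷ f ∷ g ∷ R → φ e f g ≤ ψ e f g) → S3 xs φ ≤ S3 xs ψ
S3-mono↭ []       h = z≤n
S3-mono↭ (x ∷ xs) h = +-mono-≤ (S2-mono↭ xs λ e f R p → h x e f R (prep x p))
  (S3-mono↭ xs λ e f g R p → h e f g (x ∷ R)
    (trans (prep x p) (↭-sym (shift x (e ∷ f ∷ g ∷ []) R))))

private
  +-exchange : ∀ a b c d → (a + b) + (c + d) ≡ (a + c) + (b + d)
  +-exchange = solve 4 (λ a b c d → (a :+ b) :+ (c :+ d) := (a :+ c) :+ (b :+ d)) refl

S1-+ : ∀ (φ ψ : A → ℕ) xs → S1 xs (λ x → φ x + ψ x) ≡ S1 xs φ + S1 xs ψ
S1-+ φ ψ []       = refl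
S1-+ φ ψ (x ∷ xs) = ≡.trans (cong (φ x + ψ x +_) (S1-+ φ ψ xs)) (+-exchange (φ x) (ψ x) _ _)

S2-+ : ∀ (φ ψ : A → A → ℕ) xs → S2 xs (λ x y → φ x y + ψ x y) ≡ S2 xs φ + S2 xs ψ
S2-+ φ ψ []       = refl
S2-+ φ ψ (x ∷ xs) = ≡.trans (cong₂ _+_ (S1-+ (φ x) (ψ x) xs) (S2-+ φ ψ xs)) (+-exchange (S1 xs (φ x)) _ _ _)

S3-+ : ∀ (φ ψ : A → A → A → ℕ) xs → S3 xs (λ x y z → φ x y z + ψ x y z) ≡ S3 xs φ + S3 xs ψ
S3-+ φ ψ []       = refl
S3-+ φ ψ (x ∷ xs) = ≡.trans (cong₂ _+_ (S2-+ (φ x) (ψ x) xs) (S3-+ φ ψ xs)) (+-exchange (S2 xs (φ x)) _ _ _)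

S1-* : ∀ c (φ : A → ℕ) xs → S1 xs (λ x → c * φ x) ≡ c * S1 xs φ
S1-* c φ []       = sym (*-zeroʳ c)
S1-* c φ (x ∷ xs) = ≡.trans (cong (c * φ x +_) (S1-* c φ xs)) (sym (*-distribˡ-+ c (φ x) _))

S2-* : ∀ c (φ : A → A → ℕ) xs → S2 xs (λ x y → c * φ x y) ≡ c * S2 xs φ
S2-* c φ []       = sym (*-zeroʳ c)
S2-* c φ (x ∷ xs) = ≡.trans (cong₂ _+_ (S1-* c (φ x) xs) (S2-* c φ xs)) (sym (*-distribˡ-+ c (S1 xs (φ x)) _))

S3-* : ∀ c (φ : A → A → A → ℕ) xs → S3 xs (λ x y z → c * φ x y z) ≡ c * S3 xs φ
S3-* c φ []       = sym (*-zeroʳ c)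
S3-* c φ (x ∷ xs) = ≡.trans (cong₂ _+_ (S2-* c (φ x) xs) (S3-* c φ xs)) (sym (*-distribˡ-+ c (S2 xs (φ x)) _))

S1-const : ∀ c (xs : List A) → S1 xs (λ _ → c) ≡ length xs * c
S1-const c []       = refl
S1-const c (x ∷ xs) = cong (c +_) (S1-const c xs)

S1-zero : ∀ (xs : List A) → S1 xs (λ _ → 0) ≡ 0
S1-zero xs = ≡.trans (S1-const 0 xs) (*-zeroʳ (length xs))

S1-swap : ∀ (φ : A → B → ℕ) xs ys →
  S1 xs (λ x → S1 ys (φ x)) ≡ S1 ys (λ y → S1 xs (λ x → φ x y))
S1-swap φ []       ys = sym (S1-zero ys)
S1-swap φ (x ∷ xs) ys = ≡.trans (cong (S1 ys (φ x) +_) (S1-swap φ xs ys))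
  (sym (S1-+ (φ x) (λ y → S1 xs (λ x → φ x y)) ys))

S2-swap : ∀ (ψ : A → A → B → ℕ) xs ys →
  S2 xs (λ x y → S1 ys (ψ x y)) ≡ S1 ys (λ f → S2 xs (λ x y → ψ x y f))
S2-swap ψ []       ys = sym (S1-zero ys)
S2-swap ψ (x ∷ xs) ys = ≡.trans (cong₂ _+_ (S1-swap (ψ x) xs ys) (S2-swap ψ xs ys))
  (sym (S1-+ (λ f → S1 xs (λ y → ψ x y f)) (λ f → S2 xs (λ x y → ψ x y f)) ys))

S1-map : ∀ (f : A → B) (φ : B → ℕ) xs → S1 (map f xs) φ ≡ S1 xs (φ ∘ f)
S1-map f φ []       = refl
S1-map f φ (x ∷ xs) = cong (φ (f x) +_) (S1-map f φ xs)

S2-map : ∀ (f : A → B) (φ : B → B → ℕ) xs → S2 (map f xs) φ ≡ S2 xs (λ x y → φ (f x) (f y))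
S2-map f φ []       = refl
S2-map f φ (x ∷ xs) = cong₂ _+_ (S1-map f (φ (f x)) xs) (S2-map f φ xs)

S3-map : ∀ (f : A → B) (φ : B → B → B → ℕ) xs →
  S3 (map f xs) φ ≡ S3 xs (λ x y z → φ (f x) (f y) (f z))
S3-map f φ []       = refl
S3-map f φ (x ∷ xs) = cong₂ _+_ (S2-map f (φ (f x)) xs) (S3-map f φ xs)

S1-++ : ∀ (φ : A → ℕ) xs ys → S1 (xs ++ ys) φ ≡ S1 xs φ + S1 ys φ
S1-++ φ []       ys = refl
S1-++ φ (x ∷ xs) ys = ≡.trans (cong (φ x +_) (S1-++ φ xs ys)) (sym (+-assoc (φ x) _ _))

S2-++ : ∀ (φ : A → A → ℕ) xs ys →
  S2 (xs ++ ys) φ ≡ S2 xs φ + (S1 xs (λ x → S1 ys (φ x)) + S2 ys φ)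
S2-++ φ []       ys = refl
S2-++ φ (x ∷ xs) ys = ≡.trans (cong₂ _+_ (S1-++ (φ x) xs ys) (S2-++ φ xs ys))
  (solve 5 (λ a b c d e → (a :+ b) :+ (c :+ (d :+ e)) := (a :+ c) :+ ((b :+ d) :+ e)) refl
    (S1 xs (φ x)) (S1 ys (φ x)) (S2 xs φ) (S1 xs (λ x → S1 ys (φ x))) (S2 ys φ))

S3-++ : ∀ (φ : A → A → A → ℕ) xs ys →
  S3 (xs ++ ys) φ ≡ S3 xs φ +
    (S2 xs (λ x y → S1 ys (φ x y)) + (S1 xs (λ x → S2 ys (φ x)) + S3 ys φ))
S3-++ φ []       ys = refl
S3-++ φ (x ∷ xs) ys = ≡.trans (cong₂ _+_ (S2-++ (φ x) xs ys) (S3-++ φ xs ys))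
  (solve 7 (λ a b c d e f g → (a :+ (b :+ c)) :+ (d :+ (e :+ (f :+ g)))
      := (a :+ d) :+ ((b :+ e) :+ ((c :+ f) :+ g))) refl
    (S2 xs (φ x)) (S1 xs (λ y → S1 ys (φ x y))) (S2 ys (φ x)) (S3 xs φ)
    (S2 xs (λ x y → S1 ys (φ x y))) (S1 xs (λ x → S2 ys (φ x))) (S3 ys φ))

Sym2 : (A → A → ℕ) → Set
Sym2 φ = ∀ x y → φ x y ≡ φ y x

Sym3 : (A → A → A → ℕ) → Set
Sym3 φ = (∀ x y z → φ x y z ≡ φ y x z) × (∀ x y z → φ x y z ≡ φ x z y)

S1-↭ : ∀ {φ : A → ℕ} {xs ys} → xs ↭ ys → S1 xs φ ≡ S1 ys φ
S1-↭ refl = refl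
S1-↭ (prep x p) = cong (_ +_) (S1-↭ p)
S1-↭ {φ = φ} (swap {xs} {ys} x y p) = ≡.trans (cong (λ t → φ x + (φ y + t)) (S1-↭ p))
  (solve 3 (λ a b c → a :+ (b :+ c) := b :+ (a :+ c)) refl (φ x) (φ y) (S1 ys φ))
S1-↭ (trans p q) = ≡.trans (S1-↭ p) (S1-↭ q)

S2-↭ : ∀ {φ : A → A → ℕ} → Sym2 φ → ∀ {xs ys} → xs ↭ ys → S2 xs φ ≡ S2 ys φ
S2-↭ s refl = refl
S2-↭ s (prep x p) = cong₂ _+_ (S1-↭ p) (S2-↭ s p)
S2-↭ {φ = φ} s (swap {xs} {ys} x y p) = ≡.trans
  (cong₂ _+_ (cong₂ _+_ (s x y) (S1-↭ p)) (cong₂ _+_ (S1-↭ p) (S2-↭ s p)))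
  (solve 4 (λ a b c d → (a :+ b) :+ (c :+ d) := (a :+ c) :+ (b :+ d)) refl
    (φ y x) (S1 ys (φ x)) (S1 ys (φ y)) (S2 ys φ))
S2-↭ s (trans p q) = ≡.trans (S2-↭ s p) (S2-↭ s q)

S3-↭ : ∀ {φ : A → A → A → ℕ} → Sym3 φ → ∀ {xs ys} → xs ↭ ys → S3 xs φ ≡ S3 ys φ
S3-↭ s refl = refl
S3-↭ s@(_ , s₂) (prep x p) = cong₂ _+_ (S2-↭ (s₂ x) p) (S3-↭ s p)
S3-↭ {φ = φ} s@(s₁ , s₂) (swap {xs} {ys} x y p) = ≡.trans
  (cong₂ _+_ (cong₂ _+_ (≡.trans (S1-cong xs (s₁ x y)) (S1-↭ p)) (S2-↭ (s₂ x) p))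
             (cong₂ _+_ (S2-↭ (s₂ y) p) (S3-↭ s p)))
  (solve 4 (λ a b c d → (a :+ b) :+ (c :+ d) := (a :+ c) :+ (b :+ d)) refl
    (S1 ys (φ y x)) (S2 ys (φ x)) (S2 ys (φ y)) (S3 ys φ))
S3-↭ s (trans p q) = ≡.trans (S3-↭ s p) (S3-↭ s q)

-- Each element lies in |M| - 1 pairs.
S2-double : ∀ (χ : A → ℕ) M → S2 M (λ e f → χ e + χ f) ≡ (length M ∸ 1) * S1 M χ
S2-double χ []      = refl
S2-double χ (e ∷ M) = begin
  S1 M (λ f → χ e + χ f) + S2 M (λ e f → χ e + χ f)
    ≡⟨ cong₂ _+_ (≡.trans (S1-+ (λ _ → χ e) χ M) (cong (_+ S1 M χ) (S1-const (χ e) M))) (S2-double χ M) ⟩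
  (length M * χ e + S1 M χ) + (length M ∸ 1) * S1 M χ ≡⟨ +-assoc (length M * χ e) _ _ ⟩
  length M * χ e + (S1 M χ + (length M ∸ 1) * S1 M χ) ≡⟨ cong (length M * χ e +_) (absorb M) ⟩
  length M * χ e + length M * S1 M χ ≡⟨ *-distribˡ-+ (length M) (χ e) (S1 M χ) ⟨
  length M * (χ e + S1 M χ) ∎
  where
  open ≡-Reasoning
  absorb : ∀ M → S1 M χ + (length M ∸ 1) * S1 M χ ≡ length M * S1 M χ
  absorb []      = refl
  absorb (_ ∷ M) = refl

-- Each pair lies in |M| - 2 triples; for |M| < 2 both sides vanish, so the truncated subtraction
-- does no harm.
S3-double : ∀ (ψ : A → A → ℕ) M →
  S3 M (λ e f g → ψ e f + (ψ e g + ψ f g)) ≡ (length M ∸ 2) * S2 M ψ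
S3-double ψ []      = refl
S3-double ψ (e ∷ M) = begin
  S2 M (λ f g → ψ e f + (ψ e g + ψ f g)) + S3 M (λ e f g → ψ e f + (ψ e g + ψ f g))
    ≡⟨ cong₂ _+_ (≡.trans (S2-cong M (λ f g → sym (+-assoc (ψ e f) (ψ e g) (ψ f g))))
        (≡.trans (S2-+ (λ f g → ψ e f + ψ e g) ψ M) (cong (_+ S2 M ψ) (S2-double (ψ e) M)))) (S3-double ψ M) ⟩
  ((length M ∸ 1) * S1 M (ψ e) + S2 M ψ) + (length M ∸ 2) * S2 M ψ
    ≡⟨ +-assoc ((length M ∸ 1) * S1 M (ψ e)) _ _ ⟩
  (length M ∸ 1) * S1 M (ψ e) + (S2 M ψ + (length M ∸ 2) * S2 M ψ)
    ≡⟨ cong ((length M ∸ 1) * S1 M (ψ e) +_) (absorb M) ⟩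
  (length M ∸ 1) * S1 M (ψ e) + (length M ∸ 1) * S2 M ψ
    ≡⟨ *-distribˡ-+ (length M ∸ 1) (S1 M (ψ e)) (S2 M ψ) ⟨
  (length M ∸ 1) * (S1 M (ψ e) + S2 M ψ) ∎
  where
  open ≡-Reasoning
  absorb : ∀ M → S2 M ψ + (length M ∸ 2) * S2 M ψ ≡ (length M ∸ 1) * S2 M ψ
  absorb []          = refl
  absorb (_ ∷ [])    = refl
  absorb (_ ∷ _ ∷ M) = refl

-- Sums over the vertices of a list of blocks

S1-concatMap : ∀ (v : A → List B) (φ : B → ℕ) M → S1 (concatMap v M) φ ≡ S1 M (λ e → S1 (v e) φ)
S1-concatMap v φ []      = refl
S1-concatMap v φ (e ∷ M) = ≡.trans (S1-++ φ (v e) (concatMap v M)) (cong (S1 (v e) φ +_) (S1-concatMap v φ M))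

S2-concatMap : ∀ (v : A → List B) (φ : B → B → ℕ) M → S2 (concatMap v M) φ
  ≡ S1 M (λ e → S2 (v e) φ) + S2 M (λ e f → S1 (v e) (λ x → S1 (v f) (φ x)))
S2-concatMap v φ []      = refl
S2-concatMap v φ (e ∷ M) = ≡.trans (S2-++ φ (v e) (concatMap v M))
  (≡.trans (cong₂ (λ a b → S2 (v e) φ + (a + b)) cross (S2-concatMap v φ M))
    (solve 4 (λ a b c d → a :+ (b :+ (c :+ d)) := (a :+ c) :+ (b :+ d)) refl
      (S2 (v e) φ) (S1 M (λ f → S1 (v e) (λ x → S1 (v f) (φ x))))
      (S1 M (λ e → S2 (v e) φ)) (S2 M (λ e f → S1 (v e) (λ x → S1 (v f) (φ x))))))
  where
  cross : S1 (v e) (λ x → S1 (concatMap v M) (φ x)) ≡ S1 M (λ f → S1 (v e) (λ x → S1 (v f) (φ x)))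
  cross = ≡.trans (S1-cong (v e) (λ x → S1-concatMap v (φ x) M)) (S1-swap (λ x f → S1 (v f) (φ x)) (v e) M)

-- Triples inside a single block are dropped, hence only an inequality. The blocks will be edges, so
-- for `miss` nothing is lost.
S3-concatMap : ∀ (v : A → List B) (φ : B → B → B → ℕ) M →
  S2 M (λ e f → S1 (v e) (λ x → S2 (v f) (φ x)) + S2 (v e) (λ x y → S1 (v f) (φ x y)))
  + S3 M (λ e f g → S1 (v e) (λ x → S1 (v f) (λ y → S1 (v g) (φ x y))))
  ≤ S3 (concatMap v M) φ
S3-concatMap v φ []      = z≤n
S3-concatMap {A = A} v φ (e ∷ M) = begin
  (S1 M (λ f → a f + b f) + S2 M (λ e f → S1 (v e) (λ x → S2 (v f) (φ x)) + S2 (v e) (λ x y → S1 (v f) (φ x y))))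
    + (c + S3 M (λ e f g → S1 (v e) (λ x → S1 (v f) (λ y → S1 (v g) (φ x y)))))
    ≡⟨ cong (λ t → (t + q) + (c + t3)) (S1-+ a b M) ⟩
  ((S1 M a + S1 M b) + q) + (c + t3)
    ≡⟨ solve 5 (λ a b q c t → ((a :+ b) :+ q) :+ (c :+ t) := b :+ ((a :+ c) :+ (q :+ t))) refl
        (S1 M a) (S1 M b) q c t3 ⟩
  S1 M b + ((S1 M a + c) + (q + t3))
    ≤⟨ +-mono-≤ (≤-reflexive (sym bcross)) (+-mono-≤ (≤-reflexive (sym across)) (S3-concatMap v φ M)) ⟩
  S2 (v e) (λ x y → S1 V (φ x y)) + (S1 (v e) (λ x → S2 V (φ x)) + S3 V φ)
    ≤⟨ m≤n+m _ (S3 (v e) φ) ⟩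
  S3 (v e) φ + (S2 (v e) (λ x y → S1 V (φ x y)) + (S1 (v e) (λ x → S2 V (φ x)) + S3 V φ))
    ≡⟨ S3-++ φ (v e) V ⟨
  S3 (v e ++ V) φ ∎
  where
  open ≤-Reasoning
  V = concatMap v M
  a b : A → ℕ
  a f = S1 (v e) (λ x → S2 (v f) (φ x))
  b f = S2 (v e) (λ x y → S1 (v f) (φ x y))
  c = S2 M (λ f g → S1 (v e) (λ x → S1 (v f) (λ y → S1 (v g) (φ x y))))
  q = S2 M (λ e f → S1 (v e) (λ x → S2 (v f) (φ x)) + S2 (v e) (λ x y → S1 (v f) (φ x y)))
  t3 = S3 M (λ e f g → S1 (v e) (λ x → S1 (v f) (λ y → S1 (v g) (φ x y))))
  bcross : S2 (v e) (λ x y → S1 V (φ x y)) ≡ S1 M b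
  bcross = ≡.trans (S2-cong (v e) (λ x y → S1-concatMap v (φ x y) M)) (S2-swap (λ x y f → S1 (v f) (φ x y)) (v e) M)
  across : S1 (v e) (λ x → S2 V (φ x)) ≡ S1 M a + c
  across = ≡.trans (S1-cong (v e) (λ x → S2-concatMap v (φ x) M))
    (≡.trans (S1-+ (λ x → S1 M (λ e → S2 (v e) (φ x))) (λ x → S2 M (λ f g → S1 (v f) (λ y → S1 (v g) (φ x y)))) (v e))
      (cong₂ _+_ (S1-swap (λ x e → S2 (v e) (φ x)) (v e) M)
        (sym (S2-swap (λ f g x → S1 (v f) (λ y → S1 (v g) (φ x y))) M (v e)))))

-- C(n, 2) and C(n, 3) by Pascal's rule, which is also the recursion of `S2` and `S3`; `c2≡C` and
-- `c3≡C` identify them with `_C_`.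
c2 c3 : ℕ → ℕ
c2 zero    = 0
c2 (suc n) = n + c2 n
c3 zero    = 0
c3 (suc n) = c2 n + c3 n

S2-one : ∀ (xs : List A) → S2 xs (λ _ _ → 1) ≡ c2 (length xs)
S2-one []       = refl
S2-one (x ∷ xs) = cong₂ _+_ (≡.trans (S1-const 1 xs) (*-identityʳ (length xs))) (S2-one xs)

S3-one : ∀ (xs : List A) → S3 xs (λ _ _ _ → 1) ≡ c3 (length xs)
S3-one []       = refl
S3-one (x ∷ xs) = cong₂ _+_ (S2-one xs) (S3-one xs)

2*c2 : ∀ n → 2 * c2 n + n ≡ n * n
2*c2 zero    = refl
2*c2 (suc n) = begin
  2 * (n + c2 n) + suc n       ≡⟨ solve 2 (λ n c → con 2 :* (n :+ c) :+ (con 1 :+ n) := (con 2 :* c :+ n) :+ (con 2 :* n :+ con 1)) refl n (c2 n) ⟩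
  (2 * c2 n + n) + (2 * n + 1) ≡⟨ cong (_+ (2 * n + 1)) (2*c2 n) ⟩
  n * n + (2 * n + 1)          ≡⟨ solve 1 (λ n → n :* n :+ (con 2 :* n :+ con 1) := (con 1 :+ n) :* (con 1 :+ n)) refl n ⟩
  suc n * suc n ∎
  where
  open ≡-Reasoning

-- Lists without repetitions

Unique-↭ : ∀ {xs ys : List A} → xs ↭ ys → Unique xs → Unique ys
Unique-↭ refl        u = u
Unique-↭ (prep x p)  (a ∷ u) = All-resp-↭ p a ∷ Unique-↭ p u
Unique-↭ (swap x y p) ((x≢y ∷ a) ∷ b ∷ u) =
  ((x≢y ∘ sym) ∷ All-resp-↭ p b) ∷ All-resp-↭ p a ∷ Unique-↭ p u
Unique-↭ (trans p q) u = Unique-↭ q (Unique-↭ p u)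

Unique-++⁻ˡ : ∀ (xs : List A) {ys} → Unique (xs ++ ys) → Unique xs
Unique-++⁻ˡ []       _       = []
Unique-++⁻ˡ (x ∷ xs) (a ∷ u) = AllP.++⁻ˡ xs a ∷ Unique-++⁻ˡ xs u

Unique-++⁻ʳ : ∀ (xs : List A) {ys} → Unique (xs ++ ys) → Unique ys
Unique-++⁻ʳ []       u       = u
Unique-++⁻ʳ (x ∷ xs) (_ ∷ u) = Unique-++⁻ʳ xs u

range : ℕ → List ℕ
range zero    = []
range (suc n) = 0 ∷ map suc (range n)

length-range : ∀ n → length (range n) ≡ n
length-range zero    = refl
length-range (suc n) = cong suc (≡.trans (length-map suc (range n)) (length-range n))

range-< : ∀ n → All (_< n) (range n)
range-< zero    = []
range-< (suc n) = z<s ∷ AllP.map⁺ (All.map s<s (range-< n))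

range-unique : ∀ n → Unique (range n)
range-unique zero    = []
range-unique (suc n) = AllP.map⁺ (All.map (λ _ ()) (range-< n)) ∷ UniqueP.map⁺ suc-injective (range-unique n)

∈-range : ∀ {x n} → x < n → x ∈ range n
∈-range {zero}  {suc n} _       = here refl
∈-range {suc x} {suc n} (s<s p) = there (∈-map⁺ suc (∈-range p))

range-+ : ∀ m n → range (m + n) ≡ range m ++ map (m +_) (range n)
range-+ zero    n = sym (map-id (range n))
  where
  map-id : ∀ (xs : List ℕ) → map id xs ≡ xs
  map-id []       = refl
  map-id (x ∷ xs) = cong (x ∷_) (map-id xs)
range-+ (suc m) n = cong (0 ∷_) (begin
  map suc (range (m + n)) ≡⟨ cong (map suc) (range-+ m n) ⟩
  map suc (range m ++ map (m +_) (range n)) ≡⟨ map-++ suc (range m) _ ⟩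
  map suc (range m) ++ map suc (map (m +_) (range n)) ≡⟨ cong (map suc (range m) ++_) (map-map (range n)) ⟩
  map suc (range m) ++ map (suc m +_) (range n) ∎)
  where
  open ≡-Reasoning
  map-map : ∀ xs → map suc (map (m +_) xs) ≡ map (suc m +_) xs
  map-map []       = refl
  map-map (x ∷ xs) = cong (_ ∷_) (map-map xs)

extract : ∀ {x : A} {xs} → x ∈ xs → ∃ λ ys → xs ↭ x ∷ ys
extract {x = x} p with ys , zs , eq ← ∈-∃++ p = ys ++ zs , trans (↭-reflexive eq) (shift x ys zs)

∈-tail : ∀ {x : A} {X X′} → X ↭ x ∷ X′ → ∀ {L} → All (x ≢_) L → All (_∈ X) L → All (_∈ X′) L
∈-tail p []        []       = []
∈-tail p (ne ∷ as) (q ∷ qs) with ∈-resp-↭ p q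
... | here e   = contradiction (sym e) ne
... | there q′ = q′ ∷ ∈-tail p as qs

complement : ∀ {L X : List A} → Unique L → All (_∈ X) L → ∃ λ L′ → L ++ L′ ↭ X
complement {X = X} []      []       = X , refl
complement {L = x ∷ L} (a ∷ u) (q ∷ qs) with extract q
... | X′ , p with complement u (∈-tail p a qs)
... | L′ , r = L′ , trans (prep x r) (↭-sym p)

complement-range : ∀ {L n} → Unique L → All (_< n) L → ∃ λ L′ → L ++ L′ ↭ range n
complement-range u a = complement u (All.map ∈-range a)

unique-full : ∀ {L n} → Unique L → All (_< n) L → length L ≡ n → L ↭ range n
unique-full {L} {n} un a e with complement-range un a
... | []     , p = trans (↭-reflexive (sym (++-identityʳ L))) p
... | x ∷ L′ , p = contradiction (begin-strict
  n ≡⟨ e ⟨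
  length L <⟨ ≤-trans (≤-reflexive (+-comm 1 (length L))) (+-monoʳ-≤ (length L) (s≤s z≤n)) ⟩
  length L + length (x ∷ L′) ≡⟨ length-++ L ⟨
  length (L ++ x ∷ L′) ≡⟨ ↭-length p ⟩
  length (range n) ≡⟨ length-range n ⟩
  n ∎) (<-irrefl refl)
  where open ≤-Reasoning

-- Choosing vertices by position

-- The default 0 beyond the end is never relied on: positions in use are checked to be in range.
at : List ℕ → ℕ → ℕ
at []       _       = 0
at (x ∷ xs) zero    = x
at (x ∷ xs) (suc i) = at xs i

at-∈ : ∀ xs {i} → i < length xs → at xs i ∈ xs
at-∈ (x ∷ xs) {zero}  _       = here refl
at-∈ (x ∷ xs) {suc i} (s<s p) = there (at-∈ xs p)

at-injective : ∀ {xs} → Unique xs → ∀ {i j} → i < length xs → j < length xs → at xs i ≡ at xs j → i ≡ j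
at-injective (a ∷ u) {zero}  {zero}  _ _ e = refl
at-injective {x ∷ xs} (a ∷ u) {zero}  {suc j} _ (s<s q) e = contradiction e (All.lookup a (at-∈ xs q))
at-injective {x ∷ xs} (a ∷ u) {suc i} {zero}  (s<s p) _ e = contradiction (sym e) (All.lookup a (at-∈ xs p))
at-injective (a ∷ u) {suc i} {suc j} (s<s p) (s<s q) e = cong suc (at-injective u p q e)

notIn : ℕ → List ℕ → Bool
notIn i []       = true
notIn i (j ∷ js) = not (i ≡ᵇ j) ∧ notIn i js

-- A Boolean test, so that for explicit numerals both range and distinctness are settled by `refl`.
positions : ℕ → List ℕ → Bool
positions n []       = true
positions n (i ∷ is) = (i <ᵇ n) ∧ notIn i is ∧ positions n is

private
  ∧⁻ : ∀ {a b} → a ∧ b ≡ true → a ≡ true × b ≡ true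
  ∧⁻ {true} {true} _ = refl , refl

  T⁺ : ∀ {b} → b ≡ true → T b
  T⁺ refl = _

notIn-sound : ∀ i is → notIn i is ≡ true → All (i ≢_) is
notIn-sound i []       _ = []
notIn-sound i (j ∷ js) h with i ≡ᵇ j in e
notIn-sound i (j ∷ js) h | false = (λ { refl → contradiction (≡⇒≡ᵇ i i refl) (subst (λ b → ¬ T b) (sym e) id) }) ∷ notIn-sound i js h

positions-sound : ∀ n is → positions n is ≡ true → All (_< n) is × Unique is
positions-sound n []       _ = [] , []
positions-sound n (i ∷ is) h with ∧⁻ h
... | p , h′ with ∧⁻ h′
... | q , r with positions-sound n is r
... | a , u = <ᵇ⇒< i n (T⁺ p) ∷ a , notIn-sound i is q ∷ u

map-at-unique : ∀ {xs ys} → Unique (xs ++ ys) → ∀ is → positions (length xs) is ≡ true →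
  Unique (map (at xs) is ++ ys)
map-at-unique {xs} {ys} u is h with positions-sound (length xs) is h
... | a , ui = go a ui
  where
  disj : ∀ xs → Unique (xs ++ ys) → ∀ {x} → x ∈ xs → All (x ≢_) ys
  disj (x ∷ xs) (a ∷ u) (here refl) = AllP.++⁻ʳ xs a
  disj (x ∷ xs) (a ∷ u) (there p)     = disj xs u p
  fresh : ∀ {i is} → i < length xs → All (_< length xs) is → All (i ≢_) is → All (at xs i ≢_) (map (at xs) is)
  fresh p []       []       = []
  fresh p (q ∷ qs) (ne ∷ n) = (ne ∘ at-injective (Unique-++⁻ˡ xs u) p q) ∷ fresh p qs n
  go : ∀ {is} → All (_< length xs) is → Unique is → Unique (map (at xs) is ++ ys)
  go []       []       = Unique-++⁻ʳ xs u
  go (p ∷ ps) (n ∷ un) = AllP.++⁺ (fresh p ps n) (disj xs u (at-∈ xs p)) ∷ go ps un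

map-at-All : ∀ {P : ℕ → Set} {xs} → All P xs → ∀ is → positions (length xs) is ≡ true → All P (map (at xs) is)
map-at-All {xs = xs} a is h = go (proj₁ (positions-sound (length xs) is h))
  where
  go : ∀ {is} → All (_< length xs) is → All _ (map (at xs) is)
  go []       = []
  go (p ∷ ps) = All.lookup a (at-∈ xs p) ∷ go ps

-- Distinct positions extend to a permutation of all positions, and the added terms are nonnegative.
sum-positions : ∀ ms is → positions (length ms) is ≡ true → sum (map (at ms) is) ≤ sum ms
sum-positions ms is h with positions-sound (length ms) is h
... | a , u with complement-range u a
... | L′ , p = begin
  sum (map (at ms) is) ≤⟨ m≤m+n _ _ ⟩
  sum (map (at ms) is) + sum (map (at ms) L′) ≡⟨ sum-++ (map (at ms) is) _ ⟨
  sum (map (at ms) is ++ map (at ms) L′) ≡⟨ cong sum (map-++ (at ms) is L′) ⟨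
  sum (map (at ms) (is ++ L′)) ≡⟨ S1≡ (is ++ L′) ⟨
  S1 (is ++ L′) (at ms) ≡⟨ S1-↭ p ⟩
  S1 (range (length ms)) (at ms) ≡⟨ S1≡ (range (length ms)) ⟩
  sum (map (at ms) (range (length ms))) ≡⟨ cong sum (all ms) ⟩
  sum ms ∎
  where
  open ≤-Reasoning
  S1≡ : ∀ is → S1 is (at ms) ≡ sum (map (at ms) is)
  S1≡ []       = refl
  S1≡ (i ∷ is) = cong (at ms i +_) (S1≡ is)
  all : ∀ ms → map (at ms) (range (length ms)) ≡ ms
  all []       = refl
  all (m ∷ ms) = cong (m ∷_) (≡.trans (shifted (range (length ms))) (all ms))
    where
    shifted : ∀ is → map (at (m ∷ ms)) (map suc is) ≡ map (at ms) is
    shifted []       = refl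
    shifted (i ∷ is) = cong (_ ∷_) (shifted is)

-- No position occurs in two clauses, so each clause accounts for a unit of its own.
clauses-≤-sum : ∀ ms cs → positions (length ms) (concatMap id cs) ≡ true →
  All (λ c → 1 ≤ sum (map (at ms) c)) cs → length cs ≤ sum ms
clauses-≤-sum ms cs h a = ≤-trans (go cs a) (sum-positions ms (concatMap id cs) h)
  where
  go : ∀ cs → All (λ c → 1 ≤ sum (map (at ms) c)) cs → length cs ≤ sum (map (at ms) (concatMap id cs))
  go []       []       = z≤n
  go (c ∷ cs) (p ∷ ps) rewrite map-++ (at ms) c (concatMap id cs) | sum-++ (map (at ms) c) (map (at ms) (concatMap id cs)) =
    +-mono-≤ p (go cs ps)

-- Shifted 3-graphs, presented as symmetric relations on ℕ supported on {0, …, n − 1}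

[_] : Bool → ℕ
[ true  ] = 1
[ false ] = 0

[]≤1 : ∀ b → [ b ] ≤ 1
[]≤1 true  = ≤-refl
[]≤1 false = z≤n

record Shifted (n : ℕ) (g : ℕ → ℕ → ℕ → Bool) : Set where
  field
    sym₁ : ∀ a b c → g a b c ≡ g b a c
    sym₂ : ∀ a b c → g a b c ≡ g a c b
    supp : ∀ {a b c} → g a b c ≡ true → a < n
    irr  : ∀ {a b c} → g a b c ≡ true → a ≢ b
    down : ∀ {a b c} a′ → g a b c ≡ true → a′ < a → a′ ≢ b → a′ ≢ c → g a′ b c ≡ true

  down₂ : ∀ {a b c} b′ → g a b c ≡ true → b′ < b → b′ ≢ a → b′ ≢ c → g a b′ c ≡ true
  down₂ {a} {b} {c} b′ h p q r =
    ≡.trans (sym₁ a b′ c) (down b′ (≡.trans (sym₁ b a c) h) p q r)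

  down₃ : ∀ {a b c} c′ → g a b c ≡ true → c′ < c → c′ ≢ a → c′ ≢ b → g a b c′ ≡ true
  down₃ {a} {b} {c} c′ h p q r =
    ≡.trans (sym₂ a b c′) (down₂ c′ (≡.trans (sym₂ a c b) h) p q r)

  irr₂ : ∀ {a b c} → g a b c ≡ true → b ≢ c
  irr₂ {a} {b} {c} h = irr {b} {c} {a} (≡.trans (sym₂ b c a) (≡.trans (sym₁ b a c) h))

  irr₃ : ∀ {a b c} → g a b c ≡ true → a ≢ c
  irr₃ {a} {b} {c} h = irr (≡.trans (sym₂ a c b) h)

record Tri : Set where
  constructor tri
  field
    i j k : ℕ
open Tri public

vl : Tri → List ℕ
vl e = i e ∷ j e ∷ k e ∷ []

verts : List Tri → List ℕ
verts = concatMap vl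

pverts : List (ℕ × ℕ) → List ℕ
pverts = concatMap (λ p → proj₁ p ∷ proj₂ p ∷ [])

Edge : (ℕ → ℕ → ℕ → Bool) → Tri → Set
Edge g e = g (i e) (j e) (k e) ≡ true

Matching : (ℕ → ℕ → ℕ → Bool) → List Tri → Set
Matching g M = All (Edge g) M × Unique (verts M)

ν≤ : (ℕ → ℕ → ℕ → Bool) → ℕ → Set
ν≤ g s = ∀ M → Matching g M → length M ≤ s

verts-++ : ∀ M N → verts (M ++ N) ≡ verts M ++ verts N
verts-++ []      N = refl
verts-++ (e ∷ M) N = cong (λ t → i e ∷ j e ∷ k e ∷ t) (verts-++ M N)

verts-↭ : ∀ {M N} → M ↭ N → verts M ↭ verts N
verts-↭ refl = refl
verts-↭ (prep e p) = ++⁺ˡ (vl e) (verts-↭ p)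
verts-↭ (swap {xs} {ys} e f p) = trans
  (++⁺ˡ (vl e) (++⁺ˡ (vl f) (verts-↭ p)))
  (trans (↭-reflexive (sym (++-assoc (vl e) (vl f) (verts ys))))
    (trans (++⁺ʳ (verts ys) (++-comm (vl e) (vl f))) (↭-reflexive (++-assoc (vl f) (vl e) (verts ys)))))
verts-↭ (trans p q) = trans (verts-↭ p) (verts-↭ q)

length-verts : ∀ M → length (verts M) ≡ 3 * length M
length-verts []      = refl
length-verts (e ∷ M) = ≡.trans (cong (3 +_) (length-verts M)) (sym (*-suc 3 (length M)))

length-pverts : ∀ P → length (pverts P) ≡ 2 * length P
length-pverts []      = refl
length-pverts (e ∷ P) = ≡.trans (cong (2 +_) (length-pverts P)) (sym (*-suc 2 (length P)))

mapTri : (ℕ → ℕ) → Tri → Tri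
mapTri f e = tri (f (i e)) (f (j e)) (f (k e))

verts-map : ∀ f M → verts (map (mapTri f) M) ≡ map f (verts M)
verts-map f []      = refl
verts-map f (e ∷ M) = cong (λ t → f (i e) ∷ f (j e) ∷ f (k e) ∷ t) (verts-map f M)

mapPair : (ℕ → ℕ) → ℕ × ℕ → ℕ × ℕ
mapPair f p = f (proj₁ p) , f (proj₂ p)

pverts-map : ∀ f P → pverts (map (mapPair f) P) ≡ map f (pverts P)
pverts-map f []      = refl
pverts-map f (e ∷ P) = cong (λ t → f (proj₁ e) ∷ f (proj₂ e) ∷ t) (pverts-map f P)

-- The link of u, and matchings that mix edges with pairs of the link

module Link {n s : ℕ} {g : ℕ → ℕ → ℕ → Bool} (sh : Shifted n g) (ν : ν≤ g s) where
  open Shifted sh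

  -- `z` is the last vertex of {0, ..., 3s + 1} and `u` the first one beyond. With 0 and {1, ...,
  -- 3s} they make 3 (s + 1) vertices, room for exactly one edge too many.
  u z : ℕ
  u = 3 * s + 2
  z = 3 * s + 1

  H : ℕ → ℕ → Set
  H x y = g x y u ≡ true

  H-sym : ∀ {x y} → H x y → H y x
  H-sym {x} {y} h = ≡.trans (sym₁ y x u) h

  PairH : ℕ × ℕ → Set
  PairH p = H (proj₁ p) (proj₂ p)

  private
    extend : List (ℕ × ℕ) → List ℕ → List Tri
    extend (p ∷ P) (v ∷ L) = tri (proj₁ p) (proj₂ p) v ∷ extend P L
    extend _       _       = []

    verts-extend : ∀ P L → length P ≡ length L → verts (extend P L) ↭ pverts P ++ L
    verts-extend []      []      _ = refl
    verts-extend ((x , y) ∷ P) (v ∷ L) e = prep x (prep y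
      (trans (prep v (verts-extend P L (suc-injective e))) (↭-sym (shift v (pverts P) L))))

    length-extend : ∀ P L → length P ≡ length L → length (extend P L) ≡ length P
    length-extend []      []      _ = refl
    length-extend (p ∷ P) (v ∷ L) e = cong suc (length-extend P L (suc-injective e))

    edges-extend : ∀ P L → All PairH P → All (_< 3 * s + 3) L → Unique (verts (extend P L)) →
      All (Edge g) (extend P L)
    edges-extend []      L       _        _        _ = []
    edges-extend (p ∷ P) []      _        _        _ = []
    edges-extend ((x , y) ∷ P) (v ∷ L) (h ∷ hs) (l ∷ ls) ((_ ∷ x≢v ∷ _) ∷ (y≢v ∷ _) ∷ _ ∷ un) =
      edge ∷ edges-extend P L hs ls un
      where
      -- A vertex below `u` and off the pair may replace `u`; for `v` equal to `u` the pair itself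
      -- is the edge.
      edge : g x y v ≡ true
      edge with m≤n⇒m<n∨m≡n (s≤s⁻¹ (subst (suc v ≤_) (+-suc (3 * s) 2) l))
      ... | inj₁ v<u    = down₃ v h v<u (x≢v ∘ sym) (y≢v ∘ sym)
      ... | inj₂ refl = h

  -- A pair of H needs no third vertex of its own: the unused vertices below u complete all the pairs to edges.

  no-mixed-matching : ∀ E P → All (Edge g) E → All PairH P →
    Unique (verts E ++ pverts P) → All (_< 3 * s + 3) (verts E ++ pverts P) →
    length E + length P ≡ suc s → ⊥
  no-mixed-matching E P edges pairs un bd len
    with L , p ← complement-range un bd = 1+n≰n (begin
      suc s ≡⟨ len ⟨
      length E + length P ≡⟨ cong (length E +_) (length-extend P L eqL) ⟨
      length E + length (extend P L) ≡⟨ length-++ E ⟨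
      length (E ++ extend P L) ≤⟨ ν (E ++ extend P L) (AllP.++⁺ edges (edges-extend P L pairs bdL un′) , un″) ⟩
      s ∎)
    where
    open ≤-Reasoning
    -- Of the 3 (s + 1) vertices up to u, 3 |E| + 2 |P| are used. As |E| + |P| = s + 1, exactly |P|
    -- remain, one for each pair.
    eqL : length P ≡ length L
    eqL = sym (+-cancelˡ-≡ (3 * length E + 2 * length P) (length L) (length P) (begin-equality
      (3 * length E + 2 * length P) + length L
        ≡⟨ cong₂ (λ a b → (a + b) + length L) (length-verts E) (length-pverts P) ⟨
      (length (verts E) + length (pverts P)) + length L
        ≡⟨ cong (_+ length L) (length-++ (verts E)) ⟨
      length (verts E ++ pverts P) + length L ≡⟨ length-++ (verts E ++ pverts P) ⟨
      length ((verts E ++ pverts P) ++ L) ≡⟨ ↭-length p ⟩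
      length (range (3 * s + 3)) ≡⟨ length-range (3 * s + 3) ⟩
      3 * s + 3 ≡⟨ +-comm (3 * s) 3 ⟩
      3 + 3 * s ≡⟨ *-suc 3 s ⟨
      3 * suc s ≡⟨ cong (3 *_) len ⟨
      3 * (length E + length P)
        ≡⟨ solve 2 (λ e p → con 3 :* (e :+ p) := (con 3 :* e :+ con 2 :* p) :+ p) refl (length E) (length P) ⟩
      (3 * length E + 2 * length P) + length P ∎))
    perm : verts E ++ verts (extend P L) ↭ range (3 * s + 3)
    perm = trans (++⁺ˡ (verts E) (verts-extend P L eqL))
      (trans (↭-reflexive (sym (++-assoc (verts E) (pverts P) L))) p)
    un‴ : Unique (verts E ++ verts (extend P L))
    un‴ = Unique-↭ (↭-sym perm) (range-unique (3 * s + 3))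
    un′ : Unique (verts (extend P L))
    un′ = Unique-++⁻ʳ (verts E) un‴
    un″ : Unique (verts (E ++ extend P L))
    un″ = subst Unique (sym (verts-++ E (extend P L))) un‴
    bdL : All (_< 3 * s + 3) L
    bdL = AllP.++⁻ʳ (verts E ++ pverts P) (All-resp-↭ (↭-sym p) (range-< (3 * s + 3)))

  -- Inside the vertices z, 0 and a few blocks of a perfect matching of {1, …, 3s}: positions 0 and 1
  -- stand for z and 0, positions 2, 3, 4 for the first block, and so on.

  module Local (M : List Tri) (edgesM : All (Edge g) M) (lenM : length M ≡ s)
                 (permM : z ∷ 0 ∷ verts M ↭ range (3 * s + 2)) where

    -- The blocks in `R` stay in place, so |Bs| + 1 disjoint edges and pairs on z, 0 and the
    -- vertices of `Bs` would bring the total to s + 1.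
    clash : ∀ Bs R → M ↭ Bs ++ R → ∀ E P →
      positions (length (z ∷ 0 ∷ verts Bs)) (verts E ++ pverts P) ≡ true →
      length E + length P ≡ suc (length Bs) →
      All (Edge g) (map (mapTri (at (z ∷ 0 ∷ verts Bs))) E) →
      All PairH (map (mapPair (at (z ∷ 0 ∷ verts Bs))) P) → ⊥
    clash Bs R p E P pos len edges pairs = no-mixed-matching (E′ ++ R) P′
      (AllP.++⁺ edges (AllP.++⁻ʳ Bs (All-resp-↭ p edgesM))) pairs
      (Unique-↭ (↭-sym perm) (map-at-unique un (verts E ++ pverts P) pos))
      (All-resp-↭ (↭-sym perm) (AllP.++⁺ (map-at-All (AllP.++⁻ˡ X bd) (verts E ++ pverts P) pos) (AllP.++⁻ʳ X bd)))
      (begin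
        length (E′ ++ R) + length P′ ≡⟨ cong₂ _+_ (length-++ E′) (length-map _ P) ⟩
        (length E′ + length R) + length P ≡⟨ cong (λ t → (t + length R) + length P) (length-map _ E) ⟩
        (length E + length R) + length P ≡⟨ solve 3 (λ e r p → (e :+ r) :+ p := (e :+ p) :+ r) refl (length E) (length R) (length P) ⟩
        (length E + length P) + length R ≡⟨ cong (_+ length R) len ⟩
        suc (length Bs + length R) ≡⟨ cong suc (length-++ Bs) ⟨
        suc (length (Bs ++ R)) ≡⟨ cong suc (↭-length p) ⟨
        suc (length M) ≡⟨ cong suc lenM ⟩
        suc s ∎)
      where
      open ≡-Reasoning
      X = z ∷ 0 ∷ verts Bs
      E′ = map (mapTri (at X)) E
      P′ = map (mapPair (at X)) P
      permX : X ++ verts R ↭ range (3 * s + 2)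
      permX = trans (prep z (prep 0 (trans (↭-reflexive (sym (verts-++ Bs R))) (↭-sym (verts-↭ p))))) permM
      un : Unique (X ++ verts R)
      un = Unique-↭ (↭-sym permX) (range-unique _)
      bd : All (_< 3 * s + 3) (X ++ verts R)
      bd = All-resp-↭ (↭-sym permX) (All.map (λ q → ≤-trans q (+-monoʳ-≤ (3 * s) (n≤1+n 2))) (range-< (3 * s + 2)))
      perm : verts (E′ ++ R) ++ pverts P′ ↭ map (at X) (verts E ++ pverts P) ++ verts R
      perm = trans (↭-reflexive (cong₂ _++_ (≡.trans (verts-++ E′ R) (cong (_++ verts R) (verts-map (at X) E))) (pverts-map (at X) P)))
        (trans (↭-reflexive (++-assoc (map (at X) (verts E)) (verts R) _))
        (trans (++⁺ˡ (map (at X) (verts E)) (++-comm (verts R) (map (at X) (pverts P))))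
        (trans (↭-reflexive (sym (++-assoc (map (at X) (verts E)) _ (verts R))))
          (↭-reflexive (cong (_++ verts R) (sym (map-++ (at X) (verts E) (pverts P))))))))

-- The trailing `+ 0` is the one that `sum` leaves on a list, so that these are clauses for
-- `clauses-≤-sum` as they stand.
cl₁ : ∀ {a} → (a ≡ true → ⊥) → 1 ≤ [ not a ] + 0
cl₁ {true}  h = ⊥-elim (h refl)
cl₁ {false} h = ≤-refl

cl₂ : ∀ {a b} → (a ≡ true → b ≡ true → ⊥) → 1 ≤ [ not a ] + ([ not b ] + 0)
cl₂ {false} h = s≤s z≤n
cl₂ {true}  h = cl₁ (h refl)

cl₃ : ∀ {a b c} → (a ≡ true → b ≡ true → c ≡ true → ⊥) → 1 ≤ [ not a ] + ([ not b ] + ([ not c ] + 0))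
cl₃ {false} h = s≤s z≤n
cl₃ {true}  h = cl₂ (h refl)

≢true⇒≡false : ∀ {b} → (b ≡ true → ⊥) → b ≡ false
≢true⇒≡false {true}  h = ⊥-elim (h refl)
≢true⇒≡false {false} h = refl

false⇒≢true : ∀ {b} → b ≡ false → b ≡ true → ⊥
false⇒≢true refl ()

exclusive : ∀ {a b} → (a ≡ true → b ≡ true → ⊥) → [ a ] + [ b ] ≤ 1
exclusive {true}  {b} h rewrite ≢true⇒≡false (h refl) = ≤-refl
exclusive {false} {b} h = []≤1 b

sum-map : ∀ {A : Set} (φ : A → ℕ) xs → sum (map φ xs) ≡ S1 xs φ
sum-map φ []       = refl
sum-map φ (x ∷ xs) = cong (φ x +_) (sum-map φ xs)

sum-concatMap : ∀ {A : Set} (F : A → List ℕ) xs → sum (concatMap F xs) ≡ S1 xs (sum ∘ F)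
sum-concatMap F []       = refl
sum-concatMap F (x ∷ xs) = ≡.trans (sum-++ (F x) _) (cong (sum (F x) +_) (sum-concatMap F xs))

Sorted : Tri → Set
Sorted e = i e < j e × j e < k e

-- Exchange arguments in a perfect matching of {1, ..., 3s}

module Blocks {n s : ℕ} {g : ℕ → ℕ → ℕ → Bool} (sh : Shifted n g) (ν : ν≤ g s) where
  open Shifted sh
  open Link {n} {s} {g} sh ν

  record Perfect (M : List Tri) : Set where
    field
      edgesM  : All (Edge g) M
      lenM    : length M ≡ s
      permM   : z ∷ 0 ∷ verts M ↭ range (3 * s + 2)
      sortedM : All Sorted M

  -- An edge of type T2 contains a pair of H; it is nonempty if some pair {0, x} with x in it lies in H.

  t2 ne : Tri → Bool
  t2 e = g (i e) (j e) u
  ne e = g 0 (i e) u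

  -- 1 if one of the two is nonempty but not of type T2 and the other one is empty

  NE : Tri → Tri → ℕ
  NE e f = [ ((ne e ∧ not (t2 e)) ∧ not (ne f)) ∨ (not (ne e) ∧ (ne f ∧ not (t2 f))) ]

  miss : ℕ → ℕ → ℕ → ℕ
  miss a b c = [ not (g a b c) ]

  Hn : ℕ → ℕ → ℕ
  Hn x y = [ g x y u ]

  Tm : Tri → Tri → Tri → ℕ
  Tm e f h = S1 (vl e) (λ x → S1 (vl f) (λ y → S1 (vl h) (miss x y)))

  -- Together with `inner` this sorts the pairs of `H` below u by blocks, 0 being added to each
  -- block in `inner`. Pairs through z do not occur, by `two-high`.
  P : Tri → Tri → ℕ
  P e f = S1 (vl e) (λ x → S1 (vl f) (Hn x))

  inner : Tri → ℕ
  inner e = S1 (vl e) (Hn 0) + S2 (vl e) Hn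

  -- The non-edges charged to a pair of blocks: two vertices in one and one in the other, or one in
  -- each together with z. None of them is a transversal counted by `Tm`.
  Q₁ Qz Qm : Tri → Tri → ℕ
  Q₁ e f = S1 (vl e) (λ x → S2 (vl f) (miss x))
  Qz e f = S1 (vl e) (λ x → S1 (vl f) (miss z x))
  Qm e f = (Q₁ e f + Q₁ f e) + Qz e f

  miss-sym₁ : ∀ a b c → miss a b c ≡ miss b a c
  miss-sym₁ a b c = cong ([_] ∘ not) (sym₁ a b c)

  miss-sym₂ : ∀ a b c → miss a b c ≡ miss a c b
  miss-sym₂ a b c = cong ([_] ∘ not) (sym₂ a b c)

  Tm-sym₁ : ∀ e f h → Tm e f h ≡ Tm f e h
  Tm-sym₁ e f h = ≡.trans (S1-swap (λ x y → S1 (vl h) (miss x y)) (vl e) (vl f))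
    (S1-cong (vl f) λ y → S1-cong (vl e) λ x → S1-cong (vl h) (miss-sym₁ x y))

  Tm-sym₂ : ∀ e f h → Tm e f h ≡ Tm e h f
  Tm-sym₂ e f h = S1-cong (vl e) λ x → ≡.trans (S1-swap (miss x) (vl f) (vl h))
    (S1-cong (vl h) λ w → S1-cong (vl f) λ y → miss-sym₂ x y w)

  Hn-sym : ∀ x y → Hn x y ≡ Hn y x
  Hn-sym x y = cong [_] (sym₁ x y u)

  P-sym : ∀ e f → P e f ≡ P f e
  P-sym e f = ≡.trans (S1-swap Hn (vl e) (vl f)) (S1-cong (vl f) λ y → S1-cong (vl e) λ x → Hn-sym x y)

  Qz-sym : ∀ e f → Qz e f ≡ Qz f e
  Qz-sym e f = ≡.trans (S1-swap (miss z) (vl e) (vl f)) (S1-cong (vl f) λ y → S1-cong (vl e) λ x → miss-sym₂ z x y)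

  Q₁-swap : ∀ e f → S2 (vl e) (λ x y → S1 (vl f) (miss x y)) ≡ Q₁ f e
  Q₁-swap e f = ≡.trans (S2-swap miss (vl e) (vl f))
    (S1-cong (vl f) λ w → S2-cong (vl e) λ x y → ≡.trans (miss-sym₂ x y w) (miss-sym₁ x w y))

  -- The transversal through the x-th, y-th and w-th vertices of the blocks is cell 9x + 3y + w. Each list in cs
  -- is a set of cells not all of which can be edges; the sets being disjoint, they contribute a non-edge each.

  cells : Tri → Tri → Tri → List ℕ
  cells e f h = concatMap (λ x → concatMap (λ y → map (miss x y) (vl h)) (vl f)) (vl e)

  lost : ∀ e f h cs → positions 27 (concatMap id cs) ≡ true →
    All (λ c → 1 ≤ sum (map (at (cells e f h)) c)) cs → length cs ≤ Tm e f h
  lost e f h cs pos a = subst (length cs ≤_)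
    (≡.trans (sum-concatMap (λ x → concatMap (λ y → map (miss x y) (vl h)) (vl f)) (vl e))
      (S1-cong (vl e) λ x → ≡.trans (sum-concatMap (λ y → map (miss x y) (vl h)) (vl f))
        (S1-cong (vl f) λ y → sum-map (miss x y) (vl h))))
    (clauses-≤-sum (cells e f h) cs pos a)

  -- The last component serves a new block built on a pair {a, b} of `H`: if `c` is among the two
  -- smallest vertices, it replaces a larger vertex of the pair, and shiftedness keeps the result in
  -- `H`.
  sort3 : ∀ {a b c} → g a b c ≡ true →
    Σ Tri λ t → Sorted t × Edge g t × vl t ↭ a ∷ b ∷ c ∷ [] × (c < u → H a b → t2 t ≡ true)
  sort3 {a} {b} {c} h with <-cmp a b | <-cmp b c | <-cmp a c
  ... | tri≈ _ e _ | _ | _ = contradiction e (irr h)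
  ... | tri< _ _ _ | tri≈ _ e _ | _ = contradiction e (irr₂ h)
  ... | tri> _ _ _ | tri≈ _ e _ | _ = contradiction e (irr₂ h)
  ... | tri< a<b _ _ | tri< b<c _ _ | _ = tri a b c , (a<b , b<c) , h , refl , (λ _ → id)
  ... | tri< a<b _ _ | tri> _ _ c<b | tri< a<c _ _ = tri a c b , (a<c , c<b) , ≡.trans (sym₂ a c b) h ,
    prep a (swap c b refl) , λ c<u q → down₂ c q c<b (λ e → irr₃ h (sym e)) (<⇒≢ c<u)
  ... | tri< a<b _ _ | tri> _ _ c<b | tri≈ _ e _ = contradiction e (irr₃ h)
  ... | tri< a<b _ _ | tri> _ _ c<b | tri> _ _ c<a = tri c a b , (c<a , a<b) , ≡.trans (sym₁ c a b) (≡.trans (sym₂ a c b) h) ,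
    trans (swap c a refl) (prep a (swap c b refl)) ,
    λ c<u q → H-sym (down₂ c q c<b (λ e → irr₃ h (sym e)) (<⇒≢ c<u))
  ... | tri> _ _ b<a | tri< b<c _ _ | tri< a<c _ _ = tri b a c , (b<a , a<c) , ≡.trans (sym₁ b a c) h , swap b a refl , (λ _ → H-sym)
  ... | tri> _ _ b<a | tri< b<c _ _ | tri≈ _ e _ = contradiction e (irr₃ h)
  ... | tri> _ _ b<a | tri< b<c _ _ | tri> _ _ c<a = tri b c a , (b<c , c<a) , ≡.trans (sym₂ b c a) (≡.trans (sym₁ b a c) h) ,
    trans (prep b (swap c a refl)) (swap b a refl) ,
    λ c<u q → H-sym (down c q c<a (λ e → irr₂ h (sym e)) (<⇒≢ c<u))
  ... | tri> _ _ b<a | tri> _ _ c<b | _ = tri c b a , (c<b , b<a) ,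
    ≡.trans (sym₁ c b a) (≡.trans (sym₂ b c a) (≡.trans (sym₁ b a c) h)) ,
    trans (swap c b refl) (trans (prep b (swap c a refl)) (swap b a refl)) ,
    λ c<u q → down c q (<-trans c<b b<a) (λ e → irr₂ h (sym e)) (<⇒≢ c<u)

  count-t2 : List Tri → ℕ
  count-t2 M = S1 M ([_] ∘ t2)

  module Counting (M : List Tri) (pf : Perfect M)
                  (maximal : ∀ M′ → Perfect M′ → count-t2 M′ ≤ count-t2 M) where
    open Perfect pf
    open Link.Local sh ν M edgesM lenM permM

    module Pos (Bs R : List Tri) (p : M ↭ Bs ++ R) where
      X : List ℕ
      X = z ∷ 0 ∷ verts Bs

      permX : X ++ verts R ↭ range (3 * s + 2)
      permX = trans (prep z (prep 0 (trans (↭-reflexive (sym (verts-++ Bs R))) (↭-sym (verts-↭ p))))) permM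

      unX : Unique (X ++ verts R)
      unX = Unique-↭ (↭-sym permX) (range-unique _)

      <u : ∀ a → positions (length X) (a ∷ []) ≡ true → at X a < u
      <u a h = All.head (map-at-All (AllP.++⁻ˡ X (All-resp-↭ (↭-sym permX) (range-< (3 * s + 2)))) (a ∷ []) h)

      apart : ∀ a b → positions (length X) (a ∷ b ∷ []) ≡ true → at X a ≢ at X b
      apart a b h with map-at-unique {X} unX (a ∷ b ∷ []) h
      ... | (ne ∷ _) ∷ _ = ne

      pos : ∀ a → positions (length X) (1 ∷ a ∷ []) ≡ true → 0 < at X a
      pos a h = n≢0⇒n>0 (apart 1 a h ∘ sym)

      H↓ : ∀ {x} a b → positions (length X) (a ∷ b ∷ []) ≡ true → at X a ≤ x → H x (at X b) → H (at X a) (at X b)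
      H↓ a b h le hx with m≤n⇒m<n∨m≡n le
      ... | inj₁ lt     = down (at X a) hx lt (apart a b h) (<⇒≢ (<u a (weaken h)))
        where
        weaken : positions (length X) (a ∷ b ∷ []) ≡ true → positions (length X) (a ∷ []) ≡ true
        weaken h with a <ᵇ length X
        ... | true  = refl
        ... | false = h
      ... | inj₂ refl = hx

    block-sorted : ∀ {e R} → M ↭ e ∷ R → Sorted e
    block-sorted p = All.head (All-resp-↭ p sortedM)

    block-edge : ∀ {e R} → M ↭ e ∷ R → Edge g e
    block-edge p = All.head (All-resp-↭ p edgesM)

    rot : ∀ {e f : Tri} {R} → M ↭ e ∷ f ∷ R → M ↭ f ∷ e ∷ R
    rot {e} {f} p = trans p (swap e f refl)

    swap₂₃ : ∀ {e f h : Tri} {R} → M ↭ e ∷ f ∷ h ∷ R → M ↭ e ∷ h ∷ f ∷ R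
    swap₂₃ {e} {f} {h} p = trans p (prep e (swap f h refl))

    rot₃ : ∀ {e f h : Tri} {R} → M ↭ e ∷ f ∷ h ∷ R → M ↭ h ∷ e ∷ f ∷ R
    rot₃ p = rot (swap₂₃ p)

    -- H restricted to one or two blocks and 0

    -- The six pairs on 0 and `e` split into three complementary couples. Both pairs of a couple
    -- cannot lie in `H`, since they would replace the single block `e`.
    inner≤3 : ∀ {e R} → M ↭ e ∷ R → inner e ≤ 3
    inner≤3 {e} {R} p = subst (_≤ 3) (sym reorder) (+-mono-≤ (+-mono-≤
        (exclusive λ a b → clash (e ∷ []) R p [] ((1 , 2) ∷ (3 , 4) ∷ []) refl refl [] (a ∷ b ∷ []))
        (exclusive λ a b → clash (e ∷ []) R p [] ((1 , 3) ∷ (2 , 4) ∷ []) refl refl [] (a ∷ b ∷ [])))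
        (exclusive λ a b → clash (e ∷ []) R p [] ((1 , 4) ∷ (2 , 3) ∷ []) refl refl [] (a ∷ b ∷ [])))
      where
      reorder : inner e ≡ ((Hn 0 (i e) + Hn (j e) (k e)) + (Hn 0 (j e) + Hn (i e) (k e))) + (Hn 0 (k e) + Hn (i e) (j e))
      reorder = solve 6 (λ a b c x y w → (a :+ (b :+ (c :+ con 0))) :+ ((x :+ (y :+ con 0)) :+ ((w :+ con 0) :+ con 0))
        := ((a :+ w) :+ (b :+ y)) :+ (c :+ x)) refl
        (Hn 0 (i e)) (Hn 0 (j e)) (Hn 0 (k e)) (Hn (i e) (j e)) (Hn (i e) (k e)) (Hn (j e) (k e))

    -- {0, i e} is the lowest pair on 0 and `e`, so every other pair of `H` could be lowered to it.
    inner≡0 : ∀ {e R} → M ↭ e ∷ R → ne e ≡ false → inner e ≡ 0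
    inner≡0 {e} {R} p q = zero₆ oj ok ij ik jk
      where
      zero₆ : g 0 (j e) u ≡ false → g 0 (k e) u ≡ false → g (i e) (j e) u ≡ false →
        g (i e) (k e) u ≡ false → g (j e) (k e) u ≡ false → inner e ≡ 0
      zero₆ oj ok ij ik jk rewrite q | oj | ok | ij | ik | jk = refl
      open Pos (e ∷ []) R p
      i<j = proj₁ (block-sorted p)
      j<k = proj₂ (block-sorted p)
      noi : H 0 (i e) → ⊥
      noi = false⇒≢true q
      toI : ∀ {x} → i e ≤ x → H 0 x → ⊥
      toI le h = noi (H-sym (H↓ 2 1 refl le (H-sym h)))
      oj = ≢true⇒≡false (toI (<⇒≤ i<j))
      ok = ≢true⇒≡false (toI (<⇒≤ (<-trans i<j j<k)))
      ij = ≢true⇒≡false {g (i e) (j e) u} λ h → toI (<⇒≤ i<j) (H↓ 1 3 refl z≤n h)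
      ik = ≢true⇒≡false {g (i e) (k e) u} λ h → toI (<⇒≤ (<-trans i<j j<k)) (H↓ 1 4 refl z≤n h)
      jk = ≢true⇒≡false {g (j e) (k e) u} λ h → toI (<⇒≤ (<-trans i<j j<k)) (H↓ 1 4 refl z≤n h)

    t2⇒ne : ∀ {e R} → M ↭ e ∷ R → t2 e ≡ true → ne e ≡ true
    t2⇒ne {e} {R} p h = H-sym (Pos.H↓ (e ∷ []) R p 2 1 refl ≤-refl (H-sym (H↓₀ h)))
      where
      H↓₀ : H (i e) (j e) → H 0 (i e)
      H↓₀ h = Pos.H↓ (e ∷ []) R p 1 2 refl z≤n (H-sym h)

    -- By shiftedness the pairs of `H` between two sorted blocks form a down-set of a 3 × 3 grid. A
    -- full first row excludes the second row and a full first column the second column, so at most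
    -- four cells occur. The constructors name the generators of the three down-sets with three
    -- cells; `square` below is the one with four.
    data Big (e f : Tri) : Set where
      cross : H (i e) (j f) → H (j e) (i f) → Big e f
      row   : H (i e) (k f) → Big e f
      col   : H (k e) (i f) → Big e f

    data Shape (e f : Tri) : Set where
      none   : P e f ≡ 0 → Shape e f
      small  : H (i e) (i f) → P e f ≤ 2 → Shape e f
      big    : Big e f → P e f ≤ 3 → Shape e f
      square : H (i e) (j f) → H (j e) (i f) → H (j e) (j f) → P e f ≤ 4 → Shape e f

    module Two {e f R} (p : M ↭ e ∷ f ∷ R) where
      open Pos (e ∷ f ∷ []) R p
      ij₁ = <⇒≤ (proj₁ (block-sorted p))
      jk₁ = <⇒≤ (proj₂ (block-sorted p))
      ij₂ = <⇒≤ (proj₁ (block-sorted (rot p)))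
      jk₂ = <⇒≤ (proj₂ (block-sorted (rot p)))
      ik₁ = ≤-trans ij₁ jk₁
      ik₂ = ≤-trans ij₂ jk₂

      ee : ∀ {y} a b → positions 8 (b ∷ a ∷ []) ≡ true → at X b ≤ y → H (at X a) y → H (at X a) (at X b)
      ee a b h le q = H-sym (H↓ b a h le (H-sym q))

      ii←ij : H (i e) (j f) → H (i e) (i f)
      ii←ij = ee 2 5 refl ij₂
      ij←ik : H (i e) (k f) → H (i e) (j f)
      ij←ik = ee 2 6 refl jk₂
      ii←ji : H (j e) (i f) → H (i e) (i f)
      ii←ji = H↓ 2 5 refl ij₁
      ji←ki : H (k e) (i f) → H (j e) (i f)
      ji←ki = H↓ 3 5 refl jk₁
      ij←jj : H (j e) (j f) → H (i e) (j f)
      ij←jj = H↓ 2 6 refl ij₁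
      ji←jj : H (j e) (j f) → H (j e) (i f)
      ji←jj = ee 3 5 refl ij₂
      ik←jk : H (j e) (k f) → H (i e) (k f)
      ik←jk = H↓ 2 7 refl ij₁
      ik←kk : H (k e) (k f) → H (i e) (k f)
      ik←kk = H↓ 2 7 refl ik₁
      ki←kj : H (k e) (j f) → H (k e) (i f)
      ki←kj = ee 4 5 refl ij₂
      oi₁ : ∀ {y} → H (i e) y → H 0 (i e)
      oi₁ h = H↓ 1 2 refl z≤n (H-sym h)
      oi₂ : ∀ {x} → H x (i f) → H 0 (i f)
      oi₂ h = H↓ 1 5 refl z≤n h
      oj₂ : ∀ {x} → H x (j f) → H 0 (j f)
      oj₂ h = H↓ 1 6 refl z≤n h
      oj₁ : ∀ {x} → H x (j e) → H 0 (j e)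
      oj₁ h = H↓ 1 3 refl z≤n h

      -- A third pair {0, j f} arises by lowering {i e, j f}, and three disjoint pairs would replace
      -- two blocks.
      no-row-and-ji : H (i e) (k f) → H (j e) (i f) → ⊥
      no-row-and-ji ik ji = clash (e ∷ f ∷ []) R p [] ((2 , 7) ∷ (3 , 5) ∷ (1 , 6) ∷ []) refl refl []
        (ik ∷ ji ∷ oj₂ (ij←ik ik) ∷ [])

      no-col-and-ij : H (k e) (i f) → H (i e) (j f) → ⊥
      no-col-and-ij ki ij = clash (e ∷ f ∷ []) R p [] ((4 , 5) ∷ (2 , 6) ∷ (1 , 3) ∷ []) refl refl []
        (ki ∷ ij ∷ oj₁ (H-sym (ji←ki ki)) ∷ [])

      shape : Shape e f
      shape with g (i e) (i f) u in ii
      ... | false = none (zero₉ (false⇒≢true ii))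
        where
        zero₉ : (H (i e) (i f) → ⊥) → P e f ≡ 0
        zero₉ ¬h
          rewrite ≢true⇒≡false ¬h
                | ≢true⇒≡false (¬h ∘ ii←ij)
                | ≢true⇒≡false (¬h ∘ ii←ij ∘ ij←ik)
                | ≢true⇒≡false (¬h ∘ ii←ji)
                | ≢true⇒≡false (¬h ∘ ii←ji ∘ ji←jj)
                | ≢true⇒≡false (¬h ∘ ii←ij ∘ ij←ik ∘ ik←jk)
                | ≢true⇒≡false (¬h ∘ ii←ji ∘ ji←ki)
                | ≢true⇒≡false (¬h ∘ ii←ji ∘ ji←ki ∘ ki←kj)
                | ≢true⇒≡false (¬h ∘ ii←ij ∘ ij←ik ∘ ik←kk) = refl
      ... | true with g (i e) (k f) u in ik
      ...   | true = big (row ik) (bound (no-row-and-ji ik))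
        where
        bound : (H (j e) (i f) → ⊥) → P e f ≤ 3
        bound ¬h
          rewrite ≢true⇒≡false ¬h
                | ≢true⇒≡false (¬h ∘ ji←jj)
                | ≢true⇒≡false (¬h ∘ ji←jj ∘ ee 3 6 refl jk₂)
                | ≢true⇒≡false (¬h ∘ ji←ki)
                | ≢true⇒≡false (¬h ∘ ji←ki ∘ ki←kj)
                | ≢true⇒≡false (¬h ∘ ji←ki ∘ ee 4 5 refl ik₂)
          = +-mono-≤ {y = 3} (+-mono-≤ ([]≤1 (g (i e) (i f) u)) (+-mono-≤ ([]≤1 (g (i e) (j f) u)) (+-mono-≤ ([]≤1 (g (i e) (k f) u)) z≤n))) z≤n
      ...   | false with g (k e) (i f) u in ki
      ...     | true = big (col ki) (bound (no-col-and-ij ki))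
        where
        bound : (H (i e) (j f) → ⊥) → P e f ≤ 3
        bound ¬h
          rewrite ≢true⇒≡false ¬h
                | ≢true⇒≡false (¬h ∘ ij←ik)
                | ≢true⇒≡false (¬h ∘ ij←jj)
                | ≢true⇒≡false (¬h ∘ ij←ik ∘ ik←jk)
                | ≢true⇒≡false (¬h ∘ H↓ 2 6 refl ik₁)
                | ≢true⇒≡false (¬h ∘ ij←ik ∘ ik←kk)
          = +-mono-≤ {y = 1} (+-mono-≤ ([]≤1 (g (i e) (i f) u)) z≤n)
              (+-mono-≤ {y = 1} (+-mono-≤ ([]≤1 (g (j e) (i f) u)) z≤n)
                (+-mono-≤ {y = 1} (+-mono-≤ ([]≤1 (g (k e) (i f) u)) z≤n) z≤n))
      ...     | false = inside (g (i e) (j f) u) (g (j e) (i f) u) (g (j e) (j f) u) refl refl refl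
        where
        -- Without ik and ki the down-set lies in the 2 × 2 corner.
        corner : P e f ≡ ([ g (i e) (i f) u ] + ([ g (i e) (j f) u ] + 0)) + (([ g (j e) (i f) u ] + ([ g (j e) (j f) u ] + 0)) + 0)
        corner
          rewrite ik | ki
                | ≢true⇒≡false (false⇒≢true ik ∘ ik←jk)
                | ≢true⇒≡false (false⇒≢true ik ∘ ik←kk)
                | ≢true⇒≡false (false⇒≢true ki ∘ ki←kj) = refl
        inside : ∀ a b c → g (i e) (j f) u ≡ a → g (j e) (i f) u ≡ b → g (j e) (j f) u ≡ c → Shape e f
        inside true  true  true  p q r = square p q r (subst (_≤ 4) (sym corner)
          (+-mono-≤ {y = 2} (+-mono-≤ ([]≤1 (g (i e) (i f) u)) (+-mono-≤ ([]≤1 (g (i e) (j f) u)) z≤n))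
            (+-mono-≤ {y = 2} (+-mono-≤ ([]≤1 (g (j e) (i f) u)) (+-mono-≤ ([]≤1 (g (j e) (j f) u)) z≤n)) z≤n)))
        inside true  true  false p q r = big (cross p q) (subst (_≤ 3) (sym corner)
          (+-mono-≤ {y = 2} (+-mono-≤ ([]≤1 (g (i e) (i f) u)) (+-mono-≤ ([]≤1 (g (i e) (j f) u)) z≤n))
            (+-mono-≤ {y = 1} (+-mono-≤ ([]≤1 (g (j e) (i f) u)) (≤-reflexive (cong (λ t → [ t ] + 0) r))) z≤n)))
        inside false b c p q r = small ii (subst (_≤ 2) (sym corner)
          (+-mono-≤ {y = 1} (+-mono-≤ ([]≤1 (g (i e) (i f) u)) (≤-reflexive (cong (λ t → [ t ] + 0) p)))
            (+-mono-≤ {y = 1} (+-mono-≤ ([]≤1 (g (j e) (i f) u))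
              (≤-reflexive (cong (λ t → [ t ] + 0) (≢true⇒≡false (false⇒≢true p ∘ ij←jj))))) z≤n)))
        inside true false c p q r = small ii (subst (_≤ 2) (sym corner)
          (+-mono-≤ {y = 2} (+-mono-≤ ([]≤1 (g (i e) (i f) u)) (+-mono-≤ ([]≤1 (g (i e) (j f) u)) z≤n))
            (+-mono-≤ {y = 0} (+-mono-≤ {y = 0} (≤-reflexive (cong [_] q))
              (≤-reflexive (cong (λ t → [ t ] + 0) (≢true⇒≡false (false⇒≢true q ∘ ji←jj))))) z≤n)))

      H-ii : Big e f → H (i e) (i f)
      H-ii (cross ij _) = ii←ij ij
      H-ii (row ik)     = ii←ij (ij←ik ik)
      H-ii (col ki)     = ii←ji (ji←ki ki)

      P≡0 : ne e ≡ false ⊎ ne f ≡ false → P e f ≡ 0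
      P≡0 empty with shape
      ... | none q          = q
      ... | small h _       = ⊥-elim (contra empty h)
        where
        contra : ne e ≡ false ⊎ ne f ≡ false → H (i e) (i f) → ⊥
        contra (inj₁ q) h = false⇒≢true q (oi₁ h)
        contra (inj₂ q) h = false⇒≢true q (oi₂ h)
      P≡0 (inj₁ q) | big b _        = ⊥-elim (false⇒≢true q (oi₁ (H-ii b)))
      P≡0 (inj₂ q) | big b _        = ⊥-elim (false⇒≢true q (oi₂ (H-ii b)))
      P≡0 (inj₁ q) | square ij _ _ _ = ⊥-elim (false⇒≢true q (oi₁ (ii←ij ij)))
      P≡0 (inj₂ q) | square ij _ _ _ = ⊥-elim (false⇒≢true q (oi₂ (ii←ij ij)))

      P≤4 : P e f ≤ 4
      P≤4 with shape
      ... | none q         = ≤-trans (≤-reflexive q) z≤n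
      ... | small _ q      = ≤-trans q (s≤s (s≤s z≤n))
      ... | big _ q        = ≤-trans q (n≤1+n 3)
      ... | square _ _ _ q = q

    -- Missing transversals of three blocks

    module ThirdBlock {e f h R} (p : M ↭ e ∷ f ∷ h ∷ R) where
      private
        q = rot₃ p
        open Pos (h ∷ e ∷ f ∷ []) R q
        edge = block-edge q
      -- 0 may stand in for any vertex of the block `h`, which frees that vertex for a transversal.
      ojk : g 0 (j h) (k h) ≡ true
      ojk = down 0 edge (pos 2 refl) (apart 1 3 refl) (apart 1 4 refl)
      oik : g 0 (i h) (k h) ≡ true
      oik = ≡.trans (sym₁ 0 (i h) (k h)) (down₂ 0 edge (pos 3 refl) (apart 1 2 refl) (apart 1 4 refl))
      oij : g 0 (i h) (j h) ≡ true
      oij = ≡.trans (sym₁ 0 (i h) (j h)) (≡.trans (sym₂ (i h) 0 (j h))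
        (down₃ 0 edge (pos 4 refl) (apart 1 2 refl) (apart 1 3 refl)))

    lose₁ : ∀ Bs R → M ↭ Bs ++ R → let X = z ∷ 0 ∷ verts Bs in ∀ t P →
      positions (length X) (vl t ++ pverts P) ≡ true → suc (length P) ≡ suc (length Bs) →
      All PairH (map (mapPair (at X)) P) → 1 ≤ miss (at X (i t)) (at X (j t)) (at X (k t)) + 0
    lose₁ Bs R p t P q l hs = cl₁ λ a → clash Bs R p (t ∷ []) P q l (a ∷ []) hs

    lose₂ : ∀ Bs R → M ↭ Bs ++ R → let X = z ∷ 0 ∷ verts Bs in ∀ t t′ P →
      positions (length X) (vl t ++ vl t′ ++ pverts P) ≡ true → suc (suc (length P)) ≡ suc (length Bs) →
      All PairH (map (mapPair (at X)) P) →
      1 ≤ miss (at X (i t)) (at X (j t)) (at X (k t)) + (miss (at X (i t′)) (at X (j t′)) (at X (k t′)) + 0)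
    lose₂ Bs R p t t′ P q l hs = cl₂ λ a b → clash Bs R p (t ∷ t′ ∷ []) P q l (a ∷ b ∷ []) hs

    -- The pairs {i e, i f} and {0, i h} leave two vertices in each block. Their eight transversals
    -- form four complementary couples, and a couple of edges would make four members in place of
    -- three blocks.
    four-lost : ∀ {e f h R} → M ↭ e ∷ f ∷ h ∷ R → H (i e) (i f) → H 0 (i h) → 4 ≤ Tm e f h
    four-lost {e} {f} {h} {R} p ii oi = lost e f h ((13 ∷ 26 ∷ []) ∷ (14 ∷ 25 ∷ []) ∷ (16 ∷ 23 ∷ []) ∷ (17 ∷ 22 ∷ []) ∷ []) refl
      (no₂ (tri 3 6 9) (tri 4 7 10) ((2 , 5) ∷ (1 , 8) ∷ []) refl refl (ii ∷ oi ∷ [])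
      ∷ no₂ (tri 3 6 10) (tri 4 7 9) ((2 , 5) ∷ (1 , 8) ∷ []) refl refl (ii ∷ oi ∷ [])
      ∷ no₂ (tri 3 7 9) (tri 4 6 10) ((2 , 5) ∷ (1 , 8) ∷ []) refl refl (ii ∷ oi ∷ [])
      ∷ no₂ (tri 3 7 10) (tri 4 6 9) ((2 , 5) ∷ (1 , 8) ∷ []) refl refl (ii ∷ oi ∷ [])
      ∷ [])
      where
      Bs = e ∷ f ∷ h ∷ []
      no₂ = lose₂ Bs R p

    -- All three pairs together rule out the transversals through k e, k f and j h or k h. Using {0,
    -- i h} with only one of the crossing pairs leaves complementary couples; two couples for each
    -- choice avoid the transversals already counted.
    six-lost-cross : ∀ {e f h R} → M ↭ e ∷ f ∷ h ∷ R → H (i e) (j f) → H (j e) (i f) → H 0 (i h) → 6 ≤ Tm e f h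
    six-lost-cross {e} {f} {h} {R} p ij ji oi = lost e f h ((25 ∷ []) ∷ (26 ∷ []) ∷ (16 ∷ 20 ∷ []) ∷ (17 ∷ 19 ∷ []) ∷ (7 ∷ 23 ∷ []) ∷ (8 ∷ 22 ∷ []) ∷ []) refl
      (no₁ (tri 4 7 9) ((2 , 6) ∷ (3 , 5) ∷ (1 , 8) ∷ []) refl refl (ij ∷ ji ∷ oi ∷ [])
      ∷ no₁ (tri 4 7 10) ((2 , 6) ∷ (3 , 5) ∷ (1 , 8) ∷ []) refl refl (ij ∷ ji ∷ oi ∷ [])
      ∷ no₂ (tri 3 7 9) (tri 4 5 10) ((2 , 6) ∷ (1 , 8) ∷ []) refl refl (ij ∷ oi ∷ [])
      ∷ no₂ (tri 3 7 10) (tri 4 5 9) ((2 , 6) ∷ (1 , 8) ∷ []) refl refl (ij ∷ oi ∷ [])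
      ∷ no₂ (tri 2 7 9) (tri 4 6 10) ((3 , 5) ∷ (1 , 8) ∷ []) refl refl (ji ∷ oi ∷ [])
      ∷ no₂ (tri 2 7 10) (tri 4 6 9) ((3 , 5) ∷ (1 , 8) ∷ []) refl refl (ji ∷ oi ∷ [])
      ∷ [])
      where
      Bs = e ∷ f ∷ h ∷ []
      no₁ = lose₁ Bs R p
      no₂ = lose₂ Bs R p

    -- Any vertex of `f` can go with i e. The twelve transversals avoiding i e and i h are therefore
    -- coupled by moving from j e to k e, one step cyclically in `f`, and to the other vertex in
    -- `h`; the vertex of `f` left over is the one paired with i e.
    six-lost-row : ∀ {e f h R} → M ↭ e ∷ f ∷ h ∷ R →
      H (i e) (i f) → H (i e) (j f) → H (i e) (k f) → H 0 (i h) → 6 ≤ Tm e f h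
    six-lost-row {e} {f} {h} {R} p ii ij ik oi = lost e f h ((10 ∷ 23 ∷ []) ∷ (13 ∷ 26 ∷ []) ∷ (16 ∷ 20 ∷ []) ∷ (11 ∷ 22 ∷ []) ∷ (14 ∷ 25 ∷ []) ∷ (17 ∷ 19 ∷ []) ∷ []) refl
      (no₂ (tri 3 5 9) (tri 4 6 10) ((2 , 7) ∷ (1 , 8) ∷ []) refl refl (ik ∷ oi ∷ [])
      ∷ no₂ (tri 3 6 9) (tri 4 7 10) ((2 , 5) ∷ (1 , 8) ∷ []) refl refl (ii ∷ oi ∷ [])
      ∷ no₂ (tri 3 7 9) (tri 4 5 10) ((2 , 6) ∷ (1 , 8) ∷ []) refl refl (ij ∷ oi ∷ [])
      ∷ no₂ (tri 3 5 10) (tri 4 6 9) ((2 , 7) ∷ (1 , 8) ∷ []) refl refl (ik ∷ oi ∷ [])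
      ∷ no₂ (tri 3 6 10) (tri 4 7 9) ((2 , 5) ∷ (1 , 8) ∷ []) refl refl (ii ∷ oi ∷ [])
      ∷ no₂ (tri 3 7 10) (tri 4 5 9) ((2 , 6) ∷ (1 , 8) ∷ []) refl refl (ij ∷ oi ∷ [])
      ∷ [])
      where
      Bs = e ∷ f ∷ h ∷ []
      no₂ = lose₂ Bs R p

    six-lost : ∀ {e f h R} → M ↭ e ∷ f ∷ h ∷ R → Big e f → H 0 (i h) → 6 ≤ Tm e f h
    six-lost p (cross ij ji) oi = six-lost-cross p ij ji oi
    six-lost p (row ik) oi = six-lost-row p (ii←ij (ij←ik ik)) (ij←ik ik) ik oi
      where open Two p
    six-lost {e} {f} {h} p (col ki) oi = subst (6 ≤_) (Tm-sym₁ f e h)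
      (six-lost-row (rot p) (ii←ij (ij←ik (H-sym ki))) (ij←ik (H-sym ki)) (H-sym ki) oi)
      where open Two (rot p)

    -- These are the transversals through at least two of the last vertices k e, k f, k h. For each,
    -- 0 and the first two vertices of the blocks still carry three disjoint pairs of `H`, so the
    -- transversal alone gives a clash.
    seven-lost : ∀ {e f h R} → M ↭ e ∷ f ∷ h ∷ R →
      H (i e) (i f) → H (i e) (j f) → H (j e) (i f) → H (j e) (j f) →
      H (i e) (i h) → H (i e) (j h) → H (j e) (i h) → H (j e) (j h) →
      H (i f) (j h) → H (j f) (j h) → H 0 (i f) → H 0 (i h) → 7 ≤ Tm e f h
    seven-lost {e} {f} {h} {R} p ii₁₂ ij₁₂ ji₁₂ jj₁₂ ii₁₃ ij₁₃ ji₁₃ jj₁₃ ij₂₃ jj₂₃ oi₂ oi₃ = lost e f h ((26 ∷ []) ∷ (17 ∷ []) ∷ (8 ∷ []) ∷ (23 ∷ []) ∷ (20 ∷ []) ∷ (25 ∷ []) ∷ (24 ∷ []) ∷ []) refl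
      (no₁ (tri 4 7 10) ((2 , 6) ∷ (5 , 9) ∷ (3 , 8) ∷ []) refl refl (ij₁₂ ∷ ij₂₃ ∷ ji₁₃ ∷ [])
      ∷ no₁ (tri 3 7 10) ((2 , 5) ∷ (6 , 9) ∷ (1 , 8) ∷ []) refl refl (ii₁₂ ∷ jj₂₃ ∷ oi₃ ∷ [])
      ∷ no₁ (tri 2 7 10) ((3 , 5) ∷ (6 , 9) ∷ (1 , 8) ∷ []) refl refl (ji₁₂ ∷ jj₂₃ ∷ oi₃ ∷ [])
      ∷ no₁ (tri 4 6 10) ((2 , 5) ∷ (3 , 9) ∷ (1 , 8) ∷ []) refl refl (ii₁₂ ∷ jj₁₃ ∷ oi₃ ∷ [])
      ∷ no₁ (tri 4 5 10) ((2 , 6) ∷ (3 , 9) ∷ (1 , 8) ∷ []) refl refl (ij₁₂ ∷ jj₁₃ ∷ oi₃ ∷ [])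
      ∷ no₁ (tri 4 7 9) ((2 , 8) ∷ (3 , 6) ∷ (1 , 5) ∷ []) refl refl (ii₁₃ ∷ jj₁₂ ∷ oi₂ ∷ [])
      ∷ no₁ (tri 4 7 8) ((2 , 9) ∷ (3 , 6) ∷ (1 , 5) ∷ []) refl refl (ij₁₃ ∷ jj₁₂ ∷ oi₂ ∷ [])
      ∷ [])
      where
      Bs = e ∷ f ∷ h ∷ []
      no₁ = lose₁ Bs R p

    -- The crossing pairs use up all but k e and k f. A transversal through these takes one vertex
    -- of `h`, and the other two form an edge with 0. Nothing is asked of `H` on `h`, which may be
    -- empty.
    three-lost-cross : ∀ {e f h R} → M ↭ e ∷ f ∷ h ∷ R → H (i e) (j f) → H (j e) (i f) → 3 ≤ Tm e f h
    three-lost-cross {e} {f} {h} {R} p ij ji = lost e f h ((24 ∷ []) ∷ (25 ∷ []) ∷ (26 ∷ []) ∷ []) refl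
      (cl₁ (λ a → clash Bs R p (tri 4 7 8 ∷ tri 1 9 10 ∷ []) ((2 , 6) ∷ (3 , 5) ∷ []) refl refl (a ∷ ojk ∷ []) (ij ∷ ji ∷ []))
      ∷ cl₁ (λ a → clash Bs R p (tri 4 7 9 ∷ tri 1 8 10 ∷ []) ((2 , 6) ∷ (3 , 5) ∷ []) refl refl (a ∷ oik ∷ []) (ij ∷ ji ∷ []))
      ∷ cl₁ (λ a → clash Bs R p (tri 4 7 10 ∷ tri 1 8 9 ∷ []) ((2 , 6) ∷ (3 , 5) ∷ []) refl refl (a ∷ oij ∷ []) (ij ∷ ji ∷ []))
      ∷ [])
      where
      Bs = e ∷ f ∷ h ∷ []
      open ThirdBlock p

    -- As for crossing pairs, with the two pairs now lying inside the blocks.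
    three-lost-T2 : ∀ {e f h R} → M ↭ e ∷ f ∷ h ∷ R → H (i e) (j e) → H (i f) (j f) → 3 ≤ Tm e f h
    three-lost-T2 {e} {f} {h} {R} p t₁ t₂ = lost e f h ((24 ∷ []) ∷ (25 ∷ []) ∷ (26 ∷ []) ∷ []) refl
      (cl₁ (λ a → clash Bs R p (tri 4 7 8 ∷ tri 1 9 10 ∷ []) ((2 , 3) ∷ (5 , 6) ∷ []) refl refl (a ∷ ojk ∷ []) (t₁ ∷ t₂ ∷ []))
      ∷ cl₁ (λ a → clash Bs R p (tri 4 7 9 ∷ tri 1 8 10 ∷ []) ((2 , 3) ∷ (5 , 6) ∷ []) refl refl (a ∷ oik ∷ []) (t₁ ∷ t₂ ∷ []))
      ∷ cl₁ (λ a → clash Bs R p (tri 4 7 10 ∷ tri 1 8 9 ∷ []) ((2 , 3) ∷ (5 , 6) ∷ []) refl refl (a ∷ oij ∷ []) (t₁ ∷ t₂ ∷ []))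
      ∷ [])
      where
      Bs = e ∷ f ∷ h ∷ []
      open ThirdBlock p

    -- The nine transversals through k e split into three parallel classes of f × h. Were a whole
    -- class present, lowering k e to k f₁ and to k f₂ in two of its members would give three
    -- disjoint edges; with the pairs {i, j} of the three T2 blocks these are six members in place
    -- of five blocks.
    three-lost-rainbow : ∀ {e f h f₁ f₂ R} → M ↭ e ∷ f ∷ h ∷ f₁ ∷ f₂ ∷ R →
      H (i e) (j e) → H (i f₁) (j f₁) → H (i f₂) (j f₂) → k f₁ < k e → k f₂ < k e → 3 ≤ Tm e f h
    three-lost-rainbow {e} {f} {h} {f₁} {f₂} {R} p t t₁ t₂ q₁ q₂ = lost e f h ((18 ∷ 22 ∷ 26 ∷ []) ∷ (19 ∷ 23 ∷ 24 ∷ []) ∷ (20 ∷ 21 ∷ 25 ∷ []) ∷ []) refl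
      (cl₃ (λ a b c → clash Bs R p (tri 4 5 8 ∷ tri 13 6 9 ∷ tri 16 7 10 ∷ []) ((2 , 3) ∷ (11 , 12) ∷ (14 , 15) ∷ []) refl refl (a ∷ low 13 6 9 refl q₁ b ∷ low 16 7 10 refl q₂ c ∷ []) (t ∷ t₁ ∷ t₂ ∷ []))
      ∷ cl₃ (λ a b c → clash Bs R p (tri 4 5 9 ∷ tri 13 6 10 ∷ tri 16 7 8 ∷ []) ((2 , 3) ∷ (11 , 12) ∷ (14 , 15) ∷ []) refl refl (a ∷ low 13 6 10 refl q₁ b ∷ low 16 7 8 refl q₂ c ∷ []) (t ∷ t₁ ∷ t₂ ∷ []))
      ∷ cl₃ (λ a b c → clash Bs R p (tri 4 5 10 ∷ tri 13 6 8 ∷ tri 16 7 9 ∷ []) ((2 , 3) ∷ (11 , 12) ∷ (14 , 15) ∷ []) refl refl (a ∷ low 13 6 8 refl q₁ b ∷ low 16 7 9 refl q₂ c ∷ []) (t ∷ t₁ ∷ t₂ ∷ []))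
      ∷ [])
      where
      Bs = e ∷ f ∷ h ∷ f₁ ∷ f₂ ∷ []
      open Pos Bs R p
      low : ∀ a b c → positions 17 (a ∷ b ∷ c ∷ []) ≡ true → at X a < k e →
        g (k e) (at X b) (at X c) ≡ true → g (at X a) (at X b) (at X c) ≡ true
      low a b c h lt q with map-at-unique {X} unX (a ∷ b ∷ c ∷ []) h
      ... | (ab ∷ ac ∷ _) ∷ _ = down (at X a) q lt ab ac

    -- Two edges (j, y, w), (k, y′, w′) would leave the pair {i e, i f} of H with one more vertex w″:
    -- a perfect matching with one more edge of type T2.

    six-lost-maximal : ∀ {e f h R} → M ↭ e ∷ f ∷ h ∷ R → t2 e ≡ false → t2 f ≡ false → t2 h ≡ false →
      H (i e) (i f) → 6 ≤ Tm e f h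
    six-lost-maximal {e} {f} {h} {R} p te tf th ii = lost e f h ((12 ∷ 25 ∷ []) ∷ (13 ∷ 26 ∷ []) ∷ (14 ∷ 24 ∷ []) ∷ (15 ∷ 22 ∷ []) ∷ (16 ∷ 23 ∷ []) ∷ (17 ∷ 21 ∷ []) ∷ []) refl
      (cl₂ (λ a b → improve 6 8 7 9 10 refl a b)
      ∷ cl₂ (λ a b → improve 6 9 7 10 8 refl a b)
      ∷ cl₂ (λ a b → improve 6 10 7 8 9 refl a b)
      ∷ cl₂ (λ a b → improve 7 8 6 9 10 refl a b)
      ∷ cl₂ (λ a b → improve 7 9 6 10 8 refl a b)
      ∷ cl₂ (λ a b → improve 7 10 6 8 9 refl a b)
      ∷ [])
      where
      Bs = e ∷ f ∷ h ∷ []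
      open Pos Bs R p
      improve : ∀ y w y′ w′ w″ → positions 11 (0 ∷ 1 ∷ 2 ∷ 5 ∷ w″ ∷ 3 ∷ y ∷ w ∷ 4 ∷ y′ ∷ w′ ∷ []) ≡ true →
        g (j e) (at X y) (at X w) ≡ true → g (k e) (at X y′) (at X w′) ≡ true → ⊥
      improve y w y′ w′ w″ pos₁₁ a b = 1+n≰n (begin
        suc (count-t2 M) ≡⟨ cong suc (S1-↭ p) ⟩
        suc (S1 (e ∷ f ∷ h ∷ R) ([_] ∘ t2)) ≡⟨ cong suc (begin-equality
          [ t2 e ] + ([ t2 f ] + ([ t2 h ] + count-t2 R)) ≡⟨ cong₂ (λ a b → a + (b + ([ t2 h ] + count-t2 R))) (cong [_] te) (cong [_] tf) ⟩
          [ t2 h ] + count-t2 R ≡⟨ cong (λ t → [ t ] + count-t2 R) th ⟩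
          count-t2 R ∎) ⟩
        1 + count-t2 R ≡⟨ cong (λ t → [ t ] + count-t2 R) (proj₂ (proj₂ (proj₂ (proj₂ t₁))) w″<u ii) ⟨
        [ t2 (proj₁ t₁) ] + count-t2 R ≤⟨ +-monoʳ-≤ [ t2 (proj₁ t₁) ] (≤-trans (m≤n+m _ [ t2 (proj₁ t₃) ]) (m≤n+m _ [ t2 (proj₁ t₂) ])) ⟩
        count-t2 M′ ≤⟨ maximal M′ perfect′ ⟩
        count-t2 M ∎)
        where
        open ≤-Reasoning
        -- z and 0, then the three new blocks {i e, i f, w″}, {j e, y, w} and {k e, y′, w′}. All
        -- eleven positions occur, so the new matching covers the same vertices.
        is = 0 ∷ 1 ∷ 2 ∷ 5 ∷ w″ ∷ 3 ∷ y ∷ w ∷ 4 ∷ y′ ∷ w′ ∷ []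
        bounded : All (_< u) (map (at X) is)
        bounded = map-at-All (AllP.++⁻ˡ X (All-resp-↭ (↭-sym permX) (range-< (3 * s + 2)))) is pos₁₁
        un′ : Unique (map (at X) is ++ verts R)
        un′ = map-at-unique {X} unX is pos₁₁
        w″<u : at X w″ < u
        w″<u = All.lookup bounded (there (there (there (there (here refl)))))
        fresh : ∀ {a b c d v R} → Unique (a ∷ b ∷ c ∷ d ∷ v ∷ R) → v ≢ c × v ≢ d
        fresh (_ ∷ _ ∷ (_ ∷ cv ∷ _) ∷ (dv ∷ _) ∷ _) = cv ∘ sym , dv ∘ sym
        new : g (i e) (i f) (at X w″) ≡ true
        new = down₃ (at X w″) ii w″<u (proj₁ (fresh un′)) (proj₂ (fresh un′))
        t₁ = sort3 new
        t₂ = sort3 a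
        t₃ = sort3 b
        M′ = proj₁ t₁ ∷ proj₁ t₂ ∷ proj₁ t₃ ∷ R
        full : is ↭ range 11
        full with positions-sound 11 is pos₁₁
        ... | a , un = unique-full un a refl
        perm′ : z ∷ 0 ∷ verts M′ ↭ range (3 * s + 2)
        perm′ = trans (prep z (prep 0
          (trans (++⁺ (proj₁ (proj₂ (proj₂ (proj₂ t₁)))) (++⁺ (proj₁ (proj₂ (proj₂ (proj₂ t₂)))) (++⁺ (proj₁ (proj₂ (proj₂ (proj₂ t₃)))) refl)))
            refl)))
          (trans (++⁺ʳ (verts R) (map⁺ (at X) full)) permX)
        perfect′ : Perfect M′
        perfect′ = record
          { edgesM  = proj₁ (proj₂ (proj₂ t₁)) ∷ proj₁ (proj₂ (proj₂ t₂)) ∷ proj₁ (proj₂ (proj₂ t₃)) ∷ AllP.++⁻ʳ Bs (All-resp-↭ p edgesM)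
          ; lenM    = ≡.trans (sym (↭-length p)) lenM
          ; permM   = perm′
          ; sortedM = proj₁ (proj₂ t₁) ∷ proj₁ (proj₂ t₂) ∷ proj₁ (proj₂ t₃) ∷ AllP.++⁻ʳ Bs (All-resp-↭ p sortedM)
          }

    -- Missing edges on two blocks and z

    six-lost-Q : ∀ {e f R} → M ↭ e ∷ f ∷ R → H 0 (i e) → 6 ≤ Q₁ e f + Qz e f
    -- Besides {0, i e} there remain z, j e, k e and `f`. A vertex of {j e, k e} with two vertices
    -- of `f`, and z with the other two, can be chosen in 2 · 3 ways; each way contains a non-edge.
    six-lost-Q {e} {f} {R} p oi = subst (6 ≤_) total (clauses-≤-sum (pairs ++ transversals) ((3 ∷ 17 ∷ []) ∷ (4 ∷ 16 ∷ []) ∷ (5 ∷ 15 ∷ []) ∷ (6 ∷ 14 ∷ []) ∷ (7 ∷ 13 ∷ []) ∷ (8 ∷ 12 ∷ []) ∷ []) refl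
      (no₂ (tri 3 5 6) (tri 0 4 7) ((1 , 2) ∷ []) refl refl (oi ∷ [])
      ∷ no₂ (tri 3 5 7) (tri 0 4 6) ((1 , 2) ∷ []) refl refl (oi ∷ [])
      ∷ no₂ (tri 3 6 7) (tri 0 4 5) ((1 , 2) ∷ []) refl refl (oi ∷ [])
      ∷ no₂ (tri 4 5 6) (tri 0 3 7) ((1 , 2) ∷ []) refl refl (oi ∷ [])
      ∷ no₂ (tri 4 5 7) (tri 0 3 6) ((1 , 2) ∷ []) refl refl (oi ∷ [])
      ∷ no₂ (tri 4 6 7) (tri 0 3 5) ((1 , 2) ∷ []) refl refl (oi ∷ [])
      ∷ []))
      where
      Bs = e ∷ f ∷ []
      no₂ = lose₂ Bs R p
      pairs = concatMap (λ x → miss x (i f) (j f) ∷ miss x (i f) (k f) ∷ miss x (j f) (k f) ∷ []) (vl e)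
      transversals = concatMap (λ x → map (miss z x) (vl f)) (vl e)
      total : sum (pairs ++ transversals) ≡ Q₁ e f + Qz e f
      total = ≡.trans (sum-++ pairs transversals) (cong₂ _+_
        (≡.trans (sum-concatMap (λ x → miss x (i f) (j f) ∷ miss x (i f) (k f) ∷ miss x (j f) (k f) ∷ []) (vl e))
          (S1-cong (vl e) λ x → solve 3 (λ a b c → a :+ (b :+ (c :+ con 0)) := (a :+ (b :+ con 0)) :+ ((c :+ con 0) :+ con 0)) refl
            (miss x (i f) (j f)) (miss x (i f) (k f)) (miss x (j f) (k f))))
        (≡.trans (sum-concatMap (λ x → map (miss z x) (vl f)) (vl e)) (S1-cong (vl e) λ x → sum-map (miss z x) (vl f))))

-- Weighing pairs of H against non-edges

module Weighing {n s : ℕ} {g : ℕ → ℕ → ℕ → Bool} (sh : Shifted n g) (ν : ν≤ g s)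
  (M : List Tri) (pf : Blocks.Perfect sh ν M)
  (maximal : ∀ M′ → Blocks.Perfect sh ν M′ → Blocks.count-t2 sh ν M′ ≤ Blocks.count-t2 sh ν M) where

  open Shifted sh
  open Link {n} {s} {g} sh ν using (H; H-sym; u; z)
  open Blocks sh ν
  open Counting M pf maximal

  private
    -- `x` bounds the pairs of `H` from above and `y` the non-edges from below, which reduces each
    -- local estimate to numerals.
    weigh : ∀ {a b} x y → a ≤ x → y ≤ b → 8 * x ≤ 15 * y → 8 * a ≤ 15 * b
    weigh x y p q r = ≤-trans (*-monoʳ-≤ 8 p) (≤-trans r (*-monoʳ-≤ 15 q))

  Qm≥6 : ∀ {e f R} → M ↭ e ∷ f ∷ R → ne e ≡ true ⊎ ne f ≡ true → 6 ≤ Qm e f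
  Qm≥6 {e} {f} p (inj₁ q) = ≤-trans (six-lost-Q p q) (+-monoˡ-≤ (Qz e f) (m≤m+n (Q₁ e f) (Q₁ f e)))
  Qm≥6 {e} {f} p (inj₂ q) = ≤-trans (subst (λ t → 6 ≤ Q₁ f e + t) (Qz-sym f e) (six-lost-Q (rot p) q))
    (+-monoˡ-≤ (Qz e f) (m≤n+m (Q₁ f e) (Q₁ e f)))

  NE≤1 : ∀ e f → NE e f ≤ 1
  NE≤1 e f = []≤1 _

  -- A nonempty block forces six non-edges, worth 90. Two nonempty blocks have at most six inner
  -- pairs, worth 48, and `NE` is 0. If one block is empty at most three inner pairs are left, worth
  -- 24, and the surplus covers 48 more.
  pair-bound : ∀ {e f R} → M ↭ e ∷ f ∷ R → 8 * (inner e + inner f) + 48 * NE e f ≤ 15 * Qm e f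
  pair-bound {e} {f} {R} p = go (ne e) (ne f) refl refl
    where
    go : ∀ a b → ne e ≡ a → ne f ≡ b → 8 * (inner e + inner f) + 48 * NE e f ≤ 15 * Qm e f
    go false false q r rewrite inner≡0 p q | inner≡0 (rot p) r | q | r = z≤n
    go true true q r = ≤-trans
      (+-mono-≤ (*-monoʳ-≤ 8 (+-mono-≤ (inner≤3 p) (inner≤3 (rot p)))) (≤-reflexive (cong (48 *_) zero-NE)))
      (≤-trans (≤ᵇ⇒≤ 48 90 _) (*-monoʳ-≤ 15 (Qm≥6 p (inj₁ q))))
      where
      zero-NE : NE e f ≡ 0
      zero-NE rewrite q | r with t2 e
      ... | true  = refl
      ... | false = refl
    go true false q r = ≤-trans
      (+-mono-≤ (*-monoʳ-≤ 8 (+-mono-≤ (inner≤3 p) (≤-reflexive (inner≡0 (rot p) r)))) (*-monoʳ-≤ 48 (NE≤1 e f)))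
      (≤-trans (≤ᵇ⇒≤ 72 90 _) (*-monoʳ-≤ 15 (Qm≥6 p (inj₁ q))))
    go false true q r = ≤-trans
      (+-mono-≤ (*-monoʳ-≤ 8 (+-mono-≤ (≤-reflexive (inner≡0 p q)) (inner≤3 (rot p)))) (*-monoʳ-≤ 48 (NE≤1 e f)))
      (≤-trans (≤ᵇ⇒≤ 72 90 _) (*-monoʳ-≤ 15 (Qm≥6 p (inj₂ r))))

  Square : Tri → Tri → Set
  Square e f = H (i e) (j f) × H (j e) (i f) × H (j e) (j f)

  square? : ∀ {e f} → Shape e f → Square e f ⊎ P e f ≤ 3
  square? (none q)         = inj₂ (≤-trans (≤-reflexive q) z≤n)
  square? (small _ q)      = inj₂ (≤-trans q (n≤1+n 2))
  square? (big _ q)        = inj₂ q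
  square? (square a b c q) = inj₁ (a , b , c)

  big? : ∀ {e f} → Shape e f → Big e f ⊎ (P e f ≤ 2 × (P e f ≡ 0 ⊎ H (i e) (i f)))
  big? (none q)         = inj₂ (≤-trans (≤-reflexive q) z≤n , inj₁ q)
  big? (small h q)      = inj₂ (q , inj₂ h)
  big? (big b q)        = inj₁ b
  big? (square a b c q) = inj₁ (cross a b)

  module Three {e f h R} (p : M ↭ e ∷ f ∷ h ∷ R) where
    p₁₃ : M ↭ e ∷ h ∷ f ∷ R
    p₁₃ = swap₂₃ p
    p₂₃ : M ↭ f ∷ h ∷ e ∷ R
    p₂₃ = swap₂₃ (rot p)

    to₁₃ : ∀ {c} → c ≤ Tm e h f → c ≤ Tm e f h
    to₁₃ {c} = subst (c ≤_) (Tm-sym₂ e h f)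
    to₂₃ : ∀ {c} → c ≤ Tm f h e → c ≤ Tm e f h
    to₂₃ {c} = subst (c ≤_) (≡.trans (Tm-sym₂ f h e) (Tm-sym₁ f e h))

    ΣP : ℕ
    ΣP = P e f + (P e h + P f h)

    -- Three squares give 12 pairs against 7 non-edges. Otherwise there are at most 11 pairs,
    -- against 6 non-edges as soon as two blocks have a big shape or a square; this is the tight
    -- case, 88 ≤ 90. What is left has at most 6 pairs, against 4 non-edges if there is a pair at
    -- all.
    nonempty-bound : ne e ≡ true → ne f ≡ true → ne h ≡ true → 8 * ΣP ≤ 15 * Tm e f h
    nonempty-bound qe qf qh = squares (square? s₁₂) (square? s₁₃) (square? s₂₃)
      where
      s₁₂ = Two.shape p
      s₁₃ = Two.shape p₁₃
      s₂₃ = Two.shape p₂₃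
      not-all-squares : ΣP ≤ 11 → 8 * ΣP ≤ 15 * Tm e f h
      not-all-squares le = bigs (big? s₁₂) (big? s₁₃) (big? s₂₃)
        where
        six : 6 ≤ Tm e f h → 8 * ΣP ≤ 15 * Tm e f h
        six q = weigh 11 6 le q (≤ᵇ⇒≤ 88 90 _)
        bigs : Big e f ⊎ (P e f ≤ 2 × (P e f ≡ 0 ⊎ H (i e) (i f))) →
               Big e h ⊎ (P e h ≤ 2 × (P e h ≡ 0 ⊎ H (i e) (i h))) →
               Big f h ⊎ (P f h ≤ 2 × (P f h ≡ 0 ⊎ H (i f) (i h))) → 8 * ΣP ≤ 15 * Tm e f h
        bigs (inj₁ b) _ _ = six (six-lost p b qh)
        bigs (inj₂ _) (inj₁ b) _ = six (to₁₃ (six-lost p₁₃ b qf))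
        bigs (inj₂ _) (inj₂ _) (inj₁ b) = six (to₂₃ (six-lost p₂₃ b qe))
        bigs (inj₂ (x , a)) (inj₂ (y , b)) (inj₂ (w , c)) = smalls a b c
          where
          four : 4 ≤ Tm e f h → 8 * ΣP ≤ 15 * Tm e f h
          four q = weigh 6 4 (+-mono-≤ x (+-mono-≤ y w)) q (≤ᵇ⇒≤ 48 60 _)
          smalls : P e f ≡ 0 ⊎ H (i e) (i f) → P e h ≡ 0 ⊎ H (i e) (i h) → P f h ≡ 0 ⊎ H (i f) (i h) →
            8 * ΣP ≤ 15 * Tm e f h
          smalls (inj₂ q) _ _ = four (four-lost p q qh)
          smalls (inj₁ _) (inj₂ q) _ = four (to₁₃ (four-lost p₁₃ q qf))
          smalls (inj₁ _) (inj₁ _) (inj₂ q) = four (to₂₃ (four-lost p₂₃ q qe))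
          smalls (inj₁ a) (inj₁ b) (inj₁ c) = weigh {b = Tm e f h} 0 0 (≤-reflexive (cong₂ _+_ a (cong₂ _+_ b c))) z≤n z≤n
      squares : Square e f ⊎ P e f ≤ 3 → Square e h ⊎ P e h ≤ 3 → Square f h ⊎ P f h ≤ 3 → 8 * ΣP ≤ 15 * Tm e f h
      squares (inj₁ (ij , ji , jj)) (inj₁ (ij′ , ji′ , jj′)) (inj₁ (ij″ , ji″ , jj″)) =
        weigh 12 7 (+-mono-≤ (Two.P≤4 p) (+-mono-≤ (Two.P≤4 p₁₃) (Two.P≤4 p₂₃)))
          (seven-lost p (Two.ii←ij p ij) ij ji jj (Two.ii←ij p₁₃ ij′) ij′ ji′ jj′ ij″ jj″ qf qh) (≤ᵇ⇒≤ 96 105 _)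
      squares (inj₂ q) _ _ = not-all-squares (+-mono-≤ q (+-mono-≤ (Two.P≤4 p₁₃) (Two.P≤4 p₂₃)))
      squares (inj₁ _) (inj₂ q) _ = not-all-squares (+-mono-≤ (Two.P≤4 p) (+-mono-≤ q (Two.P≤4 p₂₃)))
      squares (inj₁ _) (inj₁ _) (inj₂ q) = not-all-squares (+-mono-≤ (Two.P≤4 p) (+-mono-≤ (Two.P≤4 p₁₃) q))

  -- Only a T2 block a with one nonempty, non-T2 block and one empty block can miss too few transversals.

  Exceptional : Tri → Tri → Tri → Set
  Exceptional a b c = t2 a ≡ true × NE b c ≡ 1

  NE-intro : ∀ f h → ne f ≡ true → t2 f ≡ false → ne h ≡ false → NE f h ≡ 1
  NE-intro f h q r t rewrite q | r | t = refl

  NE-sym : ∀ e f → NE e f ≡ NE f e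
  NE-sym e f with ne e | ne f | t2 e | t2 f
  ... | true  | true  | true  | true  = refl
  ... | true  | true  | true  | false = refl
  ... | true  | true  | false | true  = refl
  ... | true  | true  | false | false = refl
  ... | true  | false | true  | _     = refl
  ... | true  | false | false | _     = refl
  ... | false | true  | _     | true  = refl
  ... | false | true  | _     | false = refl
  ... | false | false | _     | _     = refl

  OneEmpty : Tri → Tri → Tri → Set
  OneEmpty e f h = 8 * P e f ≤ 15 * Tm e f h ⊎ (8 * P e f ≤ 24 × (Exceptional e f h ⊎ Exceptional f e h))

  -- Two T2 blocks allow an exchange with their own pairs. If neither is T2, the maximality of `M`
  -- applies, an empty `h` never being T2. With exactly one the triple is exceptional.
  one-empty-star : ∀ {e f h R} → M ↭ e ∷ f ∷ h ∷ R → ne e ≡ true → ne f ≡ true → ne h ≡ false →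
    H (i e) (i f) → P e f ≤ 3 → OneEmpty e f h
  one-empty-star {e} {f} {h} p qe qf qh ii q = go (t2 e) (t2 f) refl refl
    where
    th : t2 h ≡ false
    th = ≢true⇒≡false λ t → false⇒≢true qh (t2⇒ne (rot₃ p) t)
    go : ∀ a b → t2 e ≡ a → t2 f ≡ b → OneEmpty e f h
    go true  true  te tf = inj₁ (weigh 3 3 q (three-lost-T2 p te tf) (≤ᵇ⇒≤ 24 45 _))
    go false false te tf = inj₁ (weigh 3 6 q (six-lost-maximal p te tf th ii) (≤ᵇ⇒≤ 24 90 _))
    go true  false te tf = inj₂ (*-monoʳ-≤ 8 q , inj₁ (te , NE-intro f h qf tf qh))
    go false true  te tf = inj₂ (*-monoʳ-≤ 8 q , inj₂ (tf , NE-intro e h qe te qh))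

  -- Crossing pairs or a square cost three transversals even if `h` is empty. In the remaining
  -- shapes all pairs of `H` between `e` and `f` share a vertex, and the types of the blocks decide.
  one-empty-bound : ∀ {e f h R} → M ↭ e ∷ f ∷ h ∷ R → ne e ≡ true → ne f ≡ true → ne h ≡ false → OneEmpty e f h
  one-empty-bound {e} {f} {h} {R} p qe qf qh with Two.shape p
  ... | none q              = inj₁ (weigh {b = Tm e f h} 0 0 (≤-reflexive q) z≤n z≤n)
  ... | small ii q          = one-empty-star p qe qf qh ii (≤-trans q (n≤1+n 2))
  ... | square ij ji _ q    = inj₁ (weigh 4 3 q (three-lost-cross p ij ji) (≤ᵇ⇒≤ 32 45 _))
  ... | big (cross ij ji) q = inj₁ (weigh 3 3 q (three-lost-cross p ij ji) (≤ᵇ⇒≤ 24 45 _))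
  ... | big b@(row _) q     = one-empty-star p qe qf qh (Two.H-ii p b) q
  ... | big b@(col _) q     = one-empty-star p qe qf qh (Two.H-ii p b) q

  module TripleBound {e f h R} (p : M ↭ e ∷ f ∷ h ∷ R) where
    open Three p public

    Result : Set
    Result = 8 * ΣP ≤ 15 * Tm e f h ⊎
      (8 * ΣP ≤ 24 × (Exceptional e f h ⊎ Exceptional f e h ⊎ Exceptional h e f))

    -- By the number of empty blocks: these have no pairs of `H` to other blocks, so one of them
    -- leaves a single term of `ΣP` and two leave none.
    triple-bound : Result
    triple-bound = go (ne e) (ne f) (ne h) refl refl refl
      where
      only : ∀ {t a} {b : Set} → ΣP ≡ t → 8 * t ≤ a ⊎ (8 * t ≤ 24 × b) → 8 * ΣP ≤ a ⊎ (8 * ΣP ≤ 24 × b)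
      only refl r = r
      zero₁₂ = Two.P≡0 p
      zero₁₃ = Two.P≡0 p₁₃
      zero₂₃ = Two.P≡0 p₂₃
      map₂ : ∀ {A B C : Set} → (B → C) → A ⊎ (8 * ΣP ≤ 24 × B) → A ⊎ (8 * ΣP ≤ 24 × C)
      map₂ f (inj₁ a)       = inj₁ a
      map₂ f (inj₂ (q , b)) = inj₂ (q , f b)
      vacuous : ΣP ≡ 0 → Result
      vacuous q = inj₁ (weigh {b = Tm e f h} 0 0 (≤-reflexive q) z≤n z≤n)
      go : ∀ a b c → ne e ≡ a → ne f ≡ b → ne h ≡ c → Result
      go true true true qe qf qh = inj₁ (nonempty-bound qe qf qh)
      go true true false qe qf qh = map₂ (λ { (inj₁ x) → inj₁ x ; (inj₂ x) → inj₂ (inj₁ x) })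
        (only (≡.trans (cong₂ (λ a b → P e f + (a + b)) (zero₁₃ (inj₂ qh)) (zero₂₃ (inj₂ qh))) (+-identityʳ (P e f)))
          (one-empty-bound p qe qf qh))
      go true false true qe qf qh = map₂ (λ { (inj₁ (t , q)) → inj₁ (t , ≡.trans (NE-sym f h) q) ; (inj₂ x) → inj₂ (inj₂ x) })
        (only (≡.trans (cong₂ (λ a b → a + (P e h + b)) (zero₁₂ (inj₂ qf)) (zero₂₃ (inj₁ qf))) (+-identityʳ (P e h)))
          (subst (λ t → 8 * P e h ≤ 15 * t ⊎ (8 * P e h ≤ 24 × (Exceptional e h f ⊎ Exceptional h e f)))
            (Tm-sym₂ e h f) (one-empty-bound p₁₃ qe qh qf)))
      go false true true qe qf qh = map₂ (λ { (inj₁ (t , q)) → inj₂ (inj₁ (t , ≡.trans (NE-sym e h) q)) ; (inj₂ (t , q)) → inj₂ (inj₂ (t , ≡.trans (NE-sym e f) q)) })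
        (only (cong₂ (λ a b → a + (b + P f h)) (zero₁₂ (inj₁ qe)) (zero₁₃ (inj₁ qe)))
          (subst (λ t → 8 * P f h ≤ 15 * t ⊎ (8 * P f h ≤ 24 × (Exceptional f h e ⊎ Exceptional h f e)))
            (≡.trans (Tm-sym₂ f h e) (Tm-sym₁ f e h)) (one-empty-bound p₂₃ qf qh qe)))
      go false false _ qe qf qh = vacuous (cong₂ _+_ (zero₁₂ (inj₁ qe)) (cong₂ _+_ (zero₁₃ (inj₁ qe)) (zero₂₃ (inj₁ qf))))
      go false true false qe qf qh = vacuous (cong₂ _+_ (zero₁₂ (inj₁ qe)) (cong₂ _+_ (zero₁₃ (inj₁ qe)) (zero₂₃ (inj₂ qh))))
      go true false false qe qf qh = vacuous (cong₂ _+_ (zero₁₂ (inj₂ qf)) (cong₂ _+_ (zero₁₃ (inj₂ qh)) (zero₂₃ (inj₁ qf))))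

  t2⇒NE≡0 : ∀ {e R} f → M ↭ e ∷ R → t2 e ≡ true → NE e f ≡ 0
  t2⇒NE≡0 f p q rewrite t2⇒ne p q | q = refl

  -- By three-lost-rainbow only the two T2 blocks f₁, f₂ with the smallest last vertices occur in exceptional
  -- triples; each of them costs 24, which the term 48 NE of pair-bound pays for.

  module Total (f₁ f₂ : Tri) (M′ : List Tri) (split : M ↭ f₁ ∷ f₂ ∷ M′)
    (least : All (λ e → t2 e ≡ true → (t2 f₁ ≡ true × k f₁ < k e) × (t2 f₂ ≡ true × k f₂ < k e)) M′) where

    private
      ψ : Tri → Tri → Tri → ℕ
      ψ e f h = P e f + (P e h + P f h)

      leastOf : ∀ {e R} → M′ ↭ e ∷ R → t2 e ≡ true → (t2 f₁ ≡ true × k f₁ < k e) × (t2 f₂ ≡ true × k f₂ < k e)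
      leastOf q = All.head (All-resp-↭ q least)

      1≢0 : ∀ {x} → x ≡ 1 → x ≡ 0 → ⊥
      1≢0 refl ()

      front₁ : ∀ {A : Set} {M M′ : List A} {f₁ f₂ e R} → M ↭ f₁ ∷ f₂ ∷ M′ → M′ ↭ e ∷ R → M ↭ f₁ ∷ f₂ ∷ e ∷ R
      front₁ split q = trans split (prep _ (prep _ q))

      pay : ∀ x y → 1 ≤ y → 24 ≤ 15 * x + 24 * y
      pay x y l = ≤-trans (*-monoʳ-≤ 24 l) (m≤n+m (24 * y) (15 * x))

      both : ∀ {e R} → M′ ↭ e ∷ R → 8 * ψ f₁ f₂ e ≤ 15 * Tm f₁ f₂ e + 24 * (NE f₁ e + NE f₂ e)
      both {e} {R} q with TripleBound.triple-bound (front₁ split q)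
      ... | inj₁ le = ≤-trans le (m≤m+n _ _)
      ... | inj₂ (le , inj₁ (_ , x)) = ≤-trans le (pay (Tm f₁ f₂ e) (NE f₁ e + NE f₂ e) (≤-trans (≤-reflexive (sym x)) (m≤n+m (NE f₂ e) (NE f₁ e))))
      ... | inj₂ (le , inj₂ (inj₁ (_ , x))) = ≤-trans le (pay (Tm f₁ f₂ e) (NE f₁ e + NE f₂ e) (≤-trans (≤-reflexive (sym x)) (m≤m+n (NE f₁ e) (NE f₂ e))))
      -- If `e` is T2, then so is `f₁` by `least`, and a T2 block never contributes to `NE`.
      ... | inj₂ (le , inj₂ (inj₂ (t , x))) = ⊥-elim (1≢0 x (t2⇒NE≡0 f₂ split (proj₁ (proj₁ (leastOf q t)))))

      single : ∀ {φ} → (∀ {e R} → M′ ↭ e ∷ R → t2 e ≡ true → t2 φ ≡ true) →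
        ∀ {e f S R} → M ↭ φ ∷ S → M ↭ φ ∷ e ∷ f ∷ R → (∃ λ R → M′ ↭ e ∷ f ∷ R) →
        8 * ψ φ e f ≤ 15 * Tm φ e f + 24 * NE e f
      single {φ} lst {e} {f} front p (R , q) with TripleBound.triple-bound p
      ... | inj₁ le = ≤-trans le (m≤m+n _ _)
      ... | inj₂ (le , inj₁ (_ , x)) = ≤-trans le (pay (Tm φ e f) (NE e f) (≤-reflexive (sym x)))
      ... | inj₂ (le , inj₂ (inj₁ (t , x))) = ⊥-elim (1≢0 x (t2⇒NE≡0 f front (lst q t)))
      ... | inj₂ (le , inj₂ (inj₂ (t , x))) = ⊥-elim (1≢0 x (t2⇒NE≡0 e front (lst (trans q (swap e f refl)) t)))

      perm : ∀ {e f h R} → M′ ↭ e ∷ f ∷ h ∷ R → M ↭ e ∷ f ∷ h ∷ f₁ ∷ f₂ ∷ R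
      perm {e} {f} {h} {R} q = trans split (trans (prep f₁ (prep f₂ q))
        (↭-sym (trans (shift f₁ (e ∷ f ∷ h ∷ []) (f₂ ∷ R)) (prep f₁ (shift f₂ (e ∷ f ∷ h ∷ []) R)))))

      free : ∀ {e f h R} → M′ ↭ e ∷ f ∷ h ∷ R → 8 * ψ e f h ≤ 15 * Tm e f h
      free {e} {f} {h} {R} q with TripleBound.triple-bound (perm q)
      ... | inj₁ le = le
      ... | inj₂ (le , x) = ≤-trans le (≤-trans (≤ᵇ⇒≤ 24 45 _) (*-monoʳ-≤ 15 (rainbow x)))
        where
        three : ∀ {e f h R} → M′ ↭ e ∷ f ∷ h ∷ R → t2 e ≡ true → 3 ≤ Tm e f h
        three q t with leastOf q t
        ... | (t₁ , k₁) , (t₂ , k₂) = three-lost-rainbow (perm q) t t₁ t₂ k₁ k₂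
        rainbow : Exceptional e f h ⊎ Exceptional f e h ⊎ Exceptional h e f → 3 ≤ Tm e f h
        rainbow (inj₁ (t , _))        = three q t
        rainbow (inj₂ (inj₁ (t , _))) = subst (3 ≤_) (Tm-sym₁ f e h) (three (trans q (swap e f refl)) t)
        rainbow (inj₂ (inj₂ (t , _))) = subst (3 ≤_) (≡.trans (Tm-sym₁ h e f) (Tm-sym₂ e h f))
          (three (trans q (trans (prep e (swap f h refl)) (swap e h refl))) t)

    triples-bound : 8 * S3 (f₁ ∷ f₂ ∷ M′) ψ ≤ 15 * S3 (f₁ ∷ f₂ ∷ M′) Tm + 48 * S2 (f₁ ∷ f₂ ∷ M′) NE
    triples-bound = begin
      8 * ((S1 M′ (ψ f₁ f₂) + S2 M′ (ψ f₁)) + (S2 M′ (ψ f₂) + S3 M′ ψ))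
        ≡⟨ solve 4 (λ a b c d → con 8 :* ((a :+ b) :+ (c :+ d)) := (con 8 :* a :+ con 8 :* b) :+ (con 8 :* c :+ con 8 :* d)) refl
            (S1 M′ (ψ f₁ f₂)) (S2 M′ (ψ f₁)) (S2 M′ (ψ f₂)) (S3 M′ ψ) ⟩
      (8 * S1 M′ (ψ f₁ f₂) + 8 * S2 M′ (ψ f₁)) + (8 * S2 M′ (ψ f₂) + 8 * S3 M′ ψ)
        ≤⟨ +-mono-≤ (+-mono-≤ le₁ (le₂ f₁ p₁ l₁)) (+-mono-≤ (le₂ f₂ p₂ l₂) le₃) ⟩
      ((15 * a + 24 * (x + y)) + (15 * b + 24 * w)) + ((15 * c + 24 * w) + 15 * d)
        -- So far a pair inside `M′` is charged 24 for `f₁` and 24 for `f₂`, a pair of `f₁` or `f₂`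
        -- with a block of `M′` only 24, and {f₁, f₂} nothing. All are filled up to 48.
        ≤⟨ m≤m+n _ (48 * NE f₁ f₂ + 24 * (x + y)) ⟩
      (((15 * a + 24 * (x + y)) + (15 * b + 24 * w)) + ((15 * c + 24 * w) + 15 * d)) + (48 * NE f₁ f₂ + 24 * (x + y))
        ≡⟨ solve 8 (λ a b c d x y w v →
            (((con 15 :* a :+ con 24 :* (x :+ y)) :+ (con 15 :* b :+ con 24 :* w)) :+ ((con 15 :* c :+ con 24 :* w) :+ con 15 :* d)) :+ (con 48 :* v :+ con 24 :* (x :+ y))
            := con 15 :* ((a :+ b) :+ (c :+ d)) :+ con 48 :* ((v :+ x) :+ (y :+ w))) refl a b c d x y w (NE f₁ f₂) ⟩
      15 * ((a + b) + (c + d)) + 48 * ((NE f₁ f₂ + x) + (y + w)) ∎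
      where
      open ≤-Reasoning
      a = S1 M′ (Tm f₁ f₂)
      b = S2 M′ (Tm f₁)
      c = S2 M′ (Tm f₂)
      d = S3 M′ Tm
      x = S1 M′ (NE f₁)
      y = S1 M′ (NE f₂)
      w = S2 M′ NE
      le₁ : 8 * S1 M′ (ψ f₁ f₂) ≤ 15 * a + 24 * (x + y)
      le₁ = begin
        8 * S1 M′ (ψ f₁ f₂) ≡⟨ S1-* 8 (ψ f₁ f₂) M′ ⟨
        S1 M′ (λ e → 8 * ψ f₁ f₂ e) ≤⟨ S1-mono↭ M′ (λ e R q → both q) ⟩
        S1 M′ (λ e → 15 * Tm f₁ f₂ e + 24 * (NE f₁ e + NE f₂ e)) ≡⟨ S1-+ (λ e → 15 * Tm f₁ f₂ e) (λ e → 24 * (NE f₁ e + NE f₂ e)) M′ ⟩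
        S1 M′ (λ e → 15 * Tm f₁ f₂ e) + S1 M′ (λ e → 24 * (NE f₁ e + NE f₂ e))
          ≡⟨ cong₂ _+_ (S1-* 15 (Tm f₁ f₂) M′) (≡.trans (S1-* 24 (λ e → NE f₁ e + NE f₂ e) M′) (cong (24 *_) (S1-+ (NE f₁) (NE f₂) M′))) ⟩
        15 * a + 24 * (x + y) ∎
      le₂ : ∀ φ → (∀ {e f R} → M′ ↭ e ∷ f ∷ R → ∃ λ S → M ↭ φ ∷ e ∷ f ∷ S) →
        (∀ {e R} → M′ ↭ e ∷ R → t2 e ≡ true → t2 φ ≡ true) → 8 * S2 M′ (ψ φ) ≤ 15 * S2 M′ (Tm φ) + 24 * w
      le₂ φ pp lst = begin
        8 * S2 M′ (ψ φ) ≡⟨ S2-* 8 (ψ φ) M′ ⟨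
        S2 M′ (λ e f → 8 * ψ φ e f) ≤⟨ S2-mono↭ M′ (λ e f R q → single lst (proj₂ (pp q)) (proj₂ (pp q)) (R , q)) ⟩
        S2 M′ (λ e f → 15 * Tm φ e f + 24 * NE e f) ≡⟨ S2-+ (λ e f → 15 * Tm φ e f) (λ e f → 24 * NE e f) M′ ⟩
        S2 M′ (λ e f → 15 * Tm φ e f) + S2 M′ (λ e f → 24 * NE e f) ≡⟨ cong₂ _+_ (S2-* 15 (Tm φ) M′) (S2-* 24 NE M′) ⟩
        15 * S2 M′ (Tm φ) + 24 * w ∎
      p₁ : ∀ {e f R} → M′ ↭ e ∷ f ∷ R → ∃ λ S → M ↭ f₁ ∷ e ∷ f ∷ S
      p₁ {e} {f} {R} q = f₂ ∷ R , trans split (prep f₁ (trans (prep f₂ q) (↭-sym (shift f₂ (e ∷ f ∷ []) R))))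
      p₂ : ∀ {e f R} → M′ ↭ e ∷ f ∷ R → ∃ λ S → M ↭ f₂ ∷ e ∷ f ∷ S
      p₂ {e} {f} {R} q = f₁ ∷ R , trans split (trans (swap f₁ f₂ refl) (prep f₂ (trans (prep f₁ q) (↭-sym (shift f₁ (e ∷ f ∷ []) R)))))
      l₁ : ∀ {e R} → M′ ↭ e ∷ R → t2 e ≡ true → t2 f₁ ≡ true
      l₁ q t = proj₁ (proj₁ (leastOf q t))
      l₂ : ∀ {e R} → M′ ↭ e ∷ R → t2 e ≡ true → t2 f₂ ≡ true
      l₂ q t = proj₁ (proj₂ (leastOf q t))
      le₃ : 8 * S3 M′ ψ ≤ 15 * d
      le₃ = begin
        8 * S3 M′ ψ ≡⟨ S3-* 8 ψ M′ ⟨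
        S3 M′ (λ e f h → 8 * ψ e f h) ≤⟨ S3-mono↭ M′ (λ e f h R q → free q) ⟩
        S3 M′ (λ e f h → 15 * Tm e f h) ≡⟨ S3-* 15 Tm M′ ⟩
        15 * d ∎

-- The global count in the presence of a perfect matching

select-min : ∀ {A : Set} (key : A → ℕ) x xs →
  Σ A λ y → ∃ λ ys → x ∷ xs ↭ y ∷ ys × All (λ e → key y ≤ key e) ys
select-min key x []       = x , [] , refl , []
select-min key x (w ∷ xs) with select-min key w xs
... | y , ys , p , a with ≤-total (key x) (key y)
... | inj₁ le = x , w ∷ xs , refl , All-resp-↭ (↭-sym p) (le ∷ All.map (≤-trans le) a)
... | inj₂ le = y , x ∷ ys , trans (prep x p) (swap x y refl) , le ∷ a

edgeCount : ℕ → (ℕ → ℕ → ℕ → Bool) → ℕ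
edgeCount n g = S3 (range n) (λ a b c → [ g a b c ])

module CaseB {n s : ℕ} {g : ℕ → ℕ → ℕ → Bool} (sh : Shifted n g) (ν : ν≤ g s) where
  open Shifted sh
  open Link {n} {s} {g} sh ν using (H; H-sym; u; z)
  open Blocks sh ν

  hh : List Tri → ℕ
  hh M = S1 M inner + S2 M P

  missing : ℕ
  missing = S3 (range (3 * s + 2)) miss

  module Bounds (M : List Tri) (pf : Perfect M) where
    open Perfect pf

    private
      V = verts M
      W = range (3 * s + 2)

      V-< : All (_< z) V
      V-< = go (All.tail (All.tail (All-resp-↭ (↭-sym permM) (range-< (3 * s + 2))))) (Unique-↭ (↭-sym permM) (range-unique _))
        where
        go : ∀ {V} → All (_< 3 * s + 2) V → Unique (z ∷ 0 ∷ V) → All (_< z) V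
        go a ((_ ∷ zs) ∷ _) = All.zipWith (λ { {x} (lt , ne) → ≤∧≢⇒< (s≤s⁻¹ (subst (x <_) (+-suc (3 * s) 1) lt)) (ne ∘ sym) }) (a , zs)

    -- The remaining vertex can be lowered to 0, and the edge then avoids {1, ..., 3s}: it would
    -- extend `M`.
    two-high : ∀ {a b c} → g a b c ≡ true → z ≤ b → z ≤ c → ⊥
    two-high {a} {b} {c} h zb zc = 1+n≰n (subst (λ t → suc t ≤ s) lenM
      (ν (tri 0 b c ∷ M) (lower a h ∷ edgesM , (0≢ zb ∷ 0≢ zc ∷ zero∉) ∷ (irr₂ h ∷ high zb) ∷ high zc ∷ Unique-++⁻ʳ (z ∷ 0 ∷ []) un)))
      where
      un : Unique (z ∷ 0 ∷ V)
      un = Unique-↭ (↭-sym permM) (range-unique _)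
      zero∉ : All (0 ≢_) V
      zero∉ with un
      ... | _ ∷ a ∷ _ = a
      z>0 : 0 < z
      z>0 = subst (0 <_) (sym (+-suc (3 * s) 0)) z<s
      0≢ : ∀ {x} → z ≤ x → 0 ≢ x
      0≢ le = <⇒≢ (<-≤-trans z>0 le)
      high : ∀ {x} → z ≤ x → All (x ≢_) V
      high le = All.map (λ lt e → <⇒≢ (<-≤-trans lt le) (sym e)) V-<
      lower : ∀ a → g a b c ≡ true → g 0 b c ≡ true
      lower zero    h = h
      lower (suc a) h = down 0 h z<s (0≢ zb) (0≢ zc)

    -- By `two-high` an edge leaving {0, ..., 3s + 1} has just one vertex outside. Each of the `D`
    -- outer vertices has its link inside that of u, the lowest of them.
    gain : ∀ D → n ≡ 3 * s + 2 + D → edgeCount n g + missing ≤ c3 (3 * s + 2) + D * hh M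
    gain D refl = begin
      edgeCount (3 * s + 2 + D) g + missing
        ≡⟨ cong (_+ missing) (≡.trans (cong (λ l → S3 l G) (range-+ (3 * s + 2) D)) (S3-++ G W U)) ⟩
      (S3 W G + (S2 W (λ a b → S1 U (G a b)) + (S1 W (λ a → S2 U (G a)) + S3 U G))) + missing
        ≤⟨ +-monoˡ-≤ missing (+-monoʳ-≤ (S3 W G) (+-mono-≤ links (+-mono-≤ none₁ none₂))) ⟩
      (S3 W G + (D * hh M + 0)) + missing
        ≡⟨ solve 3 (λ a d m → (a :+ (d :+ con 0)) :+ m := (a :+ m) :+ d) refl (S3 W G) (D * hh M) missing ⟩
      (S3 W G + S3 W miss) + D * hh M
        ≡⟨ cong (_+ D * hh M) (≡.trans (sym (S3-+ G miss W)) (≡.trans (S3-cong W one) (≡.trans (S3-one W) (cong c3 (length-range (3 * s + 2)))))) ⟩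
      c3 (3 * s + 2) + D * hh M ∎
      where
      open ≤-Reasoning
      G : ℕ → ℕ → ℕ → ℕ
      G a b c = [ g a b c ]
      U = map ((3 * s + 2) +_) (range D)
      one : ∀ a b c → G a b c + miss a b c ≡ 1
      one a b c with g a b c
      ... | true  = refl
      ... | false = refl
      U-≥ : All (u ≤_) U
      U-≥ = AllP.map⁺ (All.map (λ _ → m≤m+n (3 * s + 2) _) (range-< D))
      z≤u : z ≤ u
      z≤u = +-monoʳ-≤ (3 * s) (n≤1+n 1)
      []≤0 : ∀ {b} → (b ≡ true → ⊥) → [ b ] ≤ 0
      []≤0 h rewrite ≢true⇒≡false h = z≤n
      S2-zero : ∀ {A : Set} (xs : List A) → S2 xs (λ _ _ → 0) ≡ 0
      S2-zero []       = refl
      S2-zero (x ∷ xs) = cong₂ _+_ (S1-zero xs) (S2-zero xs)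
      S3-zero : ∀ {A : Set} (xs : List A) → S3 xs (λ _ _ _ → 0) ≡ 0
      S3-zero []       = refl
      S3-zero (x ∷ xs) = cong₂ _+_ (S2-zero xs) (S3-zero xs)
      none₁ : S1 W (λ a → S2 U (G a)) ≤ 0
      none₁ = ≤-trans (S1-mono {ψ = λ _ → 0} (range-< (3 * s + 2)) (λ {a} _ →
        ≤-trans (S2-mono U-≥ (λ p q → []≤0 (λ h → two-high {a} h (≤-trans z≤u p) (≤-trans z≤u q)))) (≤-reflexive (S2-zero U))))
        (≤-reflexive (S1-zero W))
      none₂ : S3 U G ≤ 0
      none₂ = ≤-trans (S3-mono U-≥ (λ {a} _ p q → []≤0 (λ h → two-high {a} h (≤-trans z≤u p) (≤-trans z≤u q)))) (≤-reflexive (S3-zero U))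
      link : ∀ {a b} → a < u → b < u → S1 U (G a b) ≤ D * Hn a b
      link {a} {b} a<u b<u = ≤-trans (S1-mono {ψ = λ _ → Hn a b} U-≥ below)
        (≤-reflexive (≡.trans (S1-const (Hn a b) U) (cong (_* Hn a b) (≡.trans (length-map _ (range D)) (length-range D)))))
        where
        below : ∀ {v} → u ≤ v → G a b v ≤ Hn a b
        below {v} le with g a b v in e
        ... | false = z≤n
        ... | true with m≤n⇒m<n∨m≡n le
        ... | inj₁ lt = ≤-reflexive (cong [_] (sym (down₃ u e lt (λ q → <⇒≢ a<u (sym q)) (λ q → <⇒≢ b<u (sym q)))))
        ... | inj₂ refl = ≤-reflexive (cong [_] (sym e))
      hh-count : S2 W Hn ≡ hh M
      hh-count = ≡.trans (S2-↭ Hn-sym (↭-sym permM)) (begin-equality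
        (Hn z 0 + S1 V (Hn z)) + (S1 V (Hn 0) + S2 V Hn)
          -- A pair of `H` through z would be an edge with the two high vertices z and u.
          ≡⟨ cong (_+ (S1 V (Hn 0) + S2 V Hn)) (n≤0⇒n≡0 (+-mono-≤ (noz 0)
              (≤-trans (S1-mono {ψ = λ _ → 0} V-< (λ {x} _ → noz x)) (≤-reflexive (S1-zero V))))) ⟩
        S1 V (Hn 0) + S2 V Hn
          ≡⟨ cong₂ _+_ (S1-concatMap vl (Hn 0) M) (S2-concatMap vl Hn M) ⟩
        S1 M (λ e → S1 (vl e) (Hn 0)) + (S1 M (λ e → S2 (vl e) Hn) + S2 M P)
          ≡⟨ +-assoc (S1 M (λ e → S1 (vl e) (Hn 0))) _ _ ⟨
        (S1 M (λ e → S1 (vl e) (Hn 0)) + S1 M (λ e → S2 (vl e) Hn)) + S2 M P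
          ≡⟨ cong (_+ S2 M P) (S1-+ (λ e → S1 (vl e) (Hn 0)) (λ e → S2 (vl e) Hn) M) ⟨
        hh M ∎)
        where
        noz : ∀ x → Hn z x ≤ 0
        noz x = []≤0 (λ h → two-high {x} (H-sym h) ≤-refl z≤u)
      links : S2 W (λ a b → S1 U (G a b)) ≤ D * hh M
      links = ≤-trans (S2-mono (range-< (3 * s + 2)) link)
        (≤-reflexive (≡.trans (S2-* D Hn W) (cong (D *_) hh-count)))

    -- The charged non-edges are distinct. Not charged are the triples through 0, those with z and
    -- two vertices of one block, and the blocks themselves.
    missing-bound : S2 M Qm + S3 M Tm ≤ missing
    missing-bound = begin
      S2 M Qm + S3 M Tm
        ≡⟨ cong (_+ S3 M Tm) (S2-+ (λ e f → Q₁ e f + Q₁ f e) Qz M) ⟩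
      (S2 M (λ e f → Q₁ e f + Q₁ f e) + S2 M Qz) + S3 M Tm
        ≡⟨ cong (λ t → (t + S2 M Qz) + S3 M Tm) (S2-cong M (λ e f → cong (Q₁ e f +_) (sym (Q₁-swap e f)))) ⟩
      (q + S2 M Qz) + S3 M Tm
        ≡⟨ solve 3 (λ a b c → (a :+ b) :+ c := b :+ (a :+ c)) refl q (S2 M Qz) (S3 M Tm) ⟩
      S2 M Qz + (q + S3 M Tm)
        ≤⟨ +-mono-≤ (≤-trans (m≤n+m _ (S1 M (λ e → S2 (vl e) (miss z)))) (≤-reflexive (sym (S2-concatMap vl (miss z) M)))) (S3-concatMap vl miss M) ⟩
      S2 V (miss z) + S3 V miss
        ≤⟨ +-mono-≤ (m≤n+m (S2 V (miss z)) (S1 V (miss z 0))) (m≤n+m (S3 V miss) (S2 V (miss 0))) ⟩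
      S3 (z ∷ 0 ∷ V) miss
        ≡⟨ S3-↭ (miss-sym₁ , miss-sym₂) permM ⟩
      missing ∎
      where
      open ≤-Reasoning
      q = S2 M (λ e f → S1 (vl e) (λ x → S2 (vl f) (miss x)) + S2 (vl e) (λ x y → S1 (vl f) (miss x y)))

  Maximal : List Tri → Set
  Maximal M = ∀ M′ → Perfect M′ → count-t2 M′ ≤ count-t2 M

  -- At most three pairs for each block with 0 and four between two blocks: 3s + 4 C(s, 2) = s (2s +
  -- 1).
  hh-bound : ∀ M (pf : Perfect M) → Maximal M → hh M ≤ s * (2 * s + 1)
  hh-bound M pf mx = begin
    S1 M inner + S2 M P
      ≤⟨ +-mono-≤ (S1-mono↭ M (λ e R p → inner≤3 p)) (S2-mono↭ M (λ e f R p → Two.P≤4 p)) ⟩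
    S1 M (λ _ → 3) + S2 M (λ _ _ → 4 * 1)
      ≡⟨ cong₂ _+_ (S1-const 3 M) (≡.trans (S2-* 4 (λ _ _ → 1) M) (cong (4 *_) (S2-one M))) ⟩
    length M * 3 + 4 * c2 (length M) ≡⟨ cong (λ m → m * 3 + 4 * c2 m) lenM ⟩
    s * 3 + 4 * c2 s ≡⟨ solve 2 (λ s c → s :* con 3 :+ con 4 :* c := con 2 :* (con 2 :* c :+ s) :+ s) refl s (c2 s) ⟩
    2 * (2 * c2 s + s) + s ≡⟨ cong (λ t → 2 * t + s) (2*c2 s) ⟩
    2 * (s * s) + s ≡⟨ solve 1 (λ s → con 2 :* (s :* s) :+ s := s :* (con 2 :* s :+ con 1)) refl s ⟩
    s * (2 * s + 1) ∎
    where
    open ≤-Reasoning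
    open Perfect pf
    open Counting M pf mx

  few : ∀ M → s ∸ 2 ≡ 0 → 8 * (s ∸ 2) * hh M ≤ 15 * missing
  few M q = ≤-trans (≤-reflexive (cong (λ t → 8 * t * hh M) q)) z≤n

  -- `u` exceeds every vertex of a block, so minimal keys select T2 blocks before all others,
  -- ordered by last vertices.
  key : Tri → ℕ
  key e = if t2 e then k e else u

  -- The local estimates are summed over all triples and all pairs of blocks. The term 48 `NE`
  -- borrowed in the sum over triples is returned by the sum over pairs.
  weight-bound : ∀ M (pf : Perfect M) → Maximal M → 8 * (s ∸ 2) * hh M ≤ 15 * missing
  weight-bound []              pf₀ mx₀ = few [] (cong (_∸ 2) (sym (Perfect.lenM pf₀)))
  weight-bound (e ∷ [])        pf₀ mx₀ = few (e ∷ []) (cong (_∸ 2) (sym (Perfect.lenM pf₀)))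
  weight-bound M₀@(e ∷ f ∷ M₁) pf₀ mx₀ with select-min key e (f ∷ M₁)
  ... | f₁ , [] , p , _ with () ← ↭-length p
  ... | f₁ , x ∷ xs , p , a with select-min key x xs
  ... | f₂ , M′ , p′ , b = begin
    8 * (s ∸ 2) * hh M₀ ≡⟨ cong (8 * (s ∸ 2) *_) (cong₂ _+_ (S1-↭ {φ = inner} perm) (S2-↭ P-sym perm)) ⟩
    8 * (s ∸ 2) * hh M ≡⟨ solve 3 (λ c a b → con 8 :* c :* (a :+ b) := con 8 :* (c :* b) :+ con 8 :* (c :* a)) refl (s ∸ 2) (S1 M inner) (S2 M P) ⟩
    8 * ((s ∸ 2) * S2 M P) + 8 * ((s ∸ 2) * S1 M inner)
      -- Pairs between blocks are counted s - 2 times, inner pairs s - 1 times, of which s - 2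
      -- suffice.
      ≤⟨ +-mono-≤ (≤-reflexive (cong (8 *_) (sym (≡.trans (S3-double P M) (cong (λ m → (m ∸ 2) * S2 M P) lenM)))))
           (*-monoʳ-≤ 8 (≤-trans (*-monoˡ-≤ (S1 M inner) (∸-monoʳ-≤ s (n≤1+n 1)))
             (≤-reflexive (sym (≡.trans (S2-double inner M) (cong (λ m → (m ∸ 1) * S1 M inner) lenM)))))) ⟩
    8 * S3 M (λ e f h → P e f + (P e h + P f h)) + 8 * S2 M (λ e f → inner e + inner f)
      ≤⟨ +-monoˡ-≤ _ (Total.triples-bound f₁ f₂ M′ refl least) ⟩
    (15 * S3 M Tm + 48 * S2 M NE) + 8 * S2 M (λ e f → inner e + inner f)
      ≡⟨ solve 3 (λ a b c → (a :+ b) :+ c := a :+ (c :+ b)) refl (15 * S3 M Tm) (48 * S2 M NE) (8 * S2 M (λ e f → inner e + inner f)) ⟩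
    15 * S3 M Tm + (8 * S2 M (λ e f → inner e + inner f) + 48 * S2 M NE)
      ≤⟨ +-monoʳ-≤ (15 * S3 M Tm) pairs ⟩
    15 * S3 M Tm + 15 * S2 M Qm
      ≡⟨ solve 2 (λ a b → con 15 :* a :+ con 15 :* b := con 15 :* (b :+ a)) refl (S3 M Tm) (S2 M Qm) ⟩
    15 * (S2 M Qm + S3 M Tm) ≤⟨ *-monoʳ-≤ 15 (Bounds.missing-bound M pf) ⟩
    15 * missing ∎
    where
    open ≤-Reasoning
    M = f₁ ∷ f₂ ∷ M′
    perm : M₀ ↭ M
    perm = trans p (prep f₁ p′)
    pf : Perfect M
    pf = record
      { edgesM  = All-resp-↭ perm (Perfect.edgesM pf₀)
      ; lenM    = ≡.trans (sym (↭-length perm)) (Perfect.lenM pf₀)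
      ; permM   = trans (prep z (prep 0 (↭-sym (verts-↭ perm)))) (Perfect.permM pf₀)
      ; sortedM = All-resp-↭ perm (Perfect.sortedM pf₀)
      }
    open Perfect pf
    mx : Maximal M
    mx M′ q = subst (count-t2 M′ ≤_) (S1-↭ {φ = [_] ∘ t2} perm) (mx₀ M′ q)
    open Weighing sh ν M pf mx
    k<u : ∀ {e R} → M ↭ e ∷ R → k e < u
    k<u {e} {R} q = Counting.Pos.<u M pf mx (e ∷ []) R q 4 refl
    first : ∀ {φ e R} → M ↭ φ ∷ e ∷ R → key φ ≤ key e → t2 e ≡ true → t2 φ ≡ true × k φ < k e
    first {φ} {e} {R} q le t with t2 φ
    ... | true  = refl , ≤∧≢⇒< (subst (λ b → k φ ≤ (if b then k e else u)) t le) (Counting.Pos.apart M pf mx (φ ∷ e ∷ []) R q 4 7 refl)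
    ... | false = ⊥-elim (<⇒≱ (k<u (trans q (swap φ e refl))) (subst (λ b → u ≤ (if b then k e else u)) t le))
    a′ : All (λ e → key f₁ ≤ key e) M′
    a′ = All.tail (All-resp-↭ p′ a)
    least : All (λ e → t2 e ≡ true → (t2 f₁ ≡ true × k f₁ < k e) × (t2 f₂ ≡ true × k f₂ < k e)) M′
    least = go M′ refl a′ b
      where
      go : ∀ N {N′} → M′ ↭ N′ ++ N → All (λ e → key f₁ ≤ key e) N → All (λ e → key f₂ ≤ key e) N →
        All (λ e → t2 e ≡ true → (t2 f₁ ≡ true × k f₁ < k e) × (t2 f₂ ≡ true × k f₂ < k e)) N
      go []      q []       []       = []
      go (e ∷ N) {N′} q (x ∷ xs) (y ∷ ys) =
        (λ t → first (prep f₁ (trans (prep f₂ q′) (swap f₂ e refl))) x t ,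
               first (trans (swap f₁ f₂ refl) (prep f₂ (trans (prep f₁ q′) (swap f₁ e refl)))) y t)
        ∷ go N {e ∷ N′} (trans q′ refl) xs ys
        where
        q′ : M′ ↭ e ∷ N′ ++ N
        q′ = trans q (shift e N′ N)
    pairs : 8 * S2 M (λ e f → inner e + inner f) + 48 * S2 M NE ≤ 15 * S2 M Qm
    pairs = begin
      8 * S2 M (λ e f → inner e + inner f) + 48 * S2 M NE ≡⟨ cong₂ _+_ (S2-* 8 (λ e f → inner e + inner f) M) (S2-* 48 NE M) ⟨
      S2 M (λ e f → 8 * (inner e + inner f)) + S2 M (λ e f → 48 * NE e f) ≡⟨ S2-+ (λ e f → 8 * (inner e + inner f)) (λ e f → 48 * NE e f) M ⟨
      S2 M (λ e f → 8 * (inner e + inner f) + 48 * NE e f) ≤⟨ S2-mono↭ M (λ e f R q → pair-bound q) ⟩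
      S2 M (λ e f → 15 * Qm e f) ≡⟨ S2-* 15 Qm M ⟩
      15 * S2 M Qm ∎

  -- Perfect matchings need not be enumerated. With the goal refuted, a matching with more T2 blocks
  -- leads to a contradiction by recursion, so the given one is maximal; the recursion ends because
  -- there are at most s blocks.
  reduce-to-maximal : ∀ {Goal : Set} → Dec Goal → (∀ M → Perfect M → Maximal M → Goal) → ∀ M → Perfect M → Goal
  reduce-to-maximal (yes g) _ _ _ = g
  reduce-to-maximal (no ¬goal) h M pf = ⊥-elim (go s M pf (m≤n+m s _))
    where
    count≤s : ∀ M → Perfect M → count-t2 M ≤ s
    count≤s M pf = begin
      count-t2 M ≤⟨ S1-mono {ψ = λ _ → 1} (Perfect.edgesM pf) (λ _ → []≤1 _) ⟩
      S1 M (λ _ → 1) ≡⟨ S1-const 1 M ⟩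
      length M * 1 ≡⟨ *-identityʳ (length M) ⟩
      length M ≡⟨ Perfect.lenM pf ⟩
      s ∎
      where open ≤-Reasoning
    go : ∀ fuel M → Perfect M → s ≤ count-t2 M + fuel → ⊥
    go zero M pf le = ¬goal (h M pf λ M′ pf′ → ≤-trans (count≤s M′ pf′) (≤-trans le (≤-reflexive (+-identityʳ _))))
    go (suc fuel) M pf le = ¬goal (h M pf mx)
      where
      mx : Maximal M
      mx M′ pf′ with count-t2 M′ ≤? count-t2 M
      ... | yes q = q
      ... | no q  = ⊥-elim (go fuel M′ pf′ (≤-trans le (≤-trans (≤-reflexive (+-suc (count-t2 M) fuel)) (+-monoˡ-≤ fuel (≰⇒> q)))))

-- Pushing a matching down onto an initial segment

rank : List ℕ → ℕ → ℕ
rank X x = S1 X (λ y → [ y <ᵇ x ])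

private
  <ᵇ-true : ∀ {m n} → m < n → (m <ᵇ n) ≡ true
  <ᵇ-true {zero}  {suc n} _       = refl
  <ᵇ-true {suc m} {suc n} (s<s p) = <ᵇ-true p

  <ᵇ-irrefl : ∀ n → (n <ᵇ n) ≡ false
  <ᵇ-irrefl zero    = refl
  <ᵇ-irrefl (suc n) = <ᵇ-irrefl n

  <ᵇ-mono : ∀ y {x x′} → x ≤ x′ → [ y <ᵇ x ] ≤ [ y <ᵇ x′ ]
  <ᵇ-mono y {x} {x′} le with y <ᵇ x in e
  ... | false = z≤n
  ... | true  = ≤-reflexive (cong [_] (sym (<ᵇ-true (<-≤-trans (<ᵇ⇒< y x (subst T (sym e) _)) le))))

  <ᵇ-suc : ∀ y x → [ y <ᵇ suc x ] ≡ [ y <ᵇ x ] + [ y ≡ᵇ x ]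
  <ᵇ-suc zero    zero    = refl
  <ᵇ-suc zero    (suc x) = refl
  <ᵇ-suc (suc y) zero    = refl
  <ᵇ-suc (suc y) (suc x) = <ᵇ-suc y x

≢⇒≡ᵇ-false : ∀ {a b} → a ≢ b → (a ≡ᵇ b) ≡ false
≢⇒≡ᵇ-false {a} {b} ne = ≢true⇒≡false λ e → ne (≡ᵇ⇒≡ a b (subst T (sym e) tt))

occurs≤1 : ∀ {X} x → Unique X → S1 X (λ y → [ y ≡ᵇ x ]) ≤ 1
occurs≤1 x [] = z≤n
occurs≤1 {y ∷ X} x (a ∷ un) with y ≟ x
... | no ne rewrite ≢⇒≡ᵇ-false ne = occurs≤1 x un
... | yes refl = +-mono-≤ ([]≤1 (y ≡ᵇ y))
  (≤-trans (S1-mono {ψ = λ _ → 0} a (λ ne → ≤-reflexive (cong [_] (≢⇒≡ᵇ-false (ne ∘ sym))))) (≤-reflexive (S1-zero X)))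

rank≤ : ∀ {X} → Unique X → ∀ x → rank X x ≤ x
rank≤ {X} un zero    = ≤-reflexive (≡.trans (S1-cong X (λ y → refl)) (S1-zero X))
rank≤ {X} un (suc x) = begin
  rank X (suc x) ≡⟨ S1-cong X (λ y → <ᵇ-suc y x) ⟩
  S1 X (λ y → [ y <ᵇ x ] + [ y ≡ᵇ x ]) ≡⟨ S1-+ (λ y → [ y <ᵇ x ]) (λ y → [ y ≡ᵇ x ]) X ⟩
  rank X x + S1 X (λ y → [ y ≡ᵇ x ]) ≤⟨ +-mono-≤ (rank≤ un x) (occurs≤1 x un) ⟩
  x + 1 ≡⟨ +-comm x 1 ⟩
  suc x ∎
  where open ≤-Reasoning

rank-mono : ∀ {X x x′} → x ∈ X → x < x′ → rank X x < rank X x′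
rank-mono {X} {x} {x′} q lt with extract q
... | X′ , p = begin
  suc (rank X x) ≡⟨ cong suc (S1-↭ {φ = λ y → [ y <ᵇ x ]} p) ⟩
  suc ([ x <ᵇ x ] + rank X′ x) ≡⟨ cong (λ t → suc ([ t ] + rank X′ x)) (<ᵇ-irrefl x) ⟩
  suc (rank X′ x) ≤⟨ s≤s (S1-mono (All.universal (λ _ → x) X′) (λ {y} _ → <ᵇ-mono y (<⇒≤ lt))) ⟩
  suc (rank X′ x′) ≡⟨ cong (λ t → [ t ] + rank X′ x′) (<ᵇ-true lt) ⟨
  [ x <ᵇ x′ ] + rank X′ x′ ≡⟨ S1-↭ {φ = λ y → [ y <ᵇ x′ ]} p ⟨
  rank X x′ ∎
  where open ≤-Reasoning

rank<length : ∀ {X x} → x ∈ X → rank X x < length X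
rank<length {X} {x} q with extract q
... | X′ , p = begin
  suc (rank X x) ≡⟨ cong suc (S1-↭ {φ = λ y → [ y <ᵇ x ]} p) ⟩
  suc ([ x <ᵇ x ] + rank X′ x) ≡⟨ cong (λ t → suc ([ t ] + rank X′ x)) (<ᵇ-irrefl x) ⟩
  suc (rank X′ x) ≤⟨ s≤s (S1-mono {ψ = λ _ → 1} (All.universal (λ _ → x) X′) (λ {y} _ → []≤1 (y <ᵇ x))) ⟩
  suc (S1 X′ (λ _ → 1)) ≡⟨ cong suc (≡.trans (S1-const 1 X′) (*-identityʳ (length X′))) ⟩
  suc (length X′) ≡⟨ ↭-length p ⟨
  length X ∎
  where open ≤-Reasoning

rank-unique : ∀ {X} → Unique X → Unique (map (suc ∘ rank X) X)
rank-unique {X} un = go X un (All.tabulate id)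
  where
  ne : ∀ {x y} → x ∈ X → y ∈ X → x ≢ y → suc (rank X x) ≢ suc (rank X y)
  ne {x} {y} p q x≢y e with <-cmp x y
  ... | tri< lt _ _ = <⇒≢ (rank-mono p lt) (suc-injective e)
  ... | tri≈ _ eq _ = x≢y eq
  ... | tri> _ _ gt = <⇒≢ (rank-mono q gt) (sym (suc-injective e))
  fresh : ∀ {x Y} → x ∈ X → All (x ≢_) Y → All (_∈ X) Y → All (suc (rank X x) ≢_) (map (suc ∘ rank X) Y)
  fresh p []       []       = []
  fresh p (a ∷ as) (q ∷ qs) = ne p q a ∷ fresh p as qs
  go : ∀ Y → Unique Y → All (_∈ X) Y → Unique (map (suc ∘ rank X) Y)
  go []      []       []       = []
  go (y ∷ Y) (a ∷ un) (q ∷ qs) = fresh q a qs ∷ go Y un qs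

module PushDown {n s : ℕ} {g : ℕ → ℕ → ℕ → Bool} (sh : Shifted n g) (ν : ν≤ g s) where
  open Shifted sh
  open Link {n} {s} {g} sh ν using (u; z)
  open Blocks sh ν

  sort-all : ∀ N → All (Edge g) N → ∃ λ N′ → All (Edge g) N′ × All Sorted N′ × verts N′ ↭ verts N × length N′ ≡ length N
  sort-all []      []       = [] , [] , [] , refl , refl
  sort-all (e ∷ N) (h ∷ hs) with sort3 h | sort-all N hs
  ... | t , st , et , pt , _ | N′ , es , ss , p , l = t ∷ N′ , et ∷ es , st ∷ ss , ++⁺ pt p , cong suc l

  -- Lowering `a`, then `b`, then `c` never meets another vertex of the edge: a′ ≤ a < b < c, and a′
  -- < b′ ≤ b < c.
  lower : ∀ {a b c a′ b′ c′} → g a b c ≡ true → a < b → b < c → a′ ≤ a → b′ ≤ b → c′ ≤ c → a′ < b′ → b′ < c′ → g a′ b′ c′ ≡ true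
  lower {a} {b} {c} {a′} {b′} {c′} h ab bc la lb lc ab′ bc′ = step₃ (step₂ (step₁ h))
    where
    step₁ : g a b c ≡ true → g a′ b c ≡ true
    step₁ h with m≤n⇒m<n∨m≡n la
    ... | inj₁ lt     = down a′ h lt (<⇒≢ (≤-<-trans la ab)) (<⇒≢ (≤-<-trans la (<-trans ab bc)))
    ... | inj₂ refl = h
    step₂ : g a′ b c ≡ true → g a′ b′ c ≡ true
    step₂ h with m≤n⇒m<n∨m≡n lb
    ... | inj₁ lt     = down₂ b′ h lt (λ e → <⇒≢ ab′ (sym e)) (<⇒≢ (≤-<-trans lb bc))
    ... | inj₂ refl = h
    step₃ : g a′ b′ c ≡ true → g a′ b′ c′ ≡ true
    step₃ h with m≤n⇒m<n∨m≡n lc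
    ... | inj₁ lt     = down₃ c′ h lt (λ e → <⇒≢ (<-trans ab′ bc′) (sym e)) (λ e → <⇒≢ bc′ (sym e))
    ... | inj₂ refl = h

  -- The vertices are renumbered 1, ..., 3s in increasing order. Each of them moves down or stays,
  -- so edges remain edges.
  push-down : ∀ N → All (Edge g) N → Unique (verts N) → All (0 <_) (verts N) → length N ≡ s → ∃ Perfect
  push-down N es un pos len with sort-all N es
  ... | N₁ , es₁ , ss₁ , p₁ , l₁ = map (mapTri φ) N₁ , record
    { edgesM  = proj₁ (lowered N₁ es₁ ss₁ (All.tabulate id))
    ; lenM    = ≡.trans (length-map (mapTri φ) N₁) (≡.trans l₁ len)
    ; permM   = unique-full (subst (λ V → Unique (z ∷ 0 ∷ V)) (sym (verts-map φ N₁)) un₂)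
                  (subst (λ V → All (_< 3 * s + 2) (z ∷ 0 ∷ V)) (sym (verts-map φ N₁)) (z<u ∷ 0<u ∷ All.map (λ lt → <-trans lt z<u) X-<))
                  (≡.trans (cong (λ V → suc (suc (length V))) (verts-map φ N₁)) (≡.trans (cong (2 +_) lenX) (+-comm 2 (3 * s))))
    ; sortedM = proj₂ (lowered N₁ es₁ ss₁ (All.tabulate id))
    }
    where
    X = verts N₁
    unX : Unique X
    unX = Unique-↭ (↭-sym p₁) un
    posX : All (0 <_) X
    posX = All-resp-↭ (↭-sym p₁) pos
    φ : ℕ → ℕ
    φ = suc ∘ rank X
    lenX : length (map φ X) ≡ 3 * s
    lenX = ≡.trans (length-map φ X) (≡.trans (length-verts N₁) (cong (3 *_) (≡.trans l₁ len)))
    z<u : z < 3 * s + 2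
    z<u = ≤-reflexive (sym (+-suc (3 * s) 1))
    0<u : 0 < 3 * s + 2
    0<u = ≤-<-trans z≤n z<u
    X-< : All (_< z) (map φ X)
    X-< = AllP.map⁺ (All.tabulate (λ {x} q → subst (suc (suc (rank X x)) ≤_)
      (≡.trans (cong suc (≡.trans (sym (length-map φ X)) lenX)) (+-comm 1 (3 * s))) (s≤s (rank<length q))))
    un₂ : Unique (z ∷ 0 ∷ map φ X)
    un₂ = ((λ e → <⇒≢ (≤-trans (s≤s z≤n) (≤-reflexive (+-comm 1 (3 * s)))) (sym e)) ∷ All.map (λ lt e → <⇒≢ lt (sym e)) X-<)
      ∷ AllP.map⁺ (All.universal (λ _ ()) X) ∷ rank-unique unX
    -- 0 is not a vertex, so that at most x − 1 vertices lie below x.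
    φ≤ : ∀ {x} → x ∈ X → φ x ≤ x
    φ≤ {x} q = ≤-trans (≤-reflexive (cong (λ t → [ t ] + rank X x) (sym (<ᵇ-true (All.lookup posX q)))))
      (rank≤ {0 ∷ X} (All.map (λ lt → <⇒≢ lt) posX ∷ unX) x)
    lowered : ∀ Y → All (Edge g) Y → All Sorted Y → All (_∈ X) (verts Y) → All (Edge g) (map (mapTri φ) Y) × All Sorted (map (mapTri φ) Y)
    lowered []      []       []               []                 = [] , []
    lowered (e ∷ Y) (h ∷ hs) ((ij , jk) ∷ ss) (qi ∷ qj ∷ qk ∷ qs) with lowered Y hs ss qs
    ... | es , sr = lower h ij jk (φ≤ qi) (φ≤ qj) (φ≤ qk) (s<s (rank-mono qi ij)) (s<s (rank-mono qj jk)) ∷ es ,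
                    (s<s (rank-mono qi ij) , s<s (rank-mono qj jk)) ∷ sr

-- Arithmetic of the two bounds

cliqueBound : ℕ → ℕ
cliqueBound s = c3 (3 * s + 2)

starBound : ℕ → ℕ → ℕ
starBound n s = c3 n ∸ c3 (n ∸ s)

c2-mono : ∀ {m n} → m ≤ n → c2 m ≤ c2 n
c2-mono {zero}  {n}     _       = z≤n
c2-mono {suc m} {suc n} (s≤s p) = +-mono-≤ p (c2-mono p)

c3-mono : ∀ {m n} → m ≤ n → c3 m ≤ c3 n
c3-mono {zero}  {n}     _       = z≤n
c3-mono {suc m} {suc n} (s≤s p) = +-mono-≤ (c2-mono p) (c3-mono p)

6*c3 : ∀ m → 6 * c3 (2 + m) ≡ (2 + m) * (1 + m) * m
6*c3 zero    = refl
6*c3 (suc m) = begin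
  6 * (c2 (2 + m) + c3 (2 + m)) ≡⟨ solve 2 (λ a b → con 6 :* (a :+ b) := con 3 :* (con 2 :* a) :+ con 6 :* b) refl (c2 (2 + m)) (c3 (2 + m)) ⟩
  3 * (2 * c2 (2 + m)) + 6 * c3 (2 + m) ≡⟨ cong₂ (λ a b → 3 * a + b) two (6*c3 m) ⟩
  3 * ((2 + m) * (1 + m)) + (2 + m) * (1 + m) * m
    ≡⟨ solve 1 (λ m → con 3 :* ((con 2 :+ m) :* (con 1 :+ m)) :+ (con 2 :+ m) :* (con 1 :+ m) :* m
        := (con 3 :+ m) :* (con 2 :+ m) :* (con 1 :+ m)) refl m ⟩
  (2 + suc m) * (1 + suc m) * suc m ∎
  where
  open ≡-Reasoning
  two : 2 * c2 (2 + m) ≡ (2 + m) * (1 + m)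
  two = +-cancelʳ-≡ (2 + m) _ _ (≡.trans (2*c2 (2 + m))
    (solve 1 (λ m → (con 2 :+ m) :* (con 2 :+ m) := (con 2 :+ m) :* (con 1 :+ m) :+ (con 2 :+ m)) refl m))

-- Deleting a centre keeps n - s, so the star bound passes through the induction without loss.
starBound-suc : ∀ m t → c2 m + starBound m t ≡ starBound (suc m) (suc t)
starBound-suc m t = sym (+-∸-assoc (c2 m) (c3-mono (m∸n≤m m t)))

-- What remains of the comparison in `star-dominates` at the extreme value e = 15 D + 16 - 8 s,
-- after cancelling a factor 3 s.
Wide : ℕ → ℕ → Set
Wide s D = 8 * (s * s) + 108 * s + 52 ≤ 15 * (D * D) + 15 * (s * D)

wide-above : ∀ s D → 33 ≤ s → 8 * s ≤ 15 * D + 15 → Wide s D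
wide-above s D s≥ le = *-cancelˡ-≤ 15 (begin
  15 * (8 * (s * s) + 108 * s + 52)
    -- With s = t + 33 and 15 D replaced by its lower bound 8 t + 249, this is the exact difference
    -- of the two sides. Starting from 32 its constant term would be negative.
    ≤⟨ m≤m+n _ (64 * (t * t) + 2139 * t + 336) ⟩
  15 * (8 * (s * s) + 108 * s + 52) + (64 * (t * t) + 2139 * t + 336)
    ≡⟨ cong (λ s → 15 * (8 * (s * s) + 108 * s + 52) + (64 * (t * t) + 2139 * t + 336)) s≡ ⟩
  15 * (8 * ((t + 33) * (t + 33)) + 108 * (t + 33) + 52) + (64 * (t * t) + 2139 * t + 336)
    ≡⟨ solve 1 (λ t → con 15 :* (con 8 :* ((t :+ con 33) :* (t :+ con 33)) :+ con 108 :* (t :+ con 33) :+ con 52)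
          :+ (con 64 :* (t :* t) :+ con 2139 :* t :+ con 336)
        := (con 8 :* t :+ con 249) :* ((con 8 :* t :+ con 249) :+ con 15 :* (t :+ con 33))) refl t ⟩
  (8 * t + 249) * ((8 * t + 249) + 15 * (t + 33))
    ≤⟨ *-mono-≤ le′ (+-mono-≤ le′ (≤-reflexive (cong (15 *_) (sym s≡)))) ⟩
  (15 * D) * (15 * D + 15 * s)
    ≡⟨ solve 2 (λ s D → (con 15 :* D) :* (con 15 :* D :+ con 15 :* s) := con 15 :* (con 15 :* (D :* D) :+ con 15 :* (s :* D))) refl s D ⟩
  15 * (15 * (D * D) + 15 * (s * D)) ∎)
  where
  open ≤-Reasoning
  t = s ∸ 33
  s≡ : s ≡ t + 33
  s≡ = sym (m∸n+n≡m s≥)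
  le′ : 8 * t + 249 ≤ 15 * D
  le′ = +-cancelʳ-≤ 15 (8 * t + 249) (15 * D) (begin
    (8 * t + 249) + 15 ≡⟨ solve 1 (λ t → (con 8 :* t :+ con 249) :+ con 15 := con 8 :* (t :+ con 33)) refl t ⟩
    8 * (t + 33) ≡⟨ cong (8 *_) s≡ ⟨
    8 * s ≤⟨ le ⟩
    15 * D + 15 ∎)

-- The left side is largest at s = 32, with value 11700. The lower bounds D ≥ 82 - 2 s and D + s ≥
-- 82 - s are smallest there, 18 and 50, and 15 · 18 · 50 = 13500.
wide-small : ∀ s D → s ≤ 32 → 82 ≤ D + 2 * s → Wide s D
wide-small s D s≤ le = begin
  8 * (s * s) + 108 * s + 52 ≤⟨ +-monoˡ-≤ 52 (+-mono-≤ (*-monoʳ-≤ 8 (*-mono-≤ s≤ s≤)) (*-monoʳ-≤ 108 s≤)) ⟩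
  11700 ≤⟨ ≤ᵇ⇒≤ 11700 13500 _ ⟩
  15 * (18 * 50) ≤⟨ *-monoʳ-≤ 15 (*-mono-≤ D≥ Ds≥) ⟩
  15 * (D * (D + s)) ≡⟨ solve 2 (λ s D → con 15 :* (D :* (D :+ s)) := con 15 :* (D :* D) :+ con 15 :* (s :* D)) refl s D ⟩
  15 * (D * D) + 15 * (s * D) ∎
  where
  open ≤-Reasoning
  D≥ : 18 ≤ D
  D≥ = +-cancelʳ-≤ 64 18 D (≤-trans le (+-monoʳ-≤ D (*-monoʳ-≤ 2 s≤)))
  Ds≥ : 50 ≤ D + s
  Ds≥ = +-cancelʳ-≤ 32 50 (D + s) (≤-trans le (≤-trans (≤-reflexive (solve 2 (λ s D → D :+ con 2 :* s := (D :+ s) :+ s) refl s D)) (+-monoʳ-≤ (D + s) s≤)))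

-- `e` stands for 15 D - 8 (s - 2), the net weight of a pair of `H` in the edge count, and s (2s +
-- 1) bounds the number of these pairs.
star-dominates : ∀ s D e → Wide s D → e + 8 * s ≤ 15 * D + 16 →
  15 * cliqueBound s + e * (s * (2 * s + 1)) ≤ 15 * starBound (3 * s + 2 + D) s
star-dominates s D e wide le = begin
  15 * cliqueBound s + e * (s * (2 * s + 1))
    ≤⟨ m+n≤o⇒m≤o∸n _ ineq ⟩
  15 * c3 n ∸ 15 * c3 (n ∸ s) ≡⟨ *-distribˡ-∸ 15 (c3 n) (c3 (n ∸ s)) ⟨
  15 * starBound n s ∎
  where
  open ≤-Reasoning
  n = 3 * s + 2 + D
  X = λ m → (2 + m) * (1 + m) * m
  cA : 6 * cliqueBound s ≡ X (3 * s)
  cA = ≡.trans (cong (λ m → 6 * c3 m) (+-comm (3 * s) 2)) (6*c3 (3 * s))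
  cn : 6 * c3 n ≡ X (3 * s + D)
  cn = ≡.trans (cong (λ m → 6 * c3 m) (solve 2 (λ s D → con 3 :* s :+ con 2 :+ D := con 2 :+ (con 3 :* s :+ D)) refl s D)) (6*c3 (3 * s + D))
  cns : 6 * c3 (n ∸ s) ≡ X (2 * s + D)
  cns = ≡.trans (cong (λ m → 6 * c3 m) (≡.trans
    (cong (_∸ s) (solve 2 (λ s D → con 3 :* s :+ con 2 :+ D := (con 2 :+ (con 2 :* s :+ D)) :+ s) refl s D))
    (m+n∸n≡m (2 + (2 * s + D)) s))) (6*c3 (2 * s + D))
  -- The first summand completes `e` to e + 8 s, so that the bound on `e` enters without
  -- subtraction; the second is 3 s times the left side of `Wide`.
  slack = 48 * (s * (s * (2 * s + 1))) + 3 * (s * (8 * (s * s) + 108 * s + 52))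
  ineq : (15 * cliqueBound s + e * (s * (2 * s + 1))) + 15 * c3 (n ∸ s) ≤ 15 * c3 n
  ineq = *-cancelˡ-≤ 6 (+-cancelʳ-≤ slack _ _ (begin
    6 * ((15 * cliqueBound s + e * (s * (2 * s + 1))) + 15 * c3 (n ∸ s)) + slack
      ≡⟨ solve 5 (λ a e q c l → con 6 :* ((con 15 :* a :+ e :* q) :+ con 15 :* c) :+ l
          := (con 15 :* (con 6 :* a) :+ con 15 :* (con 6 :* c)) :+ (con 6 :* (e :* q) :+ l)) refl
          (cliqueBound s) e (s * (2 * s + 1)) (c3 (n ∸ s)) slack ⟩
    (15 * (6 * cliqueBound s) + 15 * (6 * c3 (n ∸ s))) + (6 * (e * (s * (2 * s + 1))) + slack)
      ≡⟨ cong₂ (λ a c → (15 * a + 15 * c) + (6 * (e * (s * (2 * s + 1))) + slack)) cA cns ⟩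
    (15 * X (3 * s) + 15 * X (2 * s + D)) + (6 * (e * (s * (2 * s + 1))) + slack)
      ≡⟨ cong ((15 * X (3 * s) + 15 * X (2 * s + D)) +_)
          (solve 3 (λ s e w → con 6 :* (e :* (s :* (con 2 :* s :+ con 1))) :+ (con 48 :* (s :* (s :* (con 2 :* s :+ con 1))) :+ con 3 :* (s :* w))
            := con 6 :* ((e :+ con 8 :* s) :* (s :* (con 2 :* s :+ con 1))) :+ con 3 :* (s :* w)) refl s e (8 * (s * s) + 108 * s + 52)) ⟩
    (15 * X (3 * s) + 15 * X (2 * s + D)) + (6 * ((e + 8 * s) * (s * (2 * s + 1))) + 3 * (s * (8 * (s * s) + 108 * s + 52)))
      ≤⟨ +-monoʳ-≤ (15 * X (3 * s) + 15 * X (2 * s + D)) (+-mono-≤ (*-monoʳ-≤ 6 (*-monoˡ-≤ (s * (2 * s + 1)) le)) (*-monoʳ-≤ 3 (*-monoʳ-≤ s wide))) ⟩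
    (15 * X (3 * s) + 15 * X (2 * s + D)) + (6 * ((15 * D + 16) * (s * (2 * s + 1))) + 3 * (s * (15 * (D * D) + 15 * (s * D))))
      ≡⟨ solve 2 (λ s D →
          (con 15 :* ((con 2 :+ con 3 :* s) :* (con 1 :+ con 3 :* s) :* (con 3 :* s))
            :+ con 15 :* ((con 2 :+ (con 2 :* s :+ D)) :* (con 1 :+ (con 2 :* s :+ D)) :* (con 2 :* s :+ D)))
            :+ (con 6 :* ((con 15 :* D :+ con 16) :* (s :* (con 2 :* s :+ con 1))) :+ con 3 :* (s :* (con 15 :* (D :* D) :+ con 15 :* (s :* D))))
          := con 15 :* ((con 2 :+ (con 3 :* s :+ D)) :* (con 1 :+ (con 3 :* s :+ D)) :* (con 3 :* s :+ D))
            :+ (con 48 :* (s :* (s :* (con 2 :* s :+ con 1))) :+ con 3 :* (s :* (con 8 :* (s :* s) :+ con 108 :* s :+ con 52)))) refl s D ⟩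
    15 * X (3 * s + D) + slack ≡⟨ cong (λ t → 15 * t + slack) cn ⟨
    15 * (6 * c3 n) + slack ≡⟨ solve 2 (λ a l → con 15 :* (con 6 :* a) :+ l := con 6 :* (con 15 :* a) :+ l) refl (c3 n) slack ⟩
    6 * (15 * c3 n) + slack ∎))

clique≤star : ∀ s D → Wide s D → 8 * s ≤ 15 * D + 16 → cliqueBound s ≤ starBound (3 * s + 2 + D) s
clique≤star s D wide le = *-cancelˡ-≤ 15 (≤-trans (≤-reflexive (sym (+-identityʳ _))) (star-dominates s D 0 wide le))

-- Three new vertices give the clique C(3t + 4, 2) + C(3t + 3, 2) + C(3t + 2, 2) further triples,
-- more than the at most C(4t + 3, 2) edges through a deleted vertex.
c2-clique : ∀ t D → D ≤ t → c2 (3 * suc t + D) + cliqueBound t ≤ cliqueBound (suc t)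
c2-clique t D D≤t = begin
  c2 (3 * suc t + D) + c3 (3 * t + 2) ≤⟨ +-monoˡ-≤ (c3 (3 * t + 2)) (≤-trans (c2-mono (≤-trans (+-monoʳ-≤ (3 * suc t) D≤t)
       (≤-reflexive (solve 1 (λ t → con 3 :* (con 1 :+ t) :+ t := con 3 :+ con 4 :* t) refl t)))) three) ⟩
  (c2 (4 + 3 * t) + (c2 (3 + 3 * t) + c2 (2 + 3 * t))) + c3 (3 * t + 2) ≡⟨ cong (λ m → (c2 (4 + 3 * t) + (c2 (3 + 3 * t) + c2 (2 + 3 * t))) + c3 m) (+-comm (3 * t) 2) ⟩
  (c2 (4 + 3 * t) + (c2 (3 + 3 * t) + c2 (2 + 3 * t))) + c3 (2 + 3 * t)
    ≡⟨ solve 4 (λ a b c d → (a :+ (b :+ c)) :+ d := a :+ (b :+ (c :+ d))) refl (c2 (4 + 3 * t)) (c2 (3 + 3 * t)) (c2 (2 + 3 * t)) (c3 (2 + 3 * t)) ⟩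
  c3 (5 + 3 * t) ≡⟨ cong c3 (solve 1 (λ t → con 5 :+ con 3 :* t := con 3 :* (con 1 :+ t) :+ con 2) refl t) ⟩
  c3 (3 * suc t + 2) ∎
  where
  open ≤-Reasoning
  twice : ∀ m → 2 * c2 (1 + m) ≡ (1 + m) * m
  twice m = +-cancelʳ-≡ (1 + m) _ _ (≡.trans (2*c2 (1 + m)) (solve 1 (λ m → (con 1 :+ m) :* (con 1 :+ m) := (con 1 :+ m) :* m :+ (con 1 :+ m)) refl m))
  three : c2 (3 + 4 * t) ≤ c2 (4 + 3 * t) + (c2 (3 + 3 * t) + c2 (2 + 3 * t))
  three = *-cancelˡ-≤ 2 (begin
    2 * c2 (3 + 4 * t) ≡⟨ twice (2 + 4 * t) ⟩
    (3 + 4 * t) * (2 + 4 * t) ≤⟨ m≤m+n _ (11 * (t * t) + 25 * t + 14) ⟩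
    (3 + 4 * t) * (2 + 4 * t) + (11 * (t * t) + 25 * t + 14)
      ≡⟨ solve 1 (λ t → (con 3 :+ con 4 :* t) :* (con 2 :+ con 4 :* t) :+ (con 11 :* (t :* t) :+ con 25 :* t :+ con 14)
          := (con 4 :+ con 3 :* t) :* (con 3 :+ con 3 :* t) :+ ((con 3 :+ con 3 :* t) :* (con 2 :+ con 3 :* t) :+ (con 2 :+ con 3 :* t) :* (con 1 :+ con 3 :* t))) refl t ⟩
    (4 + 3 * t) * (3 + 3 * t) + ((3 + 3 * t) * (2 + 3 * t) + (2 + 3 * t) * (1 + 3 * t))
      ≡⟨ cong₂ _+_ (twice (3 + 3 * t)) (cong₂ _+_ (twice (2 + 3 * t)) (twice (1 + 3 * t))) ⟨
    2 * c2 (4 + 3 * t) + (2 * c2 (3 + 3 * t) + 2 * c2 (2 + 3 * t))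
      ≡⟨ solve 3 (λ a b c → con 2 :* a :+ (con 2 :* b :+ con 2 :* c) := con 2 :* (a :+ (b :+ c))) refl (c2 (4 + 3 * t)) (c2 (3 + 3 * t)) (c2 (2 + 3 * t)) ⟩
    2 * (c2 (4 + 3 * t) + (c2 (3 + 3 * t) + c2 (2 + 3 * t))) ∎)

-- Deletion of the vertex 0

edgeCount-mono : ∀ {m n} g → m ≤ n → edgeCount m g ≤ edgeCount n g
edgeCount-mono {m} {n} g le = begin
  edgeCount m g ≤⟨ m≤m+n _ _ ⟩
  edgeCount m g + _ ≡⟨ S3-++ (λ a b c → [ g a b c ]) (range m) (map (m +_) (range (n ∸ m))) ⟨
  S3 (range m ++ map (m +_) (range (n ∸ m))) (λ a b c → [ g a b c ]) ≡⟨ cong (λ l → S3 l (λ a b c → [ g a b c ])) (range-+ m (n ∸ m)) ⟨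
  edgeCount (m + (n ∸ m)) g ≡⟨ cong (λ t → edgeCount t g) (m+[n∸m]≡n le) ⟩
  edgeCount n g ∎
  where open ≤-Reasoning

widen : ∀ {m n g} → m ≤ n → Shifted m g → Shifted n g
widen le sh = record
  { sym₁ = sym₁ ; sym₂ = sym₂ ; supp = λ h → <-≤-trans (supp h) le ; irr = irr ; down = down }
  where open Shifted sh

delete₀ : (ℕ → ℕ → ℕ → Bool) → ℕ → ℕ → ℕ → Bool
delete₀ g a b c = g (suc a) (suc b) (suc c)

delete₀-shifted : ∀ {m g} → Shifted (suc m) g → Shifted m (delete₀ g)
delete₀-shifted sh = record
  { sym₁ = λ a b c → sym₁ (suc a) (suc b) (suc c)
  ; sym₂ = λ a b c → sym₂ (suc a) (suc b) (suc c)
  ; supp = λ h → s<s⁻¹ (supp h)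
  ; irr  = λ h e → irr h (cong suc e)
  ; down = λ a′ h lt p q → down (suc a′) h (s<s lt) (p ∘ suc-injective) (q ∘ suc-injective)
  }
  where open Shifted sh

delete₀-count : ∀ m g → edgeCount (suc m) g ≤ c2 m + edgeCount m (delete₀ g)
delete₀-count m g = +-mono-≤
  (begin
    S2 (map suc (range m)) (λ b c → [ g 0 b c ]) ≤⟨ S2-mono (All.universal (λ _ → z≤n {0}) (map suc (range m))) (λ _ _ → []≤1 _) ⟩
    S2 (map suc (range m)) (λ _ _ → 1) ≡⟨ S2-one (map suc (range m)) ⟩
    c2 (length (map suc (range m))) ≡⟨ cong c2 (≡.trans (length-map suc (range m)) (length-range m)) ⟩
    c2 m ∎)
  (≤-reflexive (S3-map suc (λ a b c → [ g a b c ]) (range m)))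
  where open ≤-Reasoning

-- The dichotomy is used through a contradiction instead of being decided: with the goal refuted, a
-- matching of t + 1 edges avoiding 0, cut to that size and pushed down, would reach the goal by
-- `caseB`. Hence the family without 0 has matching number at most t.
avoid₀ : ∀ {n t g} {Goal : Set} → Dec Goal → (sh : Shifted n g) (ν : ν≤ g (suc t)) →
  (∀ M → Blocks.Perfect sh ν M → CaseB.Maximal sh ν M → Goal) → (ν≤ (delete₀ g) t → Goal) → Goal
avoid₀ {n} {t} {g} dec sh ν caseB caseA with dec
... | yes goal = goal
... | no ¬goal = caseA λ N m → ≮⇒≥ λ lt → ¬goal (extend N m lt)
  where
  extend : ∀ N → Matching (delete₀ g) N → t < length N → _
  extend N (es , un) lt with PushDown.push-down sh ν (map (mapTri suc) (take (suc t) N))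
    (AllP.map⁺ (AllP.take⁺ (suc t) es))
    (subst Unique (sym (verts-map suc (take (suc t) N))) (UniqueP.map⁺ suc-injective (take-unique N un (suc t))))
    (subst (All (0 <_)) (sym (verts-map suc (take (suc t) N))) (AllP.map⁺ (All.universal (λ _ → z<s) (verts (take (suc t) N)))))
    (≡.trans (length-map (mapTri suc) (take (suc t) N)) (≡.trans (length-take (suc t) N) (m≤n⇒m⊓n≡m lt)))
    where
    verts-take : ∀ N k → ∃ λ L → verts N ≡ verts (take k N) ++ L
    verts-take N       zero    = verts N , refl
    verts-take []      (suc k) = [] , refl
    verts-take (e ∷ N) (suc k) with verts-take N k
    ... | L , eq = L , cong (λ l → i e ∷ j e ∷ k′ ∷ l) eq
      where k′ = Tri.k e
    take-unique : ∀ N → Unique (verts N) → ∀ k → Unique (verts (take k N))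
    take-unique N un k with verts-take N k
    ... | L , eq = Unique-++⁻ˡ (verts (take k N)) (subst Unique eq un)
  ... | M , pf = CaseB.reduce-to-maximal sh ν dec caseB M pf

-- Edge bounds from a perfect matching

module CaseB-bounds {s D g} (sh : Shifted (3 * s + 2 + D) g) (ν : ν≤ g s)
  (M : List Tri) (pf : Blocks.Perfect sh ν M) (mx : CaseB.Maximal sh ν M) where
  open CaseB sh ν
  private
    n = 3 * s + 2 + D
    h = hh M
    K = 8 * (s ∸ 2)

    open ≤-Reasoning

    weighed : 15 * edgeCount n g + K * h ≤ 15 * cliqueBound s + (15 * D) * h
    weighed = begin
      15 * edgeCount n g + K * h ≤⟨ +-monoʳ-≤ (15 * edgeCount n g) (weight-bound M pf mx) ⟩
      15 * edgeCount n g + 15 * missing ≡⟨ *-distribˡ-+ 15 (edgeCount n g) missing ⟨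
      15 * (edgeCount n g + missing) ≤⟨ *-monoʳ-≤ 15 (Bounds.gain M pf D refl) ⟩
      15 * (cliqueBound s + D * h) ≡⟨ solve 3 (λ a d h → con 15 :* (a :+ d :* h) := con 15 :* a :+ (con 15 :* d) :* h) refl (cliqueBound s) D h ⟩
      15 * cliqueBound s + (15 * D) * h ∎

  narrow-bound : 15 * D ≤ K → edgeCount n g ≤ cliqueBound s
  narrow-bound le = *-cancelˡ-≤ 15 (+-cancelʳ-≤ (K * h) _ _ (≤-trans weighed (+-monoʳ-≤ (15 * cliqueBound s) (*-monoˡ-≤ h le))))

  wide-bound : K ≤ 15 * D → Wide s D → edgeCount n g ≤ starBound n s
  wide-bound le wide = *-cancelˡ-≤ 15 (begin
    15 * edgeCount n g ≤⟨ +-cancelʳ-≤ (K * h) _ _ (≤-trans weighed (≤-reflexive (≡.trans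
        (cong (λ t → 15 * cliqueBound s + t * h) (sym (m∸n+n≡m le)))
        (solve 4 (λ a e k h → a :+ (e :+ k) :* h := (a :+ e :* h) :+ k :* h) refl (15 * cliqueBound s) e K h)))) ⟩
    15 * cliqueBound s + e * h ≤⟨ +-monoʳ-≤ (15 * cliqueBound s) (*-monoʳ-≤ e (hh-bound M pf mx)) ⟩
    15 * cliqueBound s + e * (s * (2 * s + 1)) ≤⟨ star-dominates s D e wide excess ⟩
    15 * starBound n s ∎)
    where
    e = 15 * D ∸ K
    -- An inequality because s - 2 is truncated for s < 2.
    s≤ : ∀ s → 8 * s ≤ 8 * (s ∸ 2) + 16
    s≤ zero          = z≤n
    s≤ (suc zero)    = ≤ᵇ⇒≤ 8 16 _
    s≤ (suc (suc s)) = ≤-reflexive (solve 1 (λ s → con 8 :* (con 2 :+ s) := con 8 :* s :+ con 16) refl s)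
    excess : e + 8 * s ≤ 15 * D + 16
    excess = begin
      e + 8 * s ≤⟨ +-monoʳ-≤ e (s≤ s) ⟩
      e + (K + 16) ≡⟨ +-assoc e K 16 ⟨
      (e + K) + 16 ≡⟨ cong (_+ 16) (m∸n+n≡m le) ⟩
      15 * D + 16 ∎

no-edges : ∀ {n g} → ν≤ g 0 → Shifted n g → edgeCount n g ≡ 0
no-edges {n} {g} ν sh = n≤0⇒n≡0 (≤-trans (S3-mono {ψ = λ _ _ _ → 0} (range-< n) (λ {a} {b} {c} _ _ _ → ≤-reflexive (cong [_] (none a b c))))
  (≤-reflexive (≡.trans (S3-* 0 (λ _ _ _ → 0) (range n)) refl)))
  where
  open Shifted sh
  none : ∀ a b c → g a b c ≡ false
  none a b c = ≢true⇒≡false λ h → contradiction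
    (ν (tri a b c ∷ []) (h ∷ [] , (irr h ∷ irr₃ h ∷ []) ∷ (irr₂ h ∷ []) ∷ [] ∷ [])) λ ()

-- The induction on s

few-disjoint : ∀ s → s ≤ 32 → ∀ n g → Shifted n g → ν≤ g s → s + 84 ≤ n → edgeCount n g ≤ starBound n s
few-disjoint zero    _  n g sh ν le = ≤-trans (≤-reflexive (no-edges ν sh)) z≤n
few-disjoint (suc t) s≤ (suc m) g sh ν le = avoid₀ (edgeCount (suc m) g ≤? starBound (suc m) (suc t)) sh ν caseB caseA
  where
  s = suc t
  -- The excess n - 3s - 2, written so that D + 2 s ≥ 82 can be read off; 82 is 84 - 2.
  D = 82 ∸ 2 * s + (suc m ∸ (s + 84))
  2s≤82 : 2 * s ≤ 82
  2s≤82 = ≤-trans (*-monoʳ-≤ 2 s≤) (≤ᵇ⇒≤ 64 82 _)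
  n≡ : suc m ≡ 3 * s + 2 + D
  n≡ = begin
    suc m ≡⟨ m+[n∸m]≡n le ⟨
    (s + 84) + r ≡⟨ cong (_+ r) (begin
      s + 84 ≡⟨ +-assoc s 2 82 ⟨
      (s + 2) + 82 ≡⟨ cong ((s + 2) +_) (m+[n∸m]≡n 2s≤82) ⟨
      (s + 2) + (2 * s + (82 ∸ 2 * s)) ≡⟨ solve 2 (λ s q → (s :+ con 2) :+ (con 2 :* s :+ q) := (con 3 :* s :+ con 2) :+ q) refl s (82 ∸ 2 * s) ⟩
      (3 * s + 2) + (82 ∸ 2 * s) ∎) ⟩
    ((3 * s + 2) + (82 ∸ 2 * s)) + r ≡⟨ +-assoc (3 * s + 2) (82 ∸ 2 * s) r ⟩
    3 * s + 2 + D ∎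
    where
    open ≡-Reasoning
    r = suc m ∸ (s + 84)
  D≥ : 82 ≤ D + 2 * s
  D≥ = ≤-trans (≤-reflexive (sym (m∸n+n≡m 2s≤82))) (+-monoˡ-≤ (2 * s) (m≤m+n (82 ∸ 2 * s) _))
  K≤ : 8 * (s ∸ 2) ≤ 15 * D
  K≤ = begin
    8 * (s ∸ 2) ≤⟨ *-monoʳ-≤ 8 (∸-monoˡ-≤ 2 s≤) ⟩
    240 ≤⟨ ≤ᵇ⇒≤ 240 270 _ ⟩
    15 * 18 ≤⟨ *-monoʳ-≤ 15 (+-cancelʳ-≤ 64 18 D (≤-trans D≥ (+-monoʳ-≤ D (*-monoʳ-≤ 2 s≤)))) ⟩
    15 * D ∎
    where open ≤-Reasoning
  caseB : ∀ M → Blocks.Perfect sh ν M → CaseB.Maximal sh ν M → edgeCount (suc m) g ≤ starBound (suc m) s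
  caseB M pf mx = go n≡ sh M pf mx
    where
    go : ∀ {n} → n ≡ 3 * s + 2 + D → (sh : Shifted n g) → ∀ M → Blocks.Perfect sh ν M → CaseB.Maximal sh ν M → edgeCount n g ≤ starBound n s
    go refl sh M pf mx = CaseB-bounds.wide-bound {s} {D} sh ν M pf mx K≤ (wide-small s D s≤ D≥)
  caseA : ν≤ (delete₀ g) t → edgeCount (suc m) g ≤ starBound (suc m) s
  caseA ν′ = begin
    edgeCount (suc m) g ≤⟨ delete₀-count m g ⟩
    c2 m + edgeCount m (delete₀ g) ≤⟨ +-monoʳ-≤ (c2 m) (few-disjoint t (≤-trans (n≤1+n t) s≤) m (delete₀ g) (delete₀-shifted sh) ν′ (s≤s⁻¹ le)) ⟩
    c2 m + starBound m t ≡⟨ starBound-suc m t ⟩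
    starBound (suc m) s ∎
    where open ≤-Reasoning

module Many {s D g} (sh : Shifted (3 * s + 2 + D) g) (ν : ν≤ g s) where
  caseB-bound : 33 ≤ s → ∀ M → Blocks.Perfect sh ν M → CaseB.Maximal sh ν M →
    edgeCount (3 * s + 2 + D) g ≤ cliqueBound s ⊔ starBound (3 * s + 2 + D) s
  caseB-bound s≥ M pf mx with 15 * D ≤? 8 * (s ∸ 2)
  ... | yes le = ≤-trans (CaseB-bounds.narrow-bound {s} {D} sh ν M pf mx le) (m≤m⊔n (cliqueBound s) (starBound (3 * s + 2 + D) s))
  ... | no ≰   = ≤-trans (CaseB-bounds.wide-bound {s} {D} sh ν M pf mx (<⇒≤ (≰⇒> ≰)) (wide-above s D s≥ (≤-trans (≤-reflexive 8s≡) (+-monoˡ-≤ 15 (≰⇒> ≰)))))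
    (m≤n⊔m (cliqueBound s) (starBound (3 * s + 2 + D) s))
    where
    -- The strict inequality 8 (s - 2) < 15 D absorbs one of the 16, which leaves 8 s ≤ 15 D + 15.
    8s≡ : 8 * s ≡ suc (8 * (s ∸ 2)) + 15
    8s≡ = ≡.trans (cong (8 *_) (sym (m∸n+n≡m (≤-trans (≤ᵇ⇒≤ 2 33 _) s≥))))
      (≡.trans (*-distribˡ-+ 8 (s ∸ 2) 2) (+-suc (8 * (s ∸ 2)) 15))

Large : ℕ → Set
Large s = ∀ n g → Shifted n g → ν≤ g s → 3 * s + 3 ≤ n → edgeCount n g ≤ cliqueBound s ⊔ starBound n s

decompose : ∀ s n → 3 * s + 3 ≤ n → ∃ λ D → n ≡ 3 * s + 2 + D × 1 ≤ D
decompose s n le = suc (n ∸ (3 * s + 3)) , ≡.trans (sym (m+[n∸m]≡n le))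
  (≡.trans (cong (_+ (n ∸ (3 * s + 3))) (+-suc (3 * s) 2)) (sym (+-suc (3 * s + 2) _))) , s≤s z≤n

-- The two bounds on `t` force s = 33. Deleting 0 leads to s = 32, where `few-disjoint` applies.
first-large : ∀ t → t ≤ 32 → 33 ≤ suc t → ∀ n g → Shifted n g → ν≤ g (suc t) → suc t + 84 ≤ n →
  edgeCount n g ≤ cliqueBound (suc t) ⊔ starBound n (suc t)
first-large t t≤ s≥ (suc m) g sh ν le with decompose (suc t) (suc m) (≤-trans 3s≤ le)
  where
  3s≤ : 3 * suc t + 3 ≤ suc t + 84
  3s≤ = begin
    3 * suc t + 3 ≡⟨ solve 1 (λ t → con 3 :* (con 1 :+ t) :+ con 3 := (con 1 :+ t) :+ (con 2 :* t :+ con 5)) refl t ⟩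
    suc t + (2 * t + 5) ≤⟨ +-monoʳ-≤ (suc t) (≤-trans (+-monoˡ-≤ 5 (*-monoʳ-≤ 2 t≤)) (≤ᵇ⇒≤ 69 84 _)) ⟩
    suc t + 84 ∎
    where open ≤-Reasoning
... | D , n≡ , _ = avoid₀ (edgeCount (suc m) g ≤? cliqueBound (suc t) ⊔ starBound (suc m) (suc t)) sh ν (caseB n≡ sh) caseA
  where
  caseB : ∀ {n} → n ≡ 3 * suc t + 2 + D → (sh : Shifted n g) → ∀ M → Blocks.Perfect sh ν M → CaseB.Maximal sh ν M →
    edgeCount n g ≤ cliqueBound (suc t) ⊔ starBound n (suc t)
  caseB refl sh = Many.caseB-bound {suc t} {D} sh ν s≥
  caseA : ν≤ (delete₀ g) t → edgeCount (suc m) g ≤ cliqueBound (suc t) ⊔ starBound (suc m) (suc t)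
  caseA ν′ = begin
    edgeCount (suc m) g ≤⟨ delete₀-count m g ⟩
    c2 m + edgeCount m (delete₀ g) ≤⟨ +-monoʳ-≤ (c2 m) (few-disjoint t t≤ m (delete₀ g) (delete₀-shifted sh) ν′ (s≤s⁻¹ le)) ⟩
    c2 m + starBound m t ≡⟨ starBound-suc m t ⟩
    starBound (suc m) (suc t) ≤⟨ m≤n⊔m (cliqueBound (suc t)) (starBound (suc m) (suc t)) ⟩
    cliqueBound (suc t) ⊔ starBound (suc m) (suc t) ∎
    where open ≤-Reasoning

-- 164846 ≤ 166650. At n = 118 the star bound is already 168146, so 84 = 117 - 33 is the largest
-- offset for which this comparison holds.
star≤clique-33 : ∀ s → 33 ≡ s → starBound (s + 84) s ≤ cliqueBound s
star≤clique-33 s refl = ≤ᵇ⇒≤ (starBound 117 33) (cliqueBound 33) _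

large : ∀ s → 33 ≤ s → Large s
large (suc t) s≥ n g sh ν le with m≤n⇒m<n∨m≡n s≥
... | inj₂ 33≡ with ≤-total (suc t + 84) n
...   | inj₁ wide   = first-large t (≤-reflexive (suc-injective (sym 33≡))) s≥ n g sh ν wide
...   | inj₂ narrow = begin
  edgeCount n g ≤⟨ edgeCount-mono g narrow ⟩
  edgeCount (suc t + 84) g ≤⟨ first-large t (≤-reflexive (suc-injective (sym 33≡))) s≥ (suc t + 84) g (widen narrow sh) ν ≤-refl ⟩
  cliqueBound (suc t) ⊔ starBound (suc t + 84) (suc t) ≡⟨ m≥n⇒m⊔n≡m (star≤clique-33 (suc t) 33≡) ⟩
  cliqueBound (suc t) ≤⟨ m≤m⊔n (cliqueBound (suc t)) (starBound n (suc t)) ⟩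
  cliqueBound (suc t) ⊔ starBound n (suc t) ∎
  where open ≤-Reasoning
large (suc t) s≥ n g sh ν le | inj₁ (s≤s t≥) = step n sh le
  where
  s = suc t
  step : ∀ n → Shifted n g → 3 * s + 3 ≤ n → edgeCount n g ≤ cliqueBound s ⊔ starBound n s
  step (suc m) sh le with decompose s (suc m) le
  ... | D , n≡ , _ = avoid₀ (edgeCount (suc m) g ≤? cliqueBound s ⊔ starBound (suc m) s) sh ν (caseB n≡ sh) caseA
    where
    open ≤-Reasoning
    caseB : ∀ {n} → n ≡ 3 * s + 2 + D → (sh : Shifted n g) → ∀ M → Blocks.Perfect sh ν M → CaseB.Maximal sh ν M →
      edgeCount n g ≤ cliqueBound s ⊔ starBound n s
    caseB refl sh = Many.caseB-bound {s} {D} sh ν s≥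
    m≡ : m ≡ 3 * s + (1 + D)
    m≡ = suc-injective (≡.trans n≡ (solve 2 (λ t D → con 3 :* (con 1 :+ t) :+ con 2 :+ D := con 1 :+ (con 3 :* (con 1 :+ t) :+ (con 1 :+ D))) refl t D))
    m≡′ : m ≡ 3 * t + 2 + (2 + D)
    m≡′ = ≡.trans m≡ (solve 2 (λ t D → con 3 :* (con 1 :+ t) :+ (con 1 :+ D) := con 3 :* t :+ con 2 :+ (con 2 :+ D)) refl t D)
    room : 3 * t + 3 ≤ m
    room = ≤-trans (+-monoʳ-≤ (3 * t) (≤ᵇ⇒≤ 3 4 _)) (≤-trans (m≤m+n (3 * t + 4) D)
      (≤-reflexive (≡.trans (solve 2 (λ t D → con 3 :* t :+ con 4 :+ D := con 3 :* t :+ con 2 :+ (con 2 :+ D)) refl t D) (sym m≡′))))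
    -- While 15 D ≤ 8 (s - 2), the clique for s absorbs the edges through 0, as then 1 + D ≤ t.
    -- Beyond that the clique bound for `t` is below the star bound, the excess over 3t + 2 having
    -- grown to 2 + D.
    clique : c2 m + cliqueBound t ≤ cliqueBound s ⊔ starBound (suc m) s
    clique with 15 * D ≤? 8 * (t ∸ 1)
    ... | yes q = ≤-trans (subst (λ m → c2 m + cliqueBound t ≤ cliqueBound s) (sym m≡) (c2-clique t (1 + D)
        (*-cancelˡ-≤ 15 (begin
          15 * (1 + D) ≡⟨ *-distribˡ-+ 15 1 D ⟩
          15 + 15 * D ≤⟨ +-monoʳ-≤ 15 (≤-trans q (*-monoˡ-≤ (t ∸ 1) (≤ᵇ⇒≤ 8 15 _))) ⟩
          15 + 15 * (t ∸ 1) ≡⟨ *-distribˡ-+ 15 1 (t ∸ 1) ⟨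
          15 * (1 + (t ∸ 1)) ≡⟨ cong (15 *_) t≡ ⟩
          15 * t ∎))))
      (m≤m⊔n (cliqueBound s) (starBound (suc m) s))
      where
      t≡ : 1 + (t ∸ 1) ≡ t
      t≡ = m+[n∸m]≡n (≤-trans (≤ᵇ⇒≤ 1 33 _) t≥)
    ... | no ¬q = begin
      c2 m + cliqueBound t ≤⟨ +-monoʳ-≤ (c2 m) (subst (λ m → cliqueBound t ≤ starBound m t) (sym m≡′)
        (clique≤star t (2 + D) (wide-above t (2 + D) t≥ (≤-trans small (m≤m+n (15 * (2 + D)) 15))) (≤-trans small (m≤m+n (15 * (2 + D)) 16)))) ⟩
      c2 m + starBound m t ≡⟨ starBound-suc m t ⟩
      starBound (suc m) s ≤⟨ m≤n⊔m (cliqueBound s) (starBound (suc m) s) ⟩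
      cliqueBound s ⊔ starBound (suc m) s ∎
      where
      small : 8 * t ≤ 15 * (2 + D)
      small = begin
        8 * t ≡⟨ cong (8 *_) (m+[n∸m]≡n (≤-trans (≤ᵇ⇒≤ 1 33 _) t≥)) ⟨
        8 * (1 + (t ∸ 1)) ≡⟨ *-distribˡ-+ 8 1 (t ∸ 1) ⟩
        8 + 8 * (t ∸ 1) ≤⟨ +-mono-≤ (≤ᵇ⇒≤ 8 30 _) (<⇒≤ (≰⇒> ¬q)) ⟩
        30 + 15 * D ≡⟨ *-distribˡ-+ 15 2 D ⟨
        15 * (2 + D) ∎
    caseA : ν≤ (delete₀ g) t → edgeCount (suc m) g ≤ cliqueBound s ⊔ starBound (suc m) s
    caseA ν′ = begin
      edgeCount (suc m) g ≤⟨ delete₀-count m g ⟩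
      c2 m + edgeCount m (delete₀ g) ≤⟨ +-monoʳ-≤ (c2 m) (large t t≥ m (delete₀ g) (delete₀-shifted sh) ν′ room) ⟩
      c2 m + (cliqueBound t ⊔ starBound m t) ≡⟨ +-distribˡ-⊔ (c2 m) (cliqueBound t) (starBound m t) ⟩
      (c2 m + cliqueBound t) ⊔ (c2 m + starBound m t) ≤⟨ ⊔-lub clique
        (≤-trans (≤-reflexive (starBound-suc m t)) (m≤n⊔m (cliqueBound s) (starBound (suc m) s))) ⟩
      cliqueBound s ⊔ starBound (suc m) s ∎

-- Sums over all subsets

N : ∀ n → (Subset n → ℕ) → ℕ
N zero    f = f []
N (suc n) f = N n (λ v → f (true ∷ v)) + N n (λ v → f (false ∷ v))

N-cong : ∀ n {f g : Subset n → ℕ} → (∀ v → f v ≡ g v) → N n f ≡ N n g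
N-cong zero    h = h []
N-cong (suc n) h = cong₂ _+_ (N-cong n (λ v → h (true ∷ v))) (N-cong n (λ v → h (false ∷ v)))

N-mono : ∀ n {f g : Subset n → ℕ} → (∀ v → f v ≤ g v) → N n f ≤ N n g
N-mono zero    h = h []
N-mono (suc n) h = +-mono-≤ (N-mono n (λ v → h (true ∷ v))) (N-mono n (λ v → h (false ∷ v)))

N-zero : ∀ n {f : Subset n → ℕ} → (∀ v → f v ≡ 0) → N n f ≡ 0
N-zero zero    h = h []
N-zero (suc n) h = cong₂ _+_ (N-zero n (λ v → h (true ∷ v))) (N-zero n (λ v → h (false ∷ v)))

N-+ : ∀ n (f g : Subset n → ℕ) → N n (λ v → f v + g v) ≡ N n f + N n g
N-+ zero    f g = refl
N-+ (suc n) f g = ≡.trans (cong₂ _+_ (N-+ n (λ v → f (true ∷ v)) (λ v → g (true ∷ v))) (N-+ n (λ v → f (false ∷ v)) (λ v → g (false ∷ v))))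
  (solve 4 (λ a b c d → (a :+ b) :+ (c :+ d) := (a :+ c) :+ (b :+ d)) refl
    (N n (λ v → f (true ∷ v))) (N n (λ v → g (true ∷ v))) (N n (λ v → f (false ∷ v))) (N n (λ v → g (false ∷ v))))

+-≡-split : ∀ {a b c d} → a ≤ c → b ≤ d → a + b ≡ c + d → a ≡ c × b ≡ d
+-≡-split {a} {b} {c} {d} p q e with m≤n⇒m<n∨m≡n p
... | inj₁ lt     = contradiction e (<⇒≢ (+-mono-<-≤ lt q))
... | inj₂ refl = refl , +-cancelˡ-≡ a b d e

N-pointwise : ∀ n {f g : Subset n → ℕ} → (∀ v → f v ≤ g v) → N n f ≡ N n g → ∀ v → f v ≡ g v
N-pointwise zero    h e [] = e
N-pointwise (suc n) h e v with +-≡-split (N-mono n (λ v → h (true ∷ v))) (N-mono n (λ v → h (false ∷ v))) e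
N-pointwise (suc n) h e (true ∷ v)  | p , q = N-pointwise n (λ v → h (true ∷ v)) p v
N-pointwise (suc n) h e (false ∷ v) | p , q = N-pointwise n (λ v → h (false ∷ v)) q v

-- Compressing the positions k and k + 1

sw : ∀ {n} → ℕ → Subset n → Subset n
sw k       []          = []
sw zero    (x ∷ [])    = x ∷ []
sw zero    (x ∷ y ∷ v) = y ∷ x ∷ v
sw (suc k) (x ∷ v)     = x ∷ sw k v

comp : ∀ {n} → ℕ → (Subset n → Bool) → Subset n → Bool
comp k       F []                  = F []
comp zero    F (x ∷ [])            = F (x ∷ [])
comp zero    F (true  ∷ true  ∷ v) = F (true ∷ true ∷ v)
comp zero    F (true  ∷ false ∷ v) = F (true ∷ false ∷ v) ∨ F (false ∷ true ∷ v)
comp zero    F (false ∷ true  ∷ v) = F (false ∷ true ∷ v) ∧ F (true ∷ false ∷ v)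
comp zero    F (false ∷ false ∷ v) = F (false ∷ false ∷ v)
comp (suc k) F (x ∷ v)             = comp k (λ w → F (x ∷ w)) v

TF : ∀ {n} → ℕ → Subset n → Set
TF zero    (true ∷ false ∷ v) = ⊤
TF (suc k) (x ∷ v)            = TF k v
TF _       _                  = ⊥

Stable : ∀ {n} → ℕ → (Subset n → Bool) → Set
Stable k F = ∀ e → TF k e → F (sw k e) ≡ true → F e ≡ true

νF≤ : ∀ {n} → (Subset n → Bool) → ℕ → Set
νF≤ F s = ∀ M → All (λ e → F e ≡ true) M → AllPairs Disjoint M → length M ≤ s

Uniform : ∀ {n} → (Subset n → Bool) → Set
Uniform F = ∀ e → F e ≡ true → ∣ e ∣ ≡ 3

sw-size : ∀ {n} k (e : Subset n) → ∣ sw k e ∣ ≡ ∣ e ∣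
sw-size k       []          = refl
sw-size zero    (x ∷ [])    = refl
sw-size zero    (true ∷ true ∷ v)   = refl
sw-size zero    (true ∷ false ∷ v)  = refl
sw-size zero    (false ∷ true ∷ v)  = refl
sw-size zero    (false ∷ false ∷ v) = refl
sw-size (suc k) (true ∷ v)  = cong suc (sw-size k v)
sw-size (suc k) (false ∷ v) = sw-size k v

sw-∩ : ∀ {n} k (e f : Subset n) → sw k e ∩ sw k f ≡ sw k (e ∩ f)
sw-∩ k       []          []           = refl
sw-∩ zero    (x ∷ [])    (y ∷ [])     = refl
sw-∩ zero    (x ∷ y ∷ v) (x′ ∷ y′ ∷ w) = refl
sw-∩ (suc k) (x ∷ v)     (y ∷ w)      = cong (_ ∷_) (sw-∩ k v w)

sw-⊥ : ∀ {n} k → sw k (Sub.⊥ {n}) ≡ Sub.⊥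
sw-⊥ {zero}        k       = refl
sw-⊥ {suc zero}    zero    = refl
sw-⊥ {suc (suc n)} zero    = refl
sw-⊥ {suc n}       (suc k) = cong (false ∷_) (sw-⊥ k)

comp-new : ∀ {n} k (F : Subset n → Bool) e → comp k F e ≡ true → F e ≡ false → TF k e × F (sw k e) ≡ true
comp-new k       F []                  h q = ⊥-elim (false⇒≢true q h)
comp-new zero    F (x ∷ [])            h q = ⊥-elim (false⇒≢true q h)
comp-new zero    F (true ∷ true ∷ v)   h q = ⊥-elim (false⇒≢true q h)
comp-new zero    F (true ∷ false ∷ v)  h q rewrite q = tt , h
comp-new zero    F (false ∷ true ∷ v)  h q rewrite q = ⊥-elim (false⇒≢true refl h)
comp-new zero    F (false ∷ false ∷ v) h q = ⊥-elim (false⇒≢true q h)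
comp-new (suc k) F (x ∷ v)             h q = comp-new k (λ w → F (x ∷ w)) v h q

∷-injective : ∀ {n x y} {v w : Subset n} → x ∷ v ≡ y ∷ w → x ≡ y × v ≡ w
∷-injective refl = refl , refl

-- `e` contains k, so `f` does not. If `f` contains k + 1, it survives compression only when its
-- swap is in `F` too; otherwise the swap fixes it.
comp-disjoint : ∀ {n} k (F : Subset n → Bool) e f → TF k e → e ∩ f ≡ Sub.⊥ → comp k F f ≡ true → F (sw k f) ≡ true
comp-disjoint zero F (true ∷ false ∷ v) (true ∷ y ∷ w) _ d h with () ← proj₁ (∷-injective d)
comp-disjoint zero F (true ∷ false ∷ v) (false ∷ false ∷ w) _ d h = h
comp-disjoint zero F (true ∷ false ∷ v) (false ∷ true ∷ w) _ d h with F (false ∷ true ∷ w)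
... | true = h
comp-disjoint (suc k) F (x ∷ v) (y ∷ w) t d h = comp-disjoint k (λ w → F (y ∷ w)) v w t (proj₂ (∷-injective d)) h

comp-sw : ∀ {n} k (F : Subset n → Bool) e → comp k F e ≡ true → F e ≡ true ⊎ F (sw k e) ≡ true
comp-sw k F e h with F e in q
... | true  = inj₁ refl
... | false = inj₂ (proj₂ (comp-new k F e h q))

comp-uniform : ∀ {n} k {F : Subset n → Bool} → Uniform F → Uniform (comp k F)
comp-uniform k {F} un e h with comp-sw k F e h
... | inj₁ q = un e q
... | inj₂ q = ≡.trans (sym (sw-size k e)) (un (sw k e) q)

-- A matching of the compressed family is a matching of F after at most one swap.

comp-ν : ∀ {n s} k {F : Subset n → Bool} → νF≤ F s → νF≤ (comp k F) s
comp-ν {n} {s} k {F} ν M all dis with find M all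
  where
  find : ∀ M → All (λ e → comp k F e ≡ true) M → All (λ e → F e ≡ true) M ⊎ Σ (Subset n) (λ e → e ∈ M × F e ≡ false)
  find []      []       = inj₁ []
  find (e ∷ M) (h ∷ hs) with F e in q | find M hs
  ... | false | _                 = inj₂ (e , here refl , q)
  ... | true  | inj₁ a            = inj₁ (q ∷ a)
  ... | true  | inj₂ (f , p , r)  = inj₂ (f , there p , r)
... | inj₁ a = ν M a dis
... | inj₂ (e , p , q) = subst (_≤ s) (length-map (sw k) M) (ν (map (sw k) M) (AllP.map⁺ (swapped M all (others M p dis))) (sw-pairs M dis))
  where
  new = comp-new k F e (All.lookup all p) q
  others : ∀ M → e ∈ M → AllPairs Disjoint M → All (λ f → e ≡ f ⊎ e ∩ f ≡ Sub.⊥) M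
  others (f ∷ M) (here refl) (a ∷ _)  = inj₁ refl ∷ All.map inj₂ a
  others (f ∷ M) (there p)     (a ∷ ds) = inj₂ (≡.trans (∩-comm e f) (All.lookup a p)) ∷ others M p ds
  swapped : ∀ M → All (λ e → comp k F e ≡ true) M → All (λ f → e ≡ f ⊎ e ∩ f ≡ Sub.⊥) M → All (λ f → F (sw k f) ≡ true) M
  swapped []      []       []                = []
  swapped (f ∷ M) (h ∷ hs) (inj₁ refl ∷ os) = proj₂ new ∷ swapped M hs os
  swapped (f ∷ M) (h ∷ hs) (inj₂ d ∷ os)      = comp-disjoint k F e f (proj₁ new) d h ∷ swapped M hs os
  sw-pairs : ∀ M → AllPairs Disjoint M → AllPairs Disjoint (map (sw k) M)
  sw-pairs []      []       = []
  sw-pairs (f ∷ M) (a ∷ ds) = AllP.map⁺ (All.map (λ {w} d → ≡.trans (sw-∩ k f w) (≡.trans (cong (sw k) d) (sw-⊥ k))) a) ∷ sw-pairs M ds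

weightSum : ∀ {n} → (Subset n → ℕ) → (Subset n → Bool) → ℕ
weightSum {n} w F = N n (λ v → [ F v ] * w v)

private
  regroup : ∀ a b c d → (a + b) + (c + d) ≡ (a + d) + (b + c)
  regroup = solve 4 (λ a b c d → (a :+ b) :+ (c :+ d) := (a :+ d) :+ (b :+ c)) refl

  exchange-≤ : ∀ a b {p q} → p ≤ q → [ a ∨ b ] * p + [ b ∧ a ] * q ≤ [ a ] * p + [ b ] * q
  exchange-≤ true  true  le = ≤-refl
  exchange-≤ true  false le = ≤-refl
  exchange-≤ false true  {p} {q} le = ≤-trans (≤-reflexive (+-identityʳ (p + 0))) (+-monoˡ-≤ 0 le)
  exchange-≤ false false le = ≤-refl

  exchange-≡ : ∀ a b {p q} → p < q → [ a ∨ b ] * p + [ b ∧ a ] * q ≡ [ a ] * p + [ b ] * q → b ≡ true → a ≡ true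
  exchange-≡ true  b    lt e _ = refl
  exchange-≡ false true {p} {q} lt e _ = contradiction (≡.trans (sym (≡.trans (+-identityʳ (p + 0)) (+-identityʳ p))) (≡.trans e (+-identityʳ q))) (<⇒≢ lt)

comp-weight : ∀ {n} k (w : Subset n → ℕ) (F : Subset n → Bool) → (∀ e → TF k e → w e ≤ w (sw k e)) →
  weightSum w (comp k F) ≤ weightSum w F
comp-weight {zero}        k       w F h = ≤-refl
comp-weight {suc zero}    zero    w F h = ≤-refl
comp-weight {suc (suc n)} zero    w F h = begin
  (tt′ + N n (λ v → [ F (true ∷ false ∷ v) ∨ F (false ∷ true ∷ v) ] * w (true ∷ false ∷ v))) +
  (N n (λ v → [ F (false ∷ true ∷ v) ∧ F (true ∷ false ∷ v) ] * w (false ∷ true ∷ v)) + ff)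
    ≡⟨ regroup tt′ _ _ ff ⟩
  (tt′ + ff) + (N n (λ v → [ F (true ∷ false ∷ v) ∨ F (false ∷ true ∷ v) ] * w (true ∷ false ∷ v)) +
    N n (λ v → [ F (false ∷ true ∷ v) ∧ F (true ∷ false ∷ v) ] * w (false ∷ true ∷ v)))
    ≡⟨ cong ((tt′ + ff) +_) (N-+ n _ _) ⟨
  (tt′ + ff) + N n (λ v → [ F (true ∷ false ∷ v) ∨ F (false ∷ true ∷ v) ] * w (true ∷ false ∷ v) +
    [ F (false ∷ true ∷ v) ∧ F (true ∷ false ∷ v) ] * w (false ∷ true ∷ v))
    ≤⟨ +-monoʳ-≤ (tt′ + ff) (N-mono n (λ v → exchange-≤ (F (true ∷ false ∷ v)) (F (false ∷ true ∷ v)) (h (true ∷ false ∷ v) tt))) ⟩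
  (tt′ + ff) + N n (λ v → [ F (true ∷ false ∷ v) ] * w (true ∷ false ∷ v) + [ F (false ∷ true ∷ v) ] * w (false ∷ true ∷ v))
    ≡⟨ cong ((tt′ + ff) +_) (N-+ n _ _) ⟩
  (tt′ + ff) + (tf + ft) ≡⟨ regroup tt′ tf ft ff ⟨
  (tt′ + tf) + (ft + ff) ∎
  where
  open ≤-Reasoning
  tt′ = N n (λ v → [ F (true ∷ true ∷ v) ] * w (true ∷ true ∷ v))
  tf = N n (λ v → [ F (true ∷ false ∷ v) ] * w (true ∷ false ∷ v))
  ft = N n (λ v → [ F (false ∷ true ∷ v) ] * w (false ∷ true ∷ v))
  ff = N n (λ v → [ F (false ∷ false ∷ v) ] * w (false ∷ false ∷ v))
comp-weight {suc n} (suc k) w F h = +-mono-≤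
  (comp-weight k (λ v → w (true ∷ v)) (λ v → F (true ∷ v)) (λ e t → h (true ∷ e) t))
  (comp-weight k (λ v → w (false ∷ v)) (λ v → F (false ∷ v)) (λ e t → h (false ∷ e) t))

-- A set that compression moves would make the total weight strictly smaller, so equality of the
-- totals means that nothing moves.
comp-stable : ∀ {n} k (w : Subset n → ℕ) (F : Subset n → Bool) → (∀ e → TF k e → w e < w (sw k e)) →
  weightSum w (comp k F) ≡ weightSum w F → Stable k F
comp-stable {suc (suc n)} zero w F h e (true ∷ false ∷ v) _ q =
  exchange-≡ (F (true ∷ false ∷ v)) (F (false ∷ true ∷ v)) (h (true ∷ false ∷ v) tt) (N-pointwise n
    (λ v → exchange-≤ (F (true ∷ false ∷ v)) (F (false ∷ true ∷ v)) (<⇒≤ (h (true ∷ false ∷ v) tt)))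
    (≡.trans (N-+ n _ _) (≡.trans (+-cancelˡ-≡ (tt′ + ff) _ _ (≡.trans (sym (regroup tt′ _ _ ff)) (≡.trans e (regroup tt′ _ _ ff)))) (sym (N-+ n _ _)))) v) q
  where
  tt′ = N n (λ v → [ F (true ∷ true ∷ v) ] * w (true ∷ true ∷ v))
  ff = N n (λ v → [ F (false ∷ false ∷ v) ] * w (false ∷ false ∷ v))
comp-stable {suc n} (suc k) w F h e (x ∷ v) t q with +-≡-split
  (comp-weight k (λ v → w (true ∷ v)) (λ v → F (true ∷ v)) (λ e t → <⇒≤ (h (true ∷ e) t)))
  (comp-weight k (λ v → w (false ∷ v)) (λ v → F (false ∷ v)) (λ e t → <⇒≤ (h (false ∷ e) t))) e
comp-stable {suc n} (suc k) w F h e (true ∷ v)  t q | p , _ = comp-stable k (λ v → w (true ∷ v)) (λ v → F (true ∷ v)) (λ e t → h (true ∷ e) t) p v t q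
comp-stable {suc n} (suc k) w F h e (false ∷ v) t q | _ , p = comp-stable k (λ v → w (false ∷ v)) (λ v → F (false ∷ v)) (λ e t → h (false ∷ e) t) p v t q

comp-count : ∀ {n} k (F : Subset n → Bool) → N n (λ v → [ comp k F v ]) ≡ N n (λ v → [ F v ])
comp-count {zero}        k       F = refl
comp-count {suc zero}    zero    F = refl
comp-count {suc (suc n)} zero    F = begin
  (a + N n (λ v → [ F (true ∷ false ∷ v) ∨ F (false ∷ true ∷ v) ])) + (N n (λ v → [ F (false ∷ true ∷ v) ∧ F (true ∷ false ∷ v) ]) + d)
    ≡⟨ regroup a _ _ d ⟩
  (a + d) + (N n (λ v → [ F (true ∷ false ∷ v) ∨ F (false ∷ true ∷ v) ]) + N n (λ v → [ F (false ∷ true ∷ v) ∧ F (true ∷ false ∷ v) ]))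
    ≡⟨ cong ((a + d) +_) (≡.trans (sym (N-+ n _ _)) (≡.trans (N-cong n (λ v → ∨∧ (F (true ∷ false ∷ v)) (F (false ∷ true ∷ v)))) (N-+ n _ _))) ⟩
  (a + d) + (N n (λ v → [ F (true ∷ false ∷ v) ]) + N n (λ v → [ F (false ∷ true ∷ v) ])) ≡⟨ regroup a _ _ d ⟨
  (a + N n (λ v → [ F (true ∷ false ∷ v) ])) + (N n (λ v → [ F (false ∷ true ∷ v) ]) + d) ∎
  where
  open ≡-Reasoning
  a = N n (λ v → [ F (true ∷ true ∷ v) ])
  d = N n (λ v → [ F (false ∷ false ∷ v) ])
  ∨∧ : ∀ a b → [ a ∨ b ] + [ b ∧ a ] ≡ [ a ] + [ b ]
  ∨∧ true  true  = refl
  ∨∧ true  false = refl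
  ∨∧ false true  = refl
  ∨∧ false false = refl
comp-count {suc n} (suc k) F = cong₂ _+_ (comp-count k (λ v → F (true ∷ v))) (comp-count k (λ v → F (false ∷ v)))

-- The sum of the elements: the element p lies in exactly p of the tails.
wt : ∀ {n} → Subset n → ℕ
wt []      = 0
wt (x ∷ v) = ∣ v ∣ + wt v

wt-sw : ∀ {n} k (e : Subset n) → TF k e → wt e < wt (sw k e)
wt-sw zero    (true ∷ false ∷ v) _ = ≤-refl
wt-sw (suc k) (x ∷ v)            t = +-mono-≤-< (≤-reflexive (sym (sw-size k v))) (wt-sw k v t)

TF-bound : ∀ {n} k (e : Subset n) → TF k e → k < n
TF-bound zero    (true ∷ false ∷ v) _ = z<s
TF-bound (suc k) (x ∷ v)            t = s<s (TF-bound k v t)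

-- Compressions are repeated while the total weight drops, which bounds their number. Testing k < n
-- suffices, since stability is void for larger k.
compress : ∀ {n s} (F : Subset n → Bool) → Uniform F → νF≤ F s →
  Σ (Subset n → Bool) λ F′ → Uniform F′ × νF≤ F′ s × N n (λ v → [ F′ v ]) ≡ N n (λ v → [ F v ]) × (∀ k → Stable k F′)
compress {n} {s} F un ν = go (weightSum wt F) F ≤-refl un ν
  where
  search : ∀ F m → (∃ λ k → weightSum wt (comp k F) < weightSum wt F) ⊎ (∀ k → k < m → weightSum wt (comp k F) ≡ weightSum wt F)
  search F zero    = inj₂ λ _ ()
  search F (suc m) with m≤n⇒m<n∨m≡n (comp-weight m wt F (λ e t → <⇒≤ (wt-sw m e t)))
  ... | inj₁ lt = inj₁ (m , lt)
  ... | inj₂ eq with search F m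
  ...   | inj₁ r = inj₁ r
  ...   | inj₂ r = inj₂ extend
    where
    extend : ∀ k → k < suc m → weightSum wt (comp k F) ≡ weightSum wt F
    extend k lt with m≤n⇒m<n∨m≡n (s≤s⁻¹ lt)
    ... | inj₁ lt′    = r k lt′
    ... | inj₂ refl = eq
  go : ∀ fuel F → weightSum wt F ≤ fuel → Uniform F → νF≤ F s →
    Σ (Subset n → Bool) λ F′ → Uniform F′ × νF≤ F′ s × N n (λ v → [ F′ v ]) ≡ N n (λ v → [ F v ]) × (∀ k → Stable k F′)
  go fuel F le un ν with search F n
  ... | inj₂ eq = F , un , ν , refl , λ k e t → comp-stable k wt F (wt-sw k) (eq k (TF-bound k e t)) e t
  go zero       F le un ν | inj₁ (k , lt) = contradiction (<-≤-trans lt le) λ ()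
  go (suc fuel) F le un ν | inj₁ (k , lt) with go fuel (comp k F) (s≤s⁻¹ (<-≤-trans lt le)) (comp-uniform k un) (comp-ν k ν)
  ... | F′ , un′ , ν′ , c , st = F′ , un′ , ν′ , ≡.trans c (comp-count k F) , st

-- From stable families of subsets to shifted relations

ind : ∀ n → (ℕ → Bool) → Subset n
ind zero    p = []
ind (suc n) p = p 0 ∷ ind n (p ∘ suc)

ind-cong : ∀ n {p q} → (∀ i → p i ≡ q i) → ind n p ≡ ind n q
ind-cong zero    h = refl
ind-cong (suc n) h = cong₂ _∷_ (h 0) (ind-cong n (h ∘ suc))

ind-∩ : ∀ n {p q} → (∀ i → p i ≡ true → q i ≡ true → ⊥) → ind n p ∩ ind n q ≡ Sub.⊥
ind-∩ zero    h = refl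
ind-∩ (suc n) {p} {q} h = cong₂ _∷_ (both (p 0) (q 0) (h 0)) (ind-∩ n (λ i → h (suc i)))
  where
  both : ∀ a b → (a ≡ true → b ≡ true → ⊥) → a ∧ b ≡ false
  both true  true  h = ⊥-elim (h refl refl)
  both true  false h = refl
  both false b     h = refl

ind-∨-size : ∀ n p q → ∣ ind n (λ i → p i ∨ q i) ∣ ≤ ∣ ind n p ∣ + ∣ ind n q ∣
ind-∨-size zero    p q = z≤n
ind-∨-size (suc n) p q with p 0 | q 0
... | true  | true  = s≤s (≤-trans (ind-∨-size n (p ∘ suc) (q ∘ suc)) (+-monoʳ-≤ ∣ ind n (p ∘ suc) ∣ (n≤1+n _)))
... | true  | false = s≤s (ind-∨-size n (p ∘ suc) (q ∘ suc))
... | false | true  = ≤-trans (s≤s (ind-∨-size n (p ∘ suc) (q ∘ suc))) (≤-reflexive (sym (+-suc ∣ ind n (p ∘ suc) ∣ _)))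
... | false | false = ind-∨-size n (p ∘ suc) (q ∘ suc)

ind-none-size : ∀ n → ∣ ind n (λ _ → false) ∣ ≡ 0
ind-none-size zero    = refl
ind-none-size (suc n) = ind-none-size n

ind-one-size : ∀ n a → ∣ ind n (_≡ᵇ a) ∣ ≤ 1
ind-one-size zero    a       = z≤n
ind-one-size (suc n) zero    = s≤s (≤-reflexive (ind-none-size n))
ind-one-size (suc n) (suc a) = ind-one-size n a

ind-out-size : ∀ n a → n ≤ a → ∣ ind n (_≡ᵇ a) ∣ ≡ 0
ind-out-size zero    a       _       = refl
ind-out-size (suc n) (suc a) (s≤s p) = ind-out-size n a p

one-of : ℕ → ℕ → ℕ → ℕ → Bool
one-of a b c i = (i ≡ᵇ a) ∨ ((i ≡ᵇ b) ∨ (i ≡ᵇ c))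

triple : ∀ n → ℕ → ℕ → ℕ → Subset n
triple n a b c = ind n (one-of a b c)

TF-ind : ∀ n k p → suc k < n → p k ≡ true → p (suc k) ≡ false → TF k (ind n p)
TF-ind (suc (suc n)) zero    p _        q r rewrite q | r = tt
TF-ind (suc n)       (suc k) p (s<s lt) q r = TF-ind n k (p ∘ suc) lt q r

sw-ind : ∀ n k {p q} → suc k < n → q k ≡ p (suc k) → q (suc k) ≡ p k → (∀ i → i ≢ k → i ≢ suc k → q i ≡ p i) →
  sw k (ind n p) ≡ ind n q
sw-ind (suc (suc n)) zero    _        a b h = cong₂ _∷_ (sym a) (cong₂ _∷_ (sym b) (ind-cong n (λ i → sym (h (suc (suc i)) (λ ()) (λ ())))))
sw-ind (suc n)       (suc k) (s<s lt) a b h = cong₂ _∷_ (sym (h 0 (λ ()) (λ ())))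
  (sw-ind n k lt a b (λ i p q → h (suc i) (p ∘ suc-injective) (q ∘ suc-injective)))

≡ᵇ-refl : ∀ a → (a ≡ᵇ a) ≡ true
≡ᵇ-refl zero    = refl
≡ᵇ-refl (suc a) = ≡ᵇ-refl a

≡ᵇ-true⇒≡ : ∀ {a b} → (a ≡ᵇ b) ≡ true → a ≡ b
≡ᵇ-true⇒≡ {a} {b} e = ≡ᵇ⇒≡ a b (subst T (sym e) tt)

module FromFamily {n} (F : Subset n → Bool) (un : Uniform F) (st : ∀ k → Stable k F) where

  rel : ℕ → ℕ → ℕ → Bool
  rel a b c = F (triple n a b c)

  private
    ∨-swap : ∀ x y z → x ∨ (y ∨ z) ≡ y ∨ (x ∨ z)
    ∨-swap true  true  z = refl
    ∨-swap true  false z = refl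
    ∨-swap false true  z = refl
    ∨-swap false false z = refl

    sym₁′ : ∀ a b c → rel a b c ≡ rel b a c
    sym₁′ a b c = cong F (ind-cong n (λ i → ∨-swap (i ≡ᵇ a) (i ≡ᵇ b) (i ≡ᵇ c)))

    sym₂′ : ∀ a b c → rel a b c ≡ rel a c b
    sym₂′ a b c = cong F (ind-cong n (λ i → cong ((i ≡ᵇ a) ∨_) (∨-comm (i ≡ᵇ b) (i ≡ᵇ c))))

    two : ∀ b c → ∣ ind n (λ i → (i ≡ᵇ b) ∨ (i ≡ᵇ c)) ∣ ≤ 2
    two b c = ≤-trans (ind-∨-size n (_≡ᵇ b) (_≡ᵇ c)) (+-mono-≤ (ind-one-size n b) (ind-one-size n c))

    supp′ : ∀ {a b c} → rel a b c ≡ true → a < n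
    supp′ {a} {b} {c} h with a <? n
    ... | yes lt = lt
    ... | no ¬lt = contradiction (begin
      3 ≡⟨ un _ h ⟨
      ∣ triple n a b c ∣ ≤⟨ ind-∨-size n (_≡ᵇ a) (λ i → (i ≡ᵇ b) ∨ (i ≡ᵇ c)) ⟩
      ∣ ind n (_≡ᵇ a) ∣ + ∣ ind n (λ i → (i ≡ᵇ b) ∨ (i ≡ᵇ c)) ∣ ≡⟨ cong (_+ ∣ ind n (λ i → (i ≡ᵇ b) ∨ (i ≡ᵇ c)) ∣) (ind-out-size n a (≮⇒≥ ¬lt)) ⟩
      ∣ ind n (λ i → (i ≡ᵇ b) ∨ (i ≡ᵇ c)) ∣ ≤⟨ two b c ⟩
      2 ∎) 1+n≰n
      where open ≤-Reasoning

    irr′ : ∀ {a b c} → rel a b c ≡ true → a ≢ b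
    irr′ {a} {.a} {c} h refl = 1+n≰n (begin
      3 ≡⟨ un _ h ⟨
      ∣ triple n a a c ∣ ≡⟨ cong ∣_∣ (ind-cong n (λ i → idem (i ≡ᵇ a) (i ≡ᵇ c))) ⟩
      ∣ ind n (λ i → (i ≡ᵇ a) ∨ (i ≡ᵇ c)) ∣ ≤⟨ two a c ⟩
      2 ∎)
      where
      open ≤-Reasoning
      idem : ∀ x y → x ∨ (x ∨ y) ≡ x ∨ y
      idem true  y = refl
      idem false y = refl

    adjacent : ∀ {a b c} → rel (suc a) b c ≡ true → a ≢ b → a ≢ c → rel a b c ≡ true
    adjacent {a} {b} {c} h a≢b a≢c = st a (triple n a b c)
      (TF-ind n a (one-of a b c) (supp′ h) (cong (_∨ ((a ≡ᵇ b) ∨ (a ≡ᵇ c))) (≡ᵇ-refl a))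
        (cong₂ _∨_ (≢⇒≡ᵇ-false {suc a} {a} (λ e → <⇒≢ ≤-refl (sym e))) out))
      (subst (λ v → F v ≡ true) (sym (sw-ind n a {one-of a b c} {one-of (suc a) b c} (supp′ h)
        (≡.trans (cong₂ _∨_ (≢⇒≡ᵇ-false {a} {suc a} (<⇒≢ ≤-refl)) in′) (sym (cong₂ _∨_ (≢⇒≡ᵇ-false {suc a} {a} (λ e → <⇒≢ ≤-refl (sym e))) out)))
        (≡.trans (cong (_∨ ((suc a ≡ᵇ b) ∨ (suc a ≡ᵇ c))) (≡ᵇ-refl a)) (sym (cong (_∨ ((a ≡ᵇ b) ∨ (a ≡ᵇ c))) (≡ᵇ-refl a))))
        (λ i p q → cong (_∨ ((i ≡ᵇ b) ∨ (i ≡ᵇ c))) (≡.trans (≢⇒≡ᵇ-false {i} {suc a} q) (sym (≢⇒≡ᵇ-false p)))))) h)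
      where
      in′ : (a ≡ᵇ b) ∨ (a ≡ᵇ c) ≡ false
      in′ = cong₂ _∨_ (≢⇒≡ᵇ-false a≢b) (≢⇒≡ᵇ-false a≢c)
      out : (suc a ≡ᵇ b) ∨ (suc a ≡ᵇ c) ≡ false
      out = cong₂ _∨_ (≢⇒≡ᵇ-false (irr′ h)) (≢⇒≡ᵇ-false (irr′ {suc a} {c} {b} (≡.trans (sym₂′ (suc a) c b) h)))

    -- An element blocking the way is moved in place of a.

    blocked : ∀ x {c} a′ → rel (suc x) x c ≡ true → a′ < x → a′ ≢ c → rel a′ x c ≡ true
    down′ : ∀ a {b c} a′ → rel a b c ≡ true → a′ < a → a′ ≢ b → a′ ≢ c → rel a′ b c ≡ true
    down′ (suc x) {b} {c} a′ h lt a′≢b a′≢c with m≤n⇒m<n∨m≡n (s≤s⁻¹ lt)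
    ... | inj₂ refl = adjacent h a′≢b a′≢c
    ... | inj₁ a′<x with x ≟ b | x ≟ c
    ...   | no x≢b | no x≢c = down′ x a′ (adjacent h x≢b x≢c) a′<x a′≢b a′≢c
    ...   | yes refl | _ = blocked x a′ h a′<x a′≢c
    ...   | no x≢b | yes refl = ≡.trans (sym₂′ a′ b x) (blocked x a′ (≡.trans (sym₂′ (suc x) x b) h) a′<x a′≢b)

    blocked x {c} a′ h a′<x a′≢c = ≡.trans (sym₁′ a′ x c) (adjacent (≡.trans (sym₁′ (suc x) a′ c)
      (down′ x a′ (≡.trans (sym₁′ x (suc x) c) h) a′<x (<⇒≢ (<-trans a′<x ≤-refl)) a′≢c))
      (λ e → <⇒≢ a′<x (sym e)) (irr′ {x} {c} {suc x} (≡.trans (sym₂′ x c (suc x)) (≡.trans (sym₁′ x (suc x) c) h))))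

  shifted : Shifted n rel
  shifted = record { sym₁ = sym₁′ ; sym₂ = sym₂′ ; supp = supp′ ; irr = irr′ ; down = λ a′ h → down′ _ a′ h }

  rel-ν : ∀ {s} → νF≤ F s → ν≤ rel s
  rel-ν {s} ν M (edges , unM) = subst (_≤ s) (length-map tr M) (ν (map tr M) (AllP.map⁺ edges) (pairs M unM))
    where
    tr : Tri → Subset n
    tr e = triple n (i e) (j e) (k e)
    cases : ∀ e x → one-of (i e) (j e) (k e) x ≡ true → x ∈ vl e
    cases (tri a b c) x h with x ≡ᵇ a in p | x ≡ᵇ b in q
    ... | true  | _     = here (≡ᵇ-true⇒≡ p)
    ... | false | true  = there (here (≡ᵇ-true⇒≡ q))
    ... | false | false = there (there (here (≡ᵇ-true⇒≡ h)))
    fresh : ∀ e M → Unique (vl e ++ verts M) → All (λ f → tr e ∩ tr f ≡ Sub.⊥) M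
    fresh e []      _ = []
    fresh e (f ∷ M) ((xa ∷ xb ∷ a) ∷ (xc ∷ b) ∷ c ∷ un) = ind-∩ n apart ∷
      fresh e M ((xa ∷ xb ∷ AllP.++⁻ʳ (vl f) a) ∷ (xc ∷ AllP.++⁻ʳ (vl f) b) ∷ AllP.++⁻ʳ (vl f) c ∷ Unique-++⁻ʳ (vl f) un)
      where
      apart : ∀ x → one-of (i e) (j e) (k e) x ≡ true → one-of (i f) (j f) (k f) x ≡ true → ⊥
      apart x p q with cases e x p | cases f x q
      ... | here refl                 | r = All.lookup (AllP.++⁻ˡ (vl f) a) r refl
      ... | there (here refl)         | r = All.lookup (AllP.++⁻ˡ (vl f) b) r refl
      ... | there (there (here refl)) | r = All.lookup (AllP.++⁻ˡ (vl f) c) r refl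
    pairs : ∀ M → Unique (verts M) → AllPairs Disjoint (map tr M)
    pairs []      _  = []
    pairs (e ∷ M) un = AllP.map⁺ (fresh e M un) ∷ pairs M (Unique-++⁻ʳ (vl e) un)

-- Sums over k-subsets, and families given by lists

Supported : ∀ {n} → ℕ → (Subset n → ℕ) → Set
Supported k f = ∀ v → ∣ v ∣ ≢ k → f v ≡ 0

N-0 : ∀ n (f : Subset n → ℕ) → Supported 0 f → N n f ≡ f (ind n (λ _ → false))
N-0 zero    f h = refl
N-0 (suc n) f h = ≡.trans (cong (_+ N n (λ v → f (false ∷ v))) (N-zero n (λ v → h (true ∷ v) (λ ())))) (N-0 n _ (λ v → h (false ∷ v)))

N-1 : ∀ n (f : Subset n → ℕ) → Supported 1 f → N n f ≡ S1 (range n) (λ a → f (ind n (_≡ᵇ a)))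
N-1 zero    f h = h [] (λ ())
N-1 (suc n) f h = cong₂ _+_ (N-0 n _ (λ v ne → h (true ∷ v) (ne ∘ suc-injective)))
  (≡.trans (N-1 n _ (λ v → h (false ∷ v))) (sym (S1-map suc (λ a → f (ind (suc n) (_≡ᵇ a))) (range n))))

N-2 : ∀ n (f : Subset n → ℕ) → Supported 2 f → N n f ≡ S2 (range n) (λ a b → f (ind n (λ i → (i ≡ᵇ a) ∨ (i ≡ᵇ b))))
N-2 zero    f h = h [] (λ ())
N-2 (suc n) f h = cong₂ _+_
  (≡.trans (N-1 n _ (λ v ne → h (true ∷ v) (ne ∘ suc-injective))) (sym (S1-map suc (λ b → f (ind (suc n) (λ i → (i ≡ᵇ 0) ∨ (i ≡ᵇ b)))) (range n))))
  (≡.trans (N-2 n _ (λ v → h (false ∷ v))) (sym (S2-map suc (λ a b → f (ind (suc n) (λ i → (i ≡ᵇ a) ∨ (i ≡ᵇ b)))) (range n))))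

-- Splitting subsets by whether they contain 0 reproduces the recursion of `S3` on `range`.
N-3 : ∀ n (f : Subset n → ℕ) → Supported 3 f → N n f ≡ S3 (range n) (λ a b c → f (triple n a b c))
N-3 zero    f h = h [] (λ ())
N-3 (suc n) f h = cong₂ _+_
  (≡.trans (N-2 n _ (λ v ne → h (true ∷ v) (ne ∘ suc-injective))) (sym (S2-map suc (λ b c → f (triple (suc n) 0 b c)) (range n))))
  (≡.trans (N-3 n _ (λ v → h (false ∷ v))) (sym (S3-map suc (λ a b c → f (triple (suc n) a b c)) (range n))))

eqv : ∀ {n} → Subset n → Subset n → Bool
eqv []          []          = true
eqv (true ∷ v)  (true ∷ w)  = eqv v w
eqv (false ∷ v) (false ∷ w) = eqv v w
eqv (_ ∷ _)     (_ ∷ _)     = false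

eqv-sound : ∀ {n} (v w : Subset n) → eqv v w ≡ true → v ≡ w
eqv-sound []          []          _ = refl
eqv-sound (true ∷ v)  (true ∷ w)  h = cong (true ∷_) (eqv-sound v w h)
eqv-sound (false ∷ v) (false ∷ w) h = cong (false ∷_) (eqv-sound v w h)

N-eqv : ∀ n (w : Subset n) → N n (λ v → [ eqv v w ]) ≡ 1
N-eqv zero    []          = refl
N-eqv (suc n) (true ∷ w)  = cong₂ _+_ (N-eqv n w) (N-zero n (λ v → refl))
N-eqv (suc n) (false ∷ w) = cong₂ _+_ (N-zero n (λ v → refl)) (N-eqv n w)

member : ∀ {n} → List (Subset n) → Subset n → Bool
member []      v = false
member (e ∷ L) v = eqv v e ∨ member L v

member-sound : ∀ {n} L (v : Subset n) → member L v ≡ true → v ∈ L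
member-sound (e ∷ L) v h with eqv v e in q
... | true  = here (eqv-sound v e q)
... | false = there (member-sound L v h)

length≤count : ∀ {n} (L : List (Subset n)) → Unique L → length L ≤ N n (λ v → [ member L v ])
length≤count {n} []      _        = z≤n
length≤count {n} (e ∷ L) (a ∷ un) = begin
  1 + length L ≤⟨ +-mono-≤ (≤-reflexive (sym (N-eqv n e))) (length≤count L un) ⟩
  N n (λ v → [ eqv v e ]) + N n (λ v → [ member L v ]) ≡⟨ N-+ n (λ v → [ eqv v e ]) (λ v → [ member L v ]) ⟨
  N n (λ v → [ eqv v e ] + [ member L v ]) ≤⟨ N-mono n disjointly ⟩
  N n (λ v → [ eqv v e ∨ member L v ]) ∎
  where
  open ≤-Reasoning
  disjointly : ∀ v → [ eqv v e ] + [ member L v ] ≤ [ eqv v e ∨ member L v ]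
  disjointly v with eqv v e in p | member L v in q
  ... | true  | false = ≤-refl
  ... | false | _     = ≤-refl
  ... | true  | true  = contradiction (sym (eqv-sound v e p)) (All.lookup a (member-sound L v q))

nC0≡1 : ∀ n → n C 0 ≡ 1
nC0≡1 zero    = refl
nC0≡1 (suc n) = refl

c2≡C : ∀ n → c2 n ≡ n C 2
c2≡C zero    = refl
c2≡C (suc n) = ≡.trans (cong₂ _+_ (sym (nC1≡n n)) (c2≡C n)) (nCk+nC[k+1]≡[n+1]C[k+1] n 1)

c3≡C : ∀ n → c3 n ≡ n C 3
c3≡C zero    = refl
c3≡C (suc n) = ≡.trans (cong₂ _+_ (c2≡C n) (c3≡C n)) (nCk+nC[k+1]≡[n+1]C[k+1] n 2)

-- The two extremal 3-graphs

pick : ∀ n → (Subset n → Bool) → List (Subset n)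
pick zero    F = if F [] then [] ∷ [] else []
pick (suc n) F = map (true ∷_) (pick n (λ v → F (true ∷ v))) ++ map (false ∷_) (pick n (λ v → F (false ∷ v)))

pick-length : ∀ n F → length (pick n F) ≡ N n (λ v → [ F v ])
pick-length zero F with F []
... | true  = refl
... | false = refl
pick-length (suc n) F = ≡.trans (length-++ (map (true ∷_) (pick n (λ v → F (true ∷ v)))))
  (cong₂ _+_ (≡.trans (length-map _ (pick n _)) (pick-length n _)) (≡.trans (length-map _ (pick n _)) (pick-length n _)))

pick-sound : ∀ n F → All (λ v → F v ≡ true) (pick n F)
pick-sound zero F with F [] in q
... | true  = q ∷ []
... | false = []
pick-sound (suc n) F = AllP.++⁺ (AllP.map⁺ (pick-sound n (λ v → F (true ∷ v)))) (AllP.map⁺ (pick-sound n (λ v → F (false ∷ v))))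

pick-complete : ∀ n F v → F v ≡ true → v ∈ pick n F
pick-complete zero F [] h rewrite h = here refl
pick-complete (suc n) F (true ∷ v)  h = ∈-++⁺ˡ (∈-map⁺ (true ∷_) (pick-complete n (λ v → F (true ∷ v)) v h))
pick-complete (suc n) F (false ∷ v) h = ∈-++⁺ʳ (map (true ∷_) (pick n (λ v → F (true ∷ v)))) (∈-map⁺ (false ∷_) (pick-complete n (λ v → F (false ∷ v)) v h))

pick-unique : ∀ n F → Unique (pick n F)
pick-unique zero F with F []
... | true  = [] ∷ []
... | false = []
pick-unique (suc n) F = UniqueP.++⁺ (UniqueP.map⁺ (proj₂ ∘ ∷-injective) (pick-unique n _))
  (UniqueP.map⁺ (proj₂ ∘ ∷-injective) (pick-unique n _)) apart
  where
  apart : ∀ {v} → ¬ (v ∈ map (true ∷_) (pick n (λ v → F (true ∷ v))) × v ∈ map (false ∷_) (pick n (λ v → F (false ∷ v))))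
  apart (p , q) with ∈-map⁻ (true ∷_) p | ∈-map⁻ (false ∷_) q
  ... | _ , _ , refl | _ , _ , ()

graph : ∀ {n} (F : Subset n → Bool) → Uniform F → ThreeGraph n
graph {n} F un = record
  { edges    = pick n F
  ; uniform  = All.map (λ {e} → un e) (pick-sound n F)
  ; distinct = pick-unique n F
  }

-- Bounds both matching numbers: an edge of the clique meets its vertex set in three elements, and
-- an edge of the star meets the centres in at least one.
disjoint-traces : ∀ {n} (c : Subset n) M → AllPairs Disjoint M → S1 M (λ e → ∣ e ∩ c ∣) ≤ ∣ c ∣
disjoint-traces [] M _ = ≤-reflexive (≡.trans (S1-cong M (λ { [] → refl })) (S1-zero M))
disjoint-traces (x ∷ c) M dis = begin
  S1 M (λ e → ∣ e ∩ (x ∷ c) ∣) ≡⟨ S1-cong M split ⟩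
  S1 M (λ e → [ head e ∧ x ] + ∣ tail e ∩ c ∣) ≡⟨ S1-+ (λ e → [ head e ∧ x ]) (λ e → ∣ tail e ∩ c ∣) M ⟩
  S1 M (λ e → [ head e ∧ x ]) + S1 M (λ e → ∣ tail e ∩ c ∣)
    ≤⟨ +-mono-≤ (heads x M dis) (≤-trans (≤-reflexive (sym (S1-map tail (λ e → ∣ e ∩ c ∣) M))) (disjoint-traces c (map tail M) (tails M dis))) ⟩
  [ x ] + ∣ c ∣ ≡⟨ cons x ⟩
  ∣ x ∷ c ∣ ∎
  where
  open ≤-Reasoning
  cons : ∀ x → [ x ] + ∣ c ∣ ≡ ∣ x ∷ c ∣
  cons true  = refl
  cons false = refl
  split : ∀ e → ∣ e ∩ (x ∷ c) ∣ ≡ [ head e ∧ x ] + ∣ tail e ∩ c ∣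
  split (y ∷ e) with y ∧ x
  ... | true  = refl
  ... | false = refl
  tails : ∀ M → AllPairs Disjoint M → AllPairs Disjoint (map tail M)
  tails []      []       = []
  tails (e ∷ M) (a ∷ ds) = AllP.map⁺ (All.map (λ {f} → go e f) a) ∷ tails M ds
    where
    go : ∀ e f → e ∩ f ≡ Sub.⊥ → tail e ∩ tail f ≡ Sub.⊥
    go (_ ∷ _) (_ ∷ _) d = proj₂ (∷-injective d)
  heads : ∀ {n} x (M : List (Subset (suc n))) → AllPairs Disjoint M → S1 M (λ e → [ head e ∧ x ]) ≤ [ x ]
  heads x []      []       = z≤n
  heads x ((false ∷ e) ∷ M) (a ∷ ds) = heads x M ds
  heads x ((true ∷ e) ∷ M)  (a ∷ ds) = ≤-trans (+-monoʳ-≤ [ x ] (≤-trans (S1-mono {ψ = λ _ → 0} a (λ {f} → none f))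
    (≤-reflexive (S1-zero M)))) (≤-reflexive (+-identityʳ [ x ]))
    where
    none : ∀ f → (true ∷ e) ∩ f ≡ Sub.⊥ → [ head f ∧ x ] ≤ 0
    none (true ∷ f)  d with () ← proj₁ (∷-injective d)
    none (false ∷ f) d = z≤n

sub : ∀ {n} → Subset n → Subset n → Bool
sub []      []      = true
sub (x ∷ v) (y ∷ c) = (not x ∨ y) ∧ sub v c

sub-∩ : ∀ {n} (v c : Subset n) → sub v c ≡ true → ∣ v ∩ c ∣ ≡ ∣ v ∣
sub-∩ []          []          h = refl
sub-∩ (true ∷ v)  (true ∷ c)  h = cong suc (sub-∩ v c h)
sub-∩ (false ∷ v) (y ∷ c)     h = sub-∩ v c h

not-sub-∩ : ∀ {n} (v d : Subset n) → sub v d ≡ false → 1 ≤ ∣ v ∩ ∁ d ∣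
not-sub-∩ []          []          ()
not-sub-∩ (true ∷ v)  (true ∷ d)  h = not-sub-∩ v d h
not-sub-∩ (true ∷ v)  (false ∷ d) h = s≤s z≤n
not-sub-∩ (false ∷ v) (y ∷ d)     h = not-sub-∩ v d h

N-sub : ∀ n k (c : Subset n) → N n (λ v → [ (∣ v ∣ ≡ᵇ k) ∧ sub v c ]) ≡ ∣ c ∣ C k
N-sub zero    zero    []          = refl
N-sub zero    (suc k) []          = sym (k>n⇒nCk≡0 (z<s {k}))
N-sub (suc n) k       (false ∷ c) = ≡.trans (cong (_+ N n (λ v → [ (∣ v ∣ ≡ᵇ k) ∧ sub v c ])) (N-zero n (λ v → cong [_] (∧-zeroʳ (suc ∣ v ∣ ≡ᵇ k))))) (N-sub n k c)
N-sub (suc n) zero    (true ∷ c)  = ≡.trans (cong (_+ N n (λ v → [ (∣ v ∣ ≡ᵇ 0) ∧ sub v c ])) (N-zero n (λ v → refl))) (≡.trans (N-sub n 0 c) (nC0≡1 ∣ c ∣))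
N-sub (suc n) (suc k) (true ∷ c)  = ≡.trans (cong₂ _+_ (N-sub n k c) (N-sub n (suc k) c)) (nCk+nC[k+1]≡[n+1]C[k+1] ∣ c ∣ k)

three? : ∀ {n} → Subset n → Bool
three? v = ∣ v ∣ ≡ᵇ 3

three?-sound : ∀ {n} (v : Subset n) {b} → three? v ∧ b ≡ true → ∣ v ∣ ≡ 3 × b ≡ true
three?-sound v {b} h with three? v in q
... | true = ≡ᵇ-true⇒≡ q , h

-- One matching serves both constructions: its triples fill the first 3s vertices, which lie in the
-- clique, and each of them receives one centre of the star.
blocks : ∀ s n → s * 3 ≤ n → List (Subset n)
blocks zero    n _ = []
blocks (suc s) (suc (suc (suc n))) (s≤s (s≤s (s≤s le))) =
  (true ∷ true ∷ true ∷ Sub.⊥) ∷ map (λ v → false ∷ false ∷ false ∷ v) (blocks s n le)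

blocks-length : ∀ s n le → length (blocks s n le) ≡ s
blocks-length zero    n _ = refl
blocks-length (suc s) (suc (suc (suc n))) (s≤s (s≤s (s≤s le))) = cong suc (≡.trans (length-map _ (blocks s n le)) (blocks-length s n le))

blocks-disjoint : ∀ s n le → AllPairs Disjoint (blocks s n le)
blocks-disjoint zero    n _ = []
blocks-disjoint (suc s) (suc (suc (suc n))) (s≤s (s≤s (s≤s le))) =
  AllP.map⁺ (All.universal (λ v → cong (λ w → false ∷ false ∷ false ∷ w) (∩-zeroˡ v)) (blocks s n le)) ∷ lift (blocks-disjoint s n le)
  where
  lift : ∀ {M : List (Subset n)} → AllPairs Disjoint M → AllPairs Disjoint (map (λ v → false ∷ false ∷ false ∷ v) M)
  lift []       = []
  lift (a ∷ ds) = AllP.map⁺ (All.map (cong (λ w → false ∷ false ∷ false ∷ w)) a) ∷ lift ds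

blocks-size : ∀ s n le → All (λ v → ∣ v ∣ ≡ 3) (blocks s n le)
blocks-size zero    n _ = []
blocks-size (suc s) (suc (suc (suc n))) (s≤s (s≤s (s≤s le))) = cong (3 +_) (∣⊥∣≡0 n) ∷ AllP.map⁺ (blocks-size s n le)

sub-⊥ : ∀ {n} (c : Subset n) → sub Sub.⊥ c ≡ true
sub-⊥ []      = refl
sub-⊥ (x ∷ c) = sub-⊥ c

initial : (m n : ℕ) → Subset n
initial zero    n       = Sub.⊥
initial (suc m) zero    = []
initial (suc m) (suc n) = true ∷ initial m n

initial-size : ∀ m n → m ≤ n → ∣ initial m n ∣ ≡ m
initial-size zero    n       _        = ∣⊥∣≡0 n
initial-size (suc m) (suc n) (s≤s le) = cong suc (initial-size m n le)

blocks-initial : ∀ s n le m → s * 3 ≤ m → All (λ v → sub v (initial m n) ≡ true) (blocks s n le)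
blocks-initial zero    n _ m _ = []
blocks-initial (suc s) (suc (suc (suc n))) (s≤s (s≤s (s≤s le))) (suc (suc (suc m))) (s≤s (s≤s (s≤s le′))) =
  sub-⊥ (initial m n) ∷ AllP.map⁺ (blocks-initial s n le m le′)

-- The complement of {0, 3, …, 3s − 3}: the star is centred at one vertex of each block.

noncentres : ∀ s n → s * 3 ≤ n → Subset n
noncentres zero    n _ = Sub.⊤
noncentres (suc s) (suc (suc (suc n))) (s≤s (s≤s (s≤s le))) = false ∷ true ∷ true ∷ noncentres s n le

noncentres-size : ∀ s n le → ∣ noncentres s n le ∣ + s ≡ n
noncentres-size zero    n _ = ≡.trans (+-identityʳ _) (∣⊤∣≡n n)
noncentres-size (suc s) (suc (suc (suc n))) (s≤s (s≤s (s≤s le))) = cong (2 +_) (≡.trans (+-suc _ s) (cong suc (noncentres-size s n le)))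

centres-size : ∀ s n le → ∣ ∁ (noncentres s n le) ∣ ≡ s
centres-size zero    n _ = go n
  where
  go : ∀ n → ∣ ∁ (Sub.⊤ {n}) ∣ ≡ 0
  go zero    = refl
  go (suc n) = go n
centres-size (suc s) (suc (suc (suc n))) (s≤s (s≤s (s≤s le))) = cong suc (centres-size s n le)

blocks-centred : ∀ s n le → All (λ v → sub v (noncentres s n le) ≡ false) (blocks s n le)
blocks-centred zero    n _ = []
blocks-centred (suc s) (suc (suc (suc n))) (s≤s (s≤s (s≤s le))) = refl ∷ AllP.map⁺ (blocks-centred s n le)

module Constructions (s n : ℕ) (le : 3 * s + 3 ≤ n) where
  private
    le₃ : s * 3 ≤ n
    le₃ = ≤-trans (≤-reflexive (*-comm s 3)) (≤-trans (m≤m+n (3 * s) 3) le)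

    le₂ : 3 * s + 2 ≤ n
    le₂ = ≤-trans (+-monoʳ-≤ (3 * s) (n≤1+n 2)) le

    c = initial (3 * s + 2) n
    d = noncentres s n le₃

    matching : (F : Subset n → Bool) (un : Uniform F) → All (λ v → F v ≡ true) (blocks s n le₃) →
      Σ (List (Subset n)) λ M → IsMatching (graph F un) M × length M ≡ s
    matching F un a = blocks s n le₃ , (All.map (λ {v} → pick-complete n F v) a , blocks-disjoint s n le₃) , blocks-length s n le₃

    in-graph : (F : Subset n → Bool) (un : Uniform F) → ∀ {M} → All (_∈ pick n F) M → All (λ v → F v ≡ true) M
    in-graph F un = All.map (All.lookup (pick-sound n F))

  cliqueF starF : Subset n → Bool
  cliqueF v = three? v ∧ sub v c
  starF v = three? v ∧ not (sub v d)

  clique-uniform : Uniform cliqueF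
  clique-uniform v h = proj₁ (three?-sound v h)

  star-uniform : Uniform starF
  star-uniform v h = proj₁ (three?-sound v h)

  clique-size : size (graph cliqueF clique-uniform) ≡ (3 * s + 2) C 3
  clique-size = ≡.trans (pick-length n cliqueF) (≡.trans (N-sub n 3 c) (cong (_C 3) (initial-size (3 * s + 2) n le₂)))

  star-size : size (graph starF star-uniform) ≡ n C 3 ∸ (n ∸ s) C 3
  star-size = ≡.trans (pick-length n starF) (sym (≡.trans (cong₂ _∸_ (sym total) (sym avoiding)) (m+n∸n≡m (N n (λ v → [ starF v ])) (N n (λ v → [ three? v ∧ sub v d ])))))
    where
    size-d : ∣ d ∣ ≡ n ∸ s
    size-d = ≡.trans (sym (m+n∸n≡m ∣ d ∣ s)) (cong (_∸ s) (noncentres-size s n le₃))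
    avoiding : N n (λ v → [ three? v ∧ sub v d ]) ≡ (n ∸ s) C 3
    avoiding = ≡.trans (N-sub n 3 d) (cong (_C 3) size-d)
    sub-⊤ : ∀ {n} (v : Subset n) → sub v Sub.⊤ ≡ true
    sub-⊤ []          = refl
    sub-⊤ (true ∷ v)  = sub-⊤ v
    sub-⊤ (false ∷ v) = sub-⊤ v
    parts : ∀ a b t → t ≡ true → [ a ∧ not b ] + [ a ∧ b ] ≡ [ a ∧ t ]
    parts true  true  _ refl = refl
    parts true  false _ refl = refl
    parts false b     t _      = refl
    total : N n (λ v → [ starF v ]) + N n (λ v → [ three? v ∧ sub v d ]) ≡ n C 3
    total = ≡.trans (sym (N-+ n (λ v → [ starF v ]) (λ v → [ three? v ∧ sub v d ])))
      (≡.trans (N-cong n (λ v → parts (three? v) (sub v d) (sub v Sub.⊤) (sub-⊤ v)))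
        (≡.trans (N-sub n 3 Sub.⊤) (cong (_C 3) (∣⊤∣≡n n))))

  clique-ν : MatchingNumberIs (graph cliqueF clique-uniform) s
  clique-ν = matching cliqueF clique-uniform (All.zipWith (λ { {v} (p , q) → yes-clique v p q }) (blocks-size s n le₃ , blocks-initial s n le₃ (3 * s + 2) s3≤)) , bound
    where
    s3≤ : s * 3 ≤ 3 * s + 2
    s3≤ = ≤-trans (≤-reflexive (*-comm s 3)) (m≤m+n (3 * s) 2)
    yes-clique : ∀ v → ∣ v ∣ ≡ 3 → sub v c ≡ true → cliqueF v ≡ true
    yes-clique v p q rewrite p = q
    bound : ∀ M → IsMatching (graph cliqueF clique-uniform) M → length M ≤ s
    bound M (a , dis) = s≤s⁻¹ (*-cancelˡ-< 3 (length M) (suc s) (begin-strict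
      3 * length M ≡⟨ *-comm 3 (length M) ⟩
      length M * 3 ≡⟨ S1-const 3 M ⟨
      S1 M (λ _ → 3) ≤⟨ S1-mono (in-graph cliqueF clique-uniform a) (λ {v} h → ≤-reflexive (sym
        (≡.trans (sub-∩ v c (proj₂ (three?-sound v h))) (proj₁ (three?-sound v h))))) ⟩
      S1 M (λ v → ∣ v ∩ c ∣) ≤⟨ disjoint-traces c M dis ⟩
      ∣ c ∣ ≡⟨ initial-size (3 * s + 2) n le₂ ⟩
      3 * s + 2 <⟨ ≤-reflexive (sym (≡.trans (*-suc 3 s) (≡.trans (+-comm 3 (3 * s)) (+-suc (3 * s) 2)))) ⟩
      3 * suc s ∎))
      where open ≤-Reasoning

  star-ν : MatchingNumberIs (graph starF star-uniform) s
  star-ν = matching starF star-uniform (All.zipWith (λ { {v} (p , q) → yes-star v p q }) (blocks-size s n le₃ , blocks-centred s n le₃)) , bound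
    where
    yes-star : ∀ v → ∣ v ∣ ≡ 3 → sub v d ≡ false → starF v ≡ true
    yes-star v p q rewrite p | q = refl
    not-true : ∀ {b} → not b ≡ true → b ≡ false
    not-true {false} _ = refl
    bound : ∀ M → IsMatching (graph starF star-uniform) M → length M ≤ s
    bound M (a , dis) = begin
      length M ≡⟨ *-identityʳ (length M) ⟨
      length M * 1 ≡⟨ S1-const 1 M ⟨
      S1 M (λ _ → 1) ≤⟨ S1-mono (in-graph starF star-uniform a) (λ {v} h → not-sub-∩ v d (not-true (proj₂ (three?-sound v h)))) ⟩
      S1 M (λ v → ∣ v ∩ ∁ d ∣) ≤⟨ disjoint-traces (∁ d) M dis ⟩
      ∣ ∁ d ∣ ≡⟨ centres-size s n le₃ ⟩
      s ∎
      where open ≤-Reasoning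

  extremal : Σ (ThreeGraph n) λ F → MatchingNumberIs F s × size F ≡ Mbound n s
  extremal with ≤-total ((3 * s + 2) C 3) (n C 3 ∸ (n ∸ s) C 3)
  ... | inj₁ le = graph starF star-uniform , star-ν , ≡.trans star-size (sym (m≤n⇒m⊔n≡n le))
  ... | inj₂ ge = graph cliqueF clique-uniform , clique-ν , ≡.trans clique-size (sym (m≥n⇒m⊔n≡m ge))

-- From arbitrary 3-graphs to shifted ones

upper-bound : ∀ s n → 33 ≤ s → 3 * s + 3 ≤ n → (F : ThreeGraph n) → MatchingNumberIs F s → size F ≤ Mbound n s
upper-bound s n s≥ le F (_ , ν) with compress {s = s} (member E) uniformE νE
  where
  E = ThreeGraph.edges F
  uniformE : Uniform (member E)
  uniformE e h = All.lookup (ThreeGraph.uniform F) (member-sound E e h)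
  νE : νF≤ (member E) s
  νE M a dis = ν M (All.map (λ {e} → member-sound E e) a , dis)
... | F′ , un , ν′ , count , st = begin
  length (ThreeGraph.edges F) ≤⟨ length≤count (ThreeGraph.edges F) (ThreeGraph.distinct F) ⟩
  N n (λ v → [ member (ThreeGraph.edges F) v ]) ≡⟨ count ⟨
  N n (λ v → [ F′ v ]) ≡⟨ N-3 n (λ v → [ F′ v ]) (λ v ne → cong [_] (≢true⇒≡false (λ h → ne (un v h)))) ⟩
  edgeCount n (FromFamily.rel F′ un st) ≤⟨ large s s≥ n _ (FromFamily.shifted F′ un st) (FromFamily.rel-ν F′ un st ν′) le ⟩
  c3 (3 * s + 2) ⊔ (c3 n ∸ c3 (n ∸ s)) ≡⟨ cong₂ _⊔_ (c3≡C (3 * s + 2)) (cong₂ _∸_ (c3≡C n) (c3≡C (n ∸ s))) ⟩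
  Mbound n s ∎
  where open ≤-Reasoning

theorem1 : (s n : ℕ) → 33 ≤ s → 3 * s + 3 ≤ n →
    ((F : ThreeGraph n) → MatchingNumberIs F s → size F ≤ Mbound n s)
    × Σ (ThreeGraph n) (λ F → MatchingNumberIs F s × size F ≡ Mbound n s)
theorem1 s n s≥ le = upper-bound s n s≥ le , Constructions.extremal s n le
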